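{- Let $\mathbb{F}$ be an algebraically closed field and let $e\le h\le \ell$ be positive integers. Then \[ \underline{Q}(\langle e,h,\ell\rangle)=\mathrm{GR}(\langle e,h,\ell\rangle)=\begin{cases} eh-\left\lfloor \frac{(e+h-\ell)^2}{4}\right\rfloor & \text{if } e+h\ge \ell,\\ eh & \text{otherwise.}\end{cases} \] In particular, $\underline{Q}(\langle m,m,m\rangle)=\mathrm{GR}(\langle m,m,m\rangle)=\lceil \tfrac34 m^2\rceil$ for every positive integer $m$.
   Context: The matrix multiplication tensor $\langle e,h,\ell\rangle\in\mathbb{F}^{eh\times h\ell\times \ell e}$ is the tensor whose trilinear map is $\mathbb{F}^{e\times h}\times\mathbb{F}^{h\times\ell}\times\mathbb{F}^{\ell\times e}\to\mathbb{F}$, $(X,Y,Z)\mapsto \mathrm{Tr}(XYZ)$. For a tensor $T\in\mathbb{F}^{n_1\times n_2\times n_3}$ with trilinear form $T(x,y,z)=\sum_{i,j,k}T_{i,j,k}x_iy_jz_k$ and $T(x,y,\cdot)=(T(x,y,e_k))_k$, the geometric rank is $\mathrm{GR}(T)=\operatorname{codim}\{(x,y)\in\mathbb{F}^{n_1}\times\mathbb{F}^{n_2}: T(x,y,\cdot)=0\}$ (codimension of an affine variety, i.e. $n_1+n_2$ minus its dimension). For tensors $S\in\mathbb{F}^{m_1\times m_2\times m_3}$, $T\in\mathbb{F}^{n_1\times n_2\times n_3}$ and matrices $A,B,C$, set $(A,B,C)\cdot T=(\sum_{a,b,c}A_{ia}B_{jb}C_{kc}T_{a,b,c})_{i,j,k}$.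 We write $S\unlhd T$ (degeneration) if for some $e'\in\mathbb{N}$ there are tensors $S_1,\dots,S_{e'}$ over $\mathbb{F}$ and matrices $A(\varepsilon),B(\varepsilon),C(\varepsilon)$ with entries Laurent polynomials in a formal variable $\varepsilon$ such that $S+\varepsilon S_1+\dots+\varepsilon^{e'}S_{e'}=(A(\varepsilon),B(\varepsilon),C(\varepsilon))\cdot T$. $I_n$ denotes the $n\times n\times n$ diagonal tensor with ones on the diagonal. The border subrank is $\underline{Q}(T)=\max\{n\in\mathbb{N}: I_n\unlhd T\}$. -}

module Defs where

open import Level using (Level; _⊔_)
open import Algebra.Bundles using (CommutativeRing)
open import Data.Nat as ℕ using (ℕ; zero; suc; _≤_; _∸_; _/_; _≤?_)
open import Data.Integer as ℤ using (ℤ; +_; -[1+_])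
open import Data.Fin as Fin using (Fin; _↑ˡ_; _↑ʳ_; remQuot)
open import Data.Fin.Properties using (_≟_)
open import Data.List using (List; []; _∷_; map; replicate; _++_)
open import Data.Product using (Σ; ∃; ∃-syntax; _×_; _,_)
open import Function.Definitions using (Injective)
open import Relation.Binary.PropositionalEquality using (_≡_)
open import Relation.Nullary using (¬_; yes; no)

record Field (c ℓ : Level) : Set (Level.suc (c ⊔ ℓ)) where
  field
    commutativeRing : CommutativeRing c ℓ
  open CommutativeRing commutativeRing public
  field
    1#≉0# : ¬ (1# ≈ 0#)
    inverse : ∀ x → ¬ (x ≈ 0#) → ∃[ y ] (x * y ≈ 1#)

module _ {c ℓ} (F : Field c ℓ) where
  open Field F

  ∑ : ∀ {n} → (Fin n → Carrier) → Carrier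
  ∑ {zero}  f = 0#
  ∑ {suc n} f = f Fin.zero + ∑ (λ i → f (Fin.suc i))

  _^_ : Carrier → ℕ → Carrier
  x ^ zero  = 1#
  x ^ suc n = x * (x ^ n)

  IsAlgClosed : Set (c ⊔ ℓ)
  IsAlgClosed = ∀ (n : ℕ) (cs : Fin (suc n) → Carrier) →
    ∃[ x ] ((x ^ suc n) + ∑ (λ i → cs i * (x ^ Fin.toℕ i)) ≈ 0#)

  Tensor : ℕ → ℕ → ℕ → Set c
  Tensor n₁ n₂ n₃ = Fin n₁ → Fin n₂ → Fin n₃ → Carrier

  δ : ∀ {n} → Fin n → Fin n → Carrier
  δ i j with i ≟ j
  ... | yes _ = 1#
  ... | no  _ = 0#

  I : (n : ℕ) → Tensor n n n
  I n i j k = δ i j * δ j k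

  -- matrix multiplication tensor ⟨e,h,l⟩ ∈ F^{eh × hl × le}:
  -- index (a,b) ∈ [e]×[h], (b',c) ∈ [h]×[l], (c',a') ∈ [l]×[e];
  -- entry 1 iff b=b', c=c', a=a' (trilinear form Tr(XYZ)).
  MM : (e h l : ℕ) → Tensor (e ℕ.* h) (h ℕ.* l) (l ℕ.* e)
  MM e h l p q r with remQuot {e} h p | remQuot {h} l q | remQuot {l} e r
  ... | (a , b) | (b' , c') | (c'' , a') = δ b b' * (δ c' c'' * δ a a')

  -- Univariate polynomials in ε (coefficient lists, lowest degree first)

  polyAdd : List Carrier → List Carrier → List Carrier
  polyAdd []       q        = q
  polyAdd (a ∷ p)  []       = a ∷ p
  polyAdd (a ∷ p)  (b ∷ q)  = (a + b) ∷ polyAdd p q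

  polyMul : List Carrier → List Carrier → List Carrier
  polyMul []      q = []
  polyMul (a ∷ p) q = polyAdd (map (a *_) q) (0# ∷ polyMul p q)

  lookupℕ : List Carrier → ℕ → Carrier
  lookupℕ []      _       = 0#
  lookupℕ (a ∷ p) zero    = a
  lookupℕ (a ∷ p) (suc n) = lookupℕ p n

  -- Laurent polynomials in ε: (k , cs) denotes  Σ_i cs[i] ε^(i - k)
  record Laurent : Set c where
    constructor laurent
    field
      shift  : ℕ
      coeffs : List Carrier

  coeffL : Laurent → ℤ → Carrier
  coeffL (laurent k cs) z with z ℤ.+ (+ k)
  ... | + n      = lookupℕ cs n
  ... | -[1+ _ ] = 0#

  zeroL : Laurent
  zeroL = laurent 0 []

  constL : Carrier → Laurent
  constL a = laurent 0 (a ∷ [])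

  _+L_ : Laurent → Laurent → Laurent
  laurent k₁ p +L laurent k₂ q =
    laurent (k₁ ℕ.+ k₂) (polyAdd (replicate k₂ 0# ++ p) (replicate k₁ 0# ++ q))

  _*L_ : Laurent → Laurent → Laurent
  laurent k₁ p *L laurent k₂ q = laurent (k₁ ℕ.+ k₂) (polyMul p q)

  ∑L : ∀ {n} → (Fin n → Laurent) → Laurent
  ∑L {zero}  f = zeroL
  ∑L {suc n} f = f Fin.zero +L ∑L (λ i → f (Fin.suc i))

  act : ∀ {m₁ m₂ m₃ n₁ n₂ n₃} →
        (Fin m₁ → Fin n₁ → Laurent) → (Fin m₂ → Fin n₂ → Laurent) →
        (Fin m₃ → Fin n₃ → Laurent) → Tensor n₁ n₂ n₃ →
        Fin m₁ → Fin m₂ → Fin m₃ → Laurent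
  act A B C T i j k =
    ∑L λ a → ∑L λ b → ∑L λ c →
      A i a *L (B j b *L (C k c *L constL (T a b c)))

  -- Degeneration S ⊴ T: S + ε S₁ + … + ε^e' S_e' = (A(ε),B(ε),C(ε))·T
  -- i.e. every entry of (A,B,C)·T has zero coefficients at negative powers
  -- of ε and its ε^0 coefficient is the corresponding entry of S (the
  -- positive-power coefficients are the arbitrary tensors S₁,…,S_e').
  _⊴_ : ∀ {m₁ m₂ m₃ n₁ n₂ n₃} → Tensor m₁ m₂ m₃ → Tensor n₁ n₂ n₃ → Set (c ⊔ ℓ)
  _⊴_ {m₁} {m₂} {m₃} {n₁} {n₂} {n₃} S T =
    Σ (Fin m₁ → Fin n₁ → Laurent) λ A →
    Σ (Fin m₂ → Fin n₂ → Laurent) λ B →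
    Σ (Fin m₃ → Fin n₃ → Laurent) λ C →
      (∀ i j k (n : ℕ) → coeffL (act A B C T i j k) -[1+ n ] ≈ 0#) ×
      (∀ i j k → coeffL (act A B C T i j k) (+ 0) ≈ S i j k)

  BorderSubrankIs : ∀ {n₁ n₂ n₃} → Tensor n₁ n₂ n₃ → ℕ → Set (c ⊔ ℓ)
  BorderSubrankIs T r = (I r ⊴ T) × (∀ n → I n ⊴ T → n ≤ r)

  data Poly (n : ℕ) : Set c where
    con  : Carrier → Poly n
    var  : Fin n → Poly n
    _⊕_  : Poly n → Poly n → Poly n
    _⊗_  : Poly n → Poly n → Poly n

  eval : ∀ {n} → Poly n → (Fin n → Carrier) → Carrier
  eval (con a)  x = a
  eval (var i)  x = x i
  eval (p ⊕ q)  x = eval p x + eval q x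
  eval (p ⊗ q)  x = eval p x * eval q x

  -- Dimension of a subset V ⊆ F^N (used for the algebraic set below):
  -- the coordinates σ(0),…,σ(d-1) are algebraically independent on V if
  -- every polynomial in them vanishing on V is the zero polynomial
  -- (as a function on F^d; over the infinite field F this is the same as
  -- being the zero polynomial).  dim V = max number of algebraically
  -- independent coordinate functions (= transcendence degree of F[V]).
  IndepOn : ∀ {N d} → ((Fin N → Carrier) → Set ℓ) → (Fin d → Fin N) → Set (c ⊔ ℓ)
  IndepOn {N} {d} V σ =
    ∀ (f : Poly d) → (∀ p → V p → eval f (λ i → p (σ i)) ≈ 0#) →
      ∀ (a : Fin d → Carrier) → eval f a ≈ 0#

  DimIs : ∀ {N} → ((Fin N → Carrier) → Set ℓ) → ℕ → Set (c ⊔ ℓ)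
  DimIs {N} V d =
    (Σ (Fin d → Fin N) λ σ → Injective _≡_ _≡_ σ × IndepOn V σ) ×
    (∀ m (σ : Fin m → Fin N) → Injective _≡_ _≡_ σ → IndepOn V σ → m ≤ d)

  ZeroSet : ∀ {n₁ n₂ n₃} → Tensor n₁ n₂ n₃ → (Fin (n₁ ℕ.+ n₂) → Carrier) → Set ℓ
  ZeroSet {n₁} {n₂} {n₃} T p =
    ∀ (k : Fin n₃) → ∑ (λ i → ∑ (λ j → T i j k * (p (i ↑ˡ n₂) * p (n₁ ↑ʳ j)))) ≈ 0#

  GeometricRankIs : ∀ {n₁ n₂ n₃} → Tensor n₁ n₂ n₃ → ℕ → Set (c ⊔ ℓ)
  GeometricRankIs {n₁} {n₂} T r = ∃[ d ] (DimIs (ZeroSet T) d × r ℕ.+ d ≡ n₁ ℕ.+ n₂)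

formula : ℕ → ℕ → ℕ → ℕ
formula e h l with l ≤? e ℕ.+ h
... | yes _ = e ℕ.* h ∸ (((e ℕ.+ h ∸ l) ℕ.* (e ℕ.+ h ∸ l)) / 4)
... | no  _ = e ℕ.* h

ceil3m²/4 : ℕ → ℕ
ceil3m²/4 m = (3 ℕ.* (m ℕ.* m) ℕ.+ 3) / 4

{-# OPTIONS --safe #-}
module Submission where

-- Let V be the zero set of T in F^N, N = n₁ + n₂. If I_n ⊴ T and m coordinates are
-- algebraically independent on V, then m + n ≤ N: the degeneration makes the linear space
-- L = {(Aᵀu , Bᵀu)} meet V only in 0 for a suitable invertible value of ε, because the
-- quadrics T(Aᵀu , Bᵀu , Cᵀ·) are u_k² + O(ε); so V × Fⁿ → F^N, (p , u) ↦ p − L u, is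
-- finite, and counting monomials of bounded degree gives the inequality. Hence for
-- n + m = N a degeneration to I_n and m independent coordinates certify that both the
-- border subrank and the geometric rank equal n. For matrix multiplication the former is
-- Strassen's monomial degeneration, supported on the cells (i , j) of [e] × [h] whose
-- antidiagonal i + j lies in a central window of length l, and the latter are the
-- coordinates of the component {rank X ≤ r, rank Y ≤ h − r} of {XY = 0}, r = ⌊max(e + h − l, 0)/2⌋.

open import Defs
open import Level using (Level; _⊔_)
open import Algebra.Solver.Ring.AlmostCommutativeRing using (fromCommutativeRing; _-Raw-AlmostCommutative⟶_)
import Algebra.Solver.Ring
open import Data.Nat as ℕ using (ℕ; zero; suc; z≤n; s≤s; _≤_)
import Data.Nat.Properties as ℕ
import Data.Nat.Tactic.RingSolver as ℕ-Solver
open import Data.Integer as ℤ using (ℤ)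
import Data.Integer.Properties as ℤ
import Data.Integer.Tactic.RingSolver as ℤ-Solver
open import Data.Fin as Fin using (Fin; zero; suc; toℕ; fromℕ<; splitAt; remQuot; combine; punchIn; punchOut; _↑ˡ_; _↑ʳ_)
open import Data.Fin.Properties as Fin using (_≟_; toℕ<n; toℕ-injective; toℕ-fromℕ<; splitAt-↑ˡ; splitAt-↑ʳ; splitAt⁻¹-↑ˡ; splitAt⁻¹-↑ʳ; join-splitAt; ↑ˡ-injective; ↑ʳ-injective; remQuot-combine; combine-remQuot; combine-injective; punchIn-punchOut; pigeonhole)
open import Data.List using (List; []; _∷_; _++_; length; map; replicate; drop; removeAt) renaming (lookup to lookupL)
open import Data.List.Properties using (length-removeAt′)
open import Data.Vec using (Vec; []; _∷_; lookup)
open import Data.Maybe using (Maybe; just; nothing)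
open import Data.Product using (Σ; Σ-syntax; ∃-syntax; _×_; _,_; proj₁; proj₂; uncurry)
open import Data.Sum using (_⊎_; inj₁; inj₂; [_,_]′)
open import Function using (_∘_; _$_)
open import Function.Definitions using (Injective)
open import Relation.Binary.PropositionalEquality as ≡ using (_≡_; _≢_)
open import Relation.Nullary using (¬_; yes; no; contradiction)

-- Equality in the field is not assumed decidable, so generic points are not found by avoiding
-- roots: algebraic closedness is used to solve P(x) = 1, which makes the value visibly invertible.
-- Finiteness over the coordinates s is obtained by linear algebra. A word of length n + 1 in the n
-- letters u_i repeats a letter, hence equals u_k u_k w. Adding to it the O(ε) part of the k-th
-- quadric times w gives one equation for each of the n^(n+1) words, with matrix identity + O(ε); on
-- V × Fⁿ the right-hand sides involve only words of length at most n, with exponents of s at most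
-- 2. At an ε that makes the pivots invertible, every word of length n + 1 is therefore such a
-- combination. Since L is built from the matrices at ε, this ε is chosen first, from the entries of
-- the degenerated tensor alone. Multiplication by a coordinate then raises the exponents of s by at
-- most 2, so the d^(m+n) monomials with exponents below d in the m independent coordinates and u
-- lie in the span of (2d(m+n) + 1)^N (n+1)^n functions, too few for large d if m + n > N.

module RingFacts {c ℓ} (F : Field c ℓ) where
  open import Data.Integer using (+_; -[1+_])
  open Field F hiding (zero)
  open import Algebra.Properties.Ring ring using (-0#≈0#; -‿+-comm; -‿involutive; -‿distribˡ-*; -‿distribʳ-*)
  open import Algebra.Properties.Semiring.Mult.TCOptimised semiring using (×-homo-+; ×1-homo-*; 1+×) renaming (_×_ to _·_)
  open import Relation.Binary.Reasoning.Setoid setoid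

  private
    ⟦_⟧ : ℤ → Carrier
    ⟦ + n ⟧ = n · 1#
    ⟦ -[1+ n ] ⟧ = - (suc n · 1#)

    cancel : ∀ a b x → (x + a) - (x + b) ≈ a - b
    cancel a b x = begin
      (x + a) - (x + b) ≈⟨ +-cong (+-comm x a) (sym (-‿+-comm x b)) ⟩
      (a + x) + (- x - b) ≈⟨ +-assoc _ _ _ ⟩
      a + (x + (- x - b)) ≈⟨ +-congˡ (+-assoc _ _ _) ⟨
      a + ((x - x) - b) ≈⟨ +-congˡ (+-congʳ (-‿inverseʳ x)) ⟩
      a + (0# - b) ≈⟨ +-congˡ (+-identityˡ _) ⟩
      a - b ∎

    ⊖-homo : ∀ m n → ⟦ m ℤ.⊖ n ⟧ ≈ m · 1# - n · 1#
    ⊖-homo m zero = sym (trans (+-congˡ -0#≈0#) (+-identityʳ _))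
    ⊖-homo zero (suc n) = sym (+-identityˡ _)
    ⊖-homo (suc m) (suc n) = begin
      ⟦ suc m ℤ.⊖ suc n ⟧ ≡⟨ ≡.cong ⟦_⟧ (ℤ.[1+m]⊖[1+n]≡m⊖n m n) ⟩
      ⟦ m ℤ.⊖ n ⟧ ≈⟨ ⊖-homo m n ⟩
      m · 1# - n · 1# ≈⟨ cancel _ _ 1# ⟨
      (1# + m · 1#) - (1# + n · 1#) ≈⟨ +-cong (1+× m 1#) (-‿cong (1+× n 1#)) ⟨
      suc m · 1# - suc n · 1# ∎

    neg-homo : ∀ x → ⟦ ℤ.- x ⟧ ≈ - ⟦ x ⟧
    neg-homo (+ zero) = sym -0#≈0#
    neg-homo (+ suc n) = refl
    neg-homo -[1+ n ] = sym (-‿involutive _)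

    +-homo : ∀ x y → ⟦ x ℤ.+ y ⟧ ≈ ⟦ x ⟧ + ⟦ y ⟧
    +-homo (+ m) (+ n) = ×-homo-+ 1# m n
    +-homo (+ m) -[1+ n ] = ⊖-homo m (suc n)
    +-homo -[1+ m ] (+ n) = trans (⊖-homo n (suc m)) (+-comm _ _)
    +-homo -[1+ m ] -[1+ n ] = begin
      - (suc (suc (m ℕ.+ n)) · 1#) ≡⟨ ≡.cong (λ k → - (suc k · 1#)) (ℕ.+-suc m n) ⟨
      - ((suc m ℕ.+ suc n) · 1#) ≈⟨ -‿cong (×-homo-+ 1# (suc m) (suc n)) ⟩
      - (suc m · 1# + suc n · 1#) ≈⟨ -‿+-comm _ _ ⟨
      - (suc m · 1#) - (suc n · 1#) ∎

    *-homo⁺ : ∀ m y → ⟦ + m ℤ.* y ⟧ ≈ ⟦ + m ⟧ * ⟦ y ⟧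
    *-homo⁺ m (+ n) = trans (reflexive (≡.cong ⟦_⟧ (≡.sym (ℤ.pos-* m n)))) (×1-homo-* m n)
    *-homo⁺ m -[1+ n ] = begin
      ⟦ + m ℤ.* ℤ.- (+ suc n) ⟧ ≡⟨ ≡.cong ⟦_⟧ (ℤ.neg-distribʳ-* (+ m) (+ suc n)) ⟨
      ⟦ ℤ.- (+ m ℤ.* + suc n) ⟧ ≈⟨ neg-homo (+ m ℤ.* + suc n) ⟩
      - ⟦ + m ℤ.* + suc n ⟧ ≈⟨ -‿cong (*-homo⁺ m (+ suc n)) ⟩
      - (m · 1# * suc n · 1#) ≈⟨ -‿distribʳ-* _ _ ⟩
      m · 1# * - (suc n · 1#) ∎

    *-homo : ∀ x y → ⟦ x ℤ.* y ⟧ ≈ ⟦ x ⟧ * ⟦ y ⟧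
    *-homo (+ m) y = *-homo⁺ m y
    *-homo -[1+ m ] y = begin
      ⟦ ℤ.- (+ suc m) ℤ.* y ⟧ ≡⟨ ≡.cong ⟦_⟧ (ℤ.neg-distribˡ-* (+ suc m) y) ⟨
      ⟦ ℤ.- (+ suc m ℤ.* y) ⟧ ≈⟨ neg-homo (+ suc m ℤ.* y) ⟩
      - ⟦ + suc m ℤ.* y ⟧ ≈⟨ -‿cong (*-homo⁺ (suc m) y) ⟩
      - (suc m · 1# * ⟦ y ⟧) ≈⟨ -‿distribˡ-* _ _ ⟩
      - (suc m · 1#) * ⟦ y ⟧ ∎

    -- The solver has to compare coefficients, which `Carrier` does not offer, so they are taken in
    -- ℤ. With the optimised multiple, `con (+ 0)` and `con (+ 1)` evaluate to `0#` and `1#`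
    -- definitionally.
    ℤ-homo : ℤ.+-*-rawRing -Raw-AlmostCommutative⟶ fromCommutativeRing commutativeRing
    ℤ-homo = record
      { ⟦_⟧ = ⟦_⟧ ; +-homo = +-homo ; *-homo = *-homo ; -‿homo = neg-homo
      ; 0-homo = refl ; 1-homo = refl }

    _≟ℤ_ : ∀ x y → Maybe (⟦ x ⟧ ≈ ⟦ y ⟧)
    x ≟ℤ y with x ℤ.≟ y
    ... | yes ≡.refl = just refl
    ... | no _ = nothing

  open Algebra.Solver.Ring ℤ.+-*-rawRing (fromCommutativeRing commutativeRing) ℤ-homo _≟ℤ_ public
    using (solve; _:=_; _:+_; _:*_; _:-_; :-_; con)

-- Finite sums and Kronecker deltas

module FiniteSums {c ℓ} (F : Field c ℓ) where
  open Field F hiding (zero)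
  open RingFacts F

  ∑-cong : ∀ {n} {f g : Fin n → Carrier} → (∀ i → f i ≈ g i) → ∑ F f ≈ ∑ F g
  ∑-cong {zero} f≈g = refl
  ∑-cong {suc n} f≈g = +-cong (f≈g zero) (∑-cong (f≈g ∘ suc))

  ∑-zero : ∀ {n} {f : Fin n → Carrier} → (∀ i → f i ≈ 0#) → ∑ F f ≈ 0#
  ∑-zero {zero} f≈0 = refl
  ∑-zero {suc n} f≈0 = trans (+-cong (f≈0 zero) (∑-zero (f≈0 ∘ suc))) (+-identityʳ 0#)

  ∑-+ : ∀ {n} (f g : Fin n → Carrier) → ∑ F (λ i → f i + g i) ≈ ∑ F f + ∑ F g
  ∑-+ {zero} f g = sym (+-identityʳ 0#)
  ∑-+ {suc n} f g = trans (+-congˡ (∑-+ (f ∘ suc) (g ∘ suc)))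
    (solve 4 (λ a b c d → (a :+ b) :+ (c :+ d) := (a :+ c) :+ (b :+ d)) refl _ _ _ _)

  ∑-*ˡ : ∀ {n} x (f : Fin n → Carrier) → x * ∑ F f ≈ ∑ F (λ i → x * f i)
  ∑-*ˡ {zero} x f = zeroʳ x
  ∑-*ˡ {suc n} x f = trans (distribˡ x _ _) (+-congˡ (∑-*ˡ x (f ∘ suc)))

  ∑-*ʳ : ∀ {n} x (f : Fin n → Carrier) → ∑ F f * x ≈ ∑ F (λ i → f i * x)
  ∑-*ʳ x f = trans (*-comm _ x) (trans (∑-*ˡ x f) (∑-cong λ i → *-comm x (f i)))

  ∑-swap : ∀ {m n} (f : Fin m → Fin n → Carrier) →
    ∑ F (λ i → ∑ F (f i)) ≈ ∑ F (λ j → ∑ F (λ i → f i j))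
  ∑-swap {zero} f = sym (∑-zero {f = λ j → ∑ F λ i → f i j} λ _ → refl)
  ∑-swap {suc m} f = trans (+-congˡ (∑-swap (f ∘ suc))) (sym (∑-+ (f zero) _))

  ∑-pick : ∀ {n} (i : Fin n) {f : Fin n → Carrier} → (∀ j → i ≢ j → f j ≈ 0#) → ∑ F f ≈ f i
  ∑-pick zero f≈0 = trans (+-congˡ (∑-zero λ j → f≈0 (suc j) λ ())) (+-identityʳ _)
  ∑-pick (suc i) f≈0 = trans
    (+-cong (f≈0 zero λ ()) (∑-pick i λ j i≢j → f≈0 (suc j) (i≢j ∘ Fin.suc-injective)))
    (+-identityˡ _)


  δ-refl : ∀ {n} (i : Fin n) → δ F i i ≈ 1#
  δ-refl i with i ≟ i
  ... | yes _ = refl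
  ... | no i≢i = contradiction ≡.refl i≢i

  δ-≢ : ∀ {n} {i j : Fin n} → i ≢ j → δ F i j ≈ 0#
  δ-≢ {i = i} {j} i≢j with i ≟ j
  ... | yes i≡j = contradiction i≡j i≢j
  ... | no _ = refl

  ∑-δ : ∀ {n} (i : Fin n) (f : Fin n → Carrier) → ∑ F (λ j → δ F i j * f j) ≈ f i
  ∑-δ i f = trans
    (∑-pick i λ j i≢j → trans (*-congʳ (δ-≢ i≢j)) (zeroˡ _))
    (trans (*-congʳ (δ-refl i)) (*-identityˡ _))

  ∑-δʳ : ∀ {n} (i : Fin n) (f : Fin n → Carrier) → ∑ F (λ j → δ F j i * f j) ≈ f i
  ∑-δʳ i f = trans
    (∑-pick i λ j i≢j → trans (*-congʳ (δ-≢ (i≢j ∘ ≡.sym))) (zeroˡ _))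
    (trans (*-congʳ (δ-refl i)) (*-identityˡ _))

  ∑-++ : ∀ m {n} (f : Fin (m ℕ.+ n) → Carrier) →
    ∑ F f ≈ ∑ F (λ i → f (i ↑ˡ n)) + ∑ F (λ j → f (m ↑ʳ j))
  ∑-++ zero f = sym (+-identityˡ _)
  ∑-++ (suc m) f = trans (+-congˡ (∑-++ m (f ∘ suc))) (sym (+-assoc _ _ _))

  ∑-combine : ∀ m {n} (f : Fin (m ℕ.* n) → Carrier) →
    ∑ F f ≈ ∑ F (λ i → ∑ F (λ j → f (combine {m} {n} i j)))
  ∑-combine zero f = refl
  ∑-combine (suc m) {n} f = trans (∑-++ n f) (+-congˡ (∑-combine m (λ i → f (n ↑ʳ i))))

-- Univariate polynomials: invertible values, and vanishing off finitely many points

module Univariate {c ℓ} (F : Field c ℓ) where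
  open import Data.Integer using (+_; -[1+_])
  open Field F hiding (zero)
  open RingFacts F
  open FiniteSums F
  open import Relation.Binary.Reasoning.Setoid setoid

  -- A positive form of nonvanishing: it carries the inverse and passes from a product to its
  -- factors, so it can be propagated without equality tests.
  Inv : Carrier → Set _
  Inv x = ∃[ y ] (x * y ≈ 1#)

  Inv-resp : ∀ {x y} → x ≈ y → Inv x → Inv y
  Inv-resp x≈y (z , xz≈1) = z , trans (*-congʳ (sym x≈y)) xz≈1

  Inv-left : ∀ {x y} → Inv (x * y) → Inv x
  Inv-left {x} {y} (z , xyz≈1) = y * z , trans (sym (*-assoc x y z)) xyz≈1

  Inv-right : ∀ {x y} → Inv (x * y) → Inv y
  Inv-right = Inv-left ∘ Inv-resp (*-comm _ _)

  Inv-cancel : ∀ {x y} → Inv x → x * y ≈ 0# → y ≈ 0#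
  Inv-cancel {x} {y} (z , xz≈1) xy≈0 = begin
    y ≈⟨ *-identityˡ y ⟨
    1# * y ≈⟨ *-congʳ xz≈1 ⟨
    x * z * y ≈⟨ solve 3 (λ x y z → x :* z :* y := z :* (x :* y)) refl x y z ⟩
    z * (x * y) ≈⟨ *-congˡ xy≈0 ⟩
    z * 0# ≈⟨ zeroʳ z ⟩
    0# ∎

  ev : List Carrier → Carrier → Carrier
  ev [] x = 0#
  ev (a ∷ p) x = a + x * ev p x

  ev-add : ∀ p q x → ev (polyAdd F p q) x ≈ ev p x + ev q x
  ev-add [] q x = sym (+-identityˡ _)
  ev-add (a ∷ p) [] x = sym (+-identityʳ _)
  ev-add (a ∷ p) (b ∷ q) x = trans (+-congˡ (*-congˡ (ev-add p q x)))
    (solve 5 (λ a b x p q → a :+ b :+ x :* (p :+ q) := a :+ x :* p :+ (b :+ x :* q)) refl a b x _ _)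

  ev-scale : ∀ a p x → ev (map (a *_) p) x ≈ a * ev p x
  ev-scale a [] x = sym (zeroʳ a)
  ev-scale a (b ∷ p) x = trans (+-congˡ (*-congˡ (ev-scale a p x)))
    (solve 4 (λ a b x p → a :* b :+ x :* (a :* p) := a :* (b :+ x :* p)) refl a b x _)

  ev-mul : ∀ p q x → ev (polyMul F p q) x ≈ ev p x * ev q x
  ev-mul [] q x = sym (zeroˡ _)
  ev-mul (a ∷ p) q x = begin
    ev (polyAdd F (map (a *_) q) (0# ∷ polyMul F p q)) x
      ≈⟨ ev-add (map (a *_) q) _ x ⟩
    ev (map (a *_) q) x + (0# + x * ev (polyMul F p q) x)
      ≈⟨ +-cong (ev-scale a q x) (trans (+-identityˡ _) (*-congˡ (ev-mul p q x))) ⟩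
    a * ev q x + x * (ev p x * ev q x)
      ≈⟨ solve 4 (λ a q x p → a :* q :+ x :* (p :* q) := (a :+ x :* p) :* q) refl a _ x _ ⟩
    (a + x * ev p x) * ev q x ∎

  -- A property of functions closed under the ring operations, so that polynomiality of a compound
  -- expression follows its shape and its coefficients need not be displayed.
  IsPoly : (Carrier → Carrier) → Set _
  IsPoly f = ∃[ p ] (∀ x → f x ≈ ev p x)

  poly-resp : ∀ {f g} → (∀ x → g x ≈ f x) → IsPoly f → IsPoly g
  poly-resp g≈f (p , f≈p) = p , λ x → trans (g≈f x) (f≈p x)

  poly-const : ∀ a → IsPoly (λ _ → a)
  poly-const a = a ∷ [] , λ x → sym (trans (+-congˡ (zeroʳ x)) (+-identityʳ a))

  poly-id : IsPoly (λ x → x)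
  poly-id = 0# ∷ 1# ∷ [] , λ x →
    solve 1 (λ x → x := con (+ 0) :+ x :* (con (+ 1) :+ x :* con (+ 0))) refl x

  poly-+ : ∀ {f g} → IsPoly f → IsPoly g → IsPoly (λ x → f x + g x)
  poly-+ (p , f≈p) (q , g≈q) = polyAdd F p q , λ x →
    trans (+-cong (f≈p x) (g≈q x)) (sym (ev-add p q x))

  poly-* : ∀ {f g} → IsPoly f → IsPoly g → IsPoly (λ x → f x * g x)
  poly-* (p , f≈p) (q , g≈q) = polyMul F p q , λ x →
    trans (*-cong (f≈p x) (g≈q x)) (sym (ev-mul p q x))

  poly-neg : ∀ {f} → IsPoly f → IsPoly (λ x → - f x)
  poly-neg f-poly = poly-resp (λ x → solve 1 (λ y → :- y := con -[1+ 0 ] :* y) refl _)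
    (poly-* (poly-const (- 1#)) f-poly)


  poly-∑ : ∀ {n} {f : Fin n → Carrier → Carrier} → (∀ i → IsPoly (f i)) →
    IsPoly (λ x → ∑ F (λ i → f i x))
  poly-∑ {zero} f-poly = poly-const 0#
  poly-∑ {suc n} f-poly = poly-+ (f-poly zero) (poly-∑ (f-poly ∘ suc))

  -- Synthetic division by `x - t`: the coefficients of the quotient are the values at `t` of the
  -- proper tails of the coefficient list, and the remainder is `ev p t`.
  quotient : List Carrier → Carrier → List Carrier
  quotient [] t = []
  quotient (a ∷ []) t = []
  quotient (a ∷ b ∷ p) t = ev (b ∷ p) t ∷ quotient (b ∷ p) t

  length-quotient : ∀ a p t → length (quotient (a ∷ p) t) ≡ length p
  length-quotient a [] t = ≡.refl
  length-quotient a (b ∷ p) t = ≡.cong suc (length-quotient b p t)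

  ev-quotient : ∀ p t x → ev p x ≈ ev p t + (x - t) * ev (quotient p t) x
  ev-quotient [] t x = sym (trans (+-identityˡ _) (zeroʳ _))
  ev-quotient (a ∷ []) t x =
    solve 3 (λ a t x → a :+ x :* con (+ 0) := a :+ t :* con (+ 0) :+ (x :- t) :* con (+ 0)) refl a t x
  ev-quotient (a ∷ p@(_ ∷ _)) t x = trans (+-congˡ (*-congˡ (ev-quotient p t x)))
    (solve 5 (λ a t x pt q → a :+ x :* (pt :+ (x :- t) :* q)
      := a :+ t :* pt :+ (x :- t) :* (pt :+ x :* q)) refl a t x _ _)

  -- Only the coefficients below the leading 1 are stored, as in `IsAlgClosed`; the degree is the
  -- length of the vector, with no leading coefficient to test.
  monic : ∀ {n} → Vec Carrier n → Carrier → Carrier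
  monic [] x = 1#
  monic (a ∷ p) x = a + x * monic p x

  monic-expand : ∀ {n} (p : Vec Carrier n) x →
    monic p x ≈ (F ^ x) n + ∑ F (λ i → lookup p i * (F ^ x) (Fin.toℕ i))
  monic-expand [] x = sym (+-identityʳ 1#)
  monic-expand {suc n} (a ∷ p) x = begin
    a + x * monic p x
      ≈⟨ +-congˡ (*-congˡ (monic-expand p x)) ⟩
    a + x * ((F ^ x) n + ∑ F (λ i → lookup p i * (F ^ x) (Fin.toℕ i)))
      ≈⟨ solve 4 (λ a x m s → a :+ x :* (m :+ s) := x :* m :+ (a :* con (+ 1) :+ x :* s)) refl a x _ _ ⟩
    x * (F ^ x) n + (a * 1# + x * ∑ F (λ i → lookup p i * (F ^ x) (Fin.toℕ i)))
      ≈⟨ +-congˡ (+-congˡ (trans (∑-*ˡ x (λ i → lookup p i * (F ^ x) (Fin.toℕ i))) (∑-cong λ i →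
           solve 3 (λ x a m → x :* (a :* m) := a :* (x :* m)) refl x (lookup p i) _))) ⟩
    x * (F ^ x) n + (a * 1# + ∑ F (λ i → lookup p i * (x * (F ^ x) (Fin.toℕ i)))) ∎

  shiftConst : ∀ {n} → Carrier → Vec Carrier (suc n) → Vec Carrier (suc n)
  shiftConst c (a ∷ p) = (c + a) ∷ p

  monic-shift : ∀ {n} c (p : Vec Carrier (suc n)) x → monic (shiftConst c p) x ≈ c + monic p x
  monic-shift c (a ∷ p) x = +-assoc c a _

  timesRoot : ∀ {n} → Carrier → Vec Carrier n → Vec Carrier (suc n)
  timesRoot t [] = (- t) ∷ []
  timesRoot t (a ∷ p) = (- t * a) ∷ shiftConst a (timesRoot t p)

  monic-timesRoot : ∀ {n} t (p : Vec Carrier n) x → monic (timesRoot t p) x ≈ (x - t) * monic p x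
  monic-timesRoot t [] x = solve 2 (λ t x → :- t :+ x :* con (+ 1) := (x :- t) :* con (+ 1)) refl t x
  monic-timesRoot t (a ∷ p) x = begin
    - t * a + x * monic (shiftConst a (timesRoot t p)) x
      ≈⟨ +-congˡ (*-congˡ (trans (monic-shift a (timesRoot t p) x) (+-congˡ (monic-timesRoot t p x)))) ⟩
    - t * a + x * (a + (x - t) * monic p x)
      ≈⟨ solve 4 (λ t a x m → :- t :* a :+ x :* (a :+ (x :- t) :* m) := (x :- t) :* (a :+ x :* m)) refl t a x _ ⟩
    (x - t) * (a + x * monic p x) ∎

  -- The base case is the polynomial x and not 1: the degree is then positive, so that `monic-root`
  -- applies, and 0 is among the roots, so that a point away from them is invertible.
  fromRoots : (ts : List Carrier) → Vec Carrier (suc (length ts))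
  fromRoots [] = 0# ∷ []
  fromRoots (t ∷ ts) = timesRoot t (fromRoots ts)

  module _ (closed : IsAlgClosed F) where

    monic-root : ∀ {n} (p : Vec Carrier (suc n)) → ∃[ x ] (monic p x ≈ 0#)
    monic-root {n} p with closed n (lookup p)
    ... | x , root = x , trans (monic-expand p x) root

    -- A root of P - 1, where P is the product over the roots to be avoided, satisfies P(x) = 1 and
    -- so stays away from all of them.
    freshPoint : ∀ ts → ∃[ x ] Inv (monic (fromRoots ts) x)
    freshPoint ts with monic-root (shiftConst (- 1#) (fromRoots ts))
    ... | x , root = x , 1# , (begin
      monic (fromRoots ts) x * 1#
        ≈⟨ solve 1 (λ m → m :* con (+ 1) := con (+ 1) :+ (:- con (+ 1) :+ m)) refl _ ⟩
      1# + (- 1# + monic (fromRoots ts) x)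
        ≈⟨ +-congˡ (trans (sym (monic-shift (- 1#) (fromRoots ts) x)) root) ⟩
      1# + 0# ≈⟨ +-identityʳ 1# ⟩
      1# ∎)

    -- Induction on the length of the coefficient list: at a fresh `t` the remainder vanishes, and
    -- the quotient by `x - t` is shorter and vanishes off the enlarged set of roots.
    vanish-offRoots : ∀ n p → length p ≡ n → ∀ ts →
      (∀ x → Inv (monic (fromRoots ts) x) → ev p x ≈ 0#) → ∀ x → ev p x ≈ 0#
    vanish-offRoots n [] _ ts _ x = refl
    vanish-offRoots (suc n) p@(a ∷ p′) eq ts vanish x with freshPoint ts
    ... | t , t-fresh = begin
      ev p x ≈⟨ ev-quotient p t x ⟩
      ev p t + (x - t) * ev (quotient p t) x
        ≈⟨ +-cong (vanish t t-fresh) (*-congˡ (vanish-offRoots n (quotient p t)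
             (≡.trans (length-quotient a p′ t) (≡.cong ℕ.pred eq)) (t ∷ ts) quotient-vanish x)) ⟩
      0# + (x - t) * 0# ≈⟨ trans (+-identityˡ _) (zeroʳ _) ⟩
      0# ∎
      where
      quotient-vanish : ∀ y → Inv (monic (fromRoots (t ∷ ts)) y) → ev (quotient p t) y ≈ 0#
      quotient-vanish y y-away = Inv-cancel (Inv-left split) (begin
        (y - t) * ev (quotient p t) y ≈⟨ +-identityˡ _ ⟨
        0# + (y - t) * ev (quotient p t) y ≈⟨ +-congʳ (vanish t t-fresh) ⟨
        ev p t + (y - t) * ev (quotient p t) y ≈⟨ ev-quotient p t y ⟨
        ev p y ≈⟨ vanish y (Inv-right split) ⟩
        0# ∎)
        where split = Inv-resp (monic-timesRoot t (fromRoots ts) y) y-away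

    vanish-offZero : ∀ {f} → IsPoly f → (∀ x → Inv x → f x ≈ 0#) → ∀ x → f x ≈ 0#
    vanish-offZero (p , f≈p) vanish x = trans (f≈p x)
      (vanish-offRoots (length p) p ≡.refl [] (λ y y-inv → trans (sym (f≈p y))
        (vanish y (Inv-resp (solve 1 (λ y → con (+ 0) :+ y :* con (+ 1) := y) refl y) y-inv))) x)

-- Linear algebra without decidable equality, and independence of monomials

¬¬-Fin : ∀ {a n} {P : Fin n → Set a} → (∀ i → ¬ ¬ P i) → ¬ ¬ (∀ i → P i)
¬¬-Fin {n = zero} nn k = k λ ()
¬¬-Fin {n = suc n} nn k = nn zero λ p₀ → ¬¬-Fin (nn ∘ suc) λ ps →
  k λ { zero → p₀ ; (suc i) → ps i }

module LinearAlgebra {c ℓ} (F : Field c ℓ) where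
  open import Data.Integer using (+_)
  open Field F hiding (zero)
  open RingFacts F
  open FiniteSums F
  open Univariate F
  open import Relation.Binary.Reasoning.Setoid setoid

  δ-suc : ∀ {n} (i j : Fin n) → δ F (Fin.suc i) (Fin.suc j) ≈ δ F i j
  δ-suc i j with i ≟ j
  ... | yes _ = refl
  ... | no _ = refl

  -- Elimination on row zero: an invertible entry is a pivot and removes one row and one column; if
  -- all entries vanish, the first unit vector lies in the kernel. Which case occurs is known only
  -- up to double negation, so the conclusion is a negation and no kernel vector is produced.
  tallMatrix-notInjective : ∀ {k r} → r ℕ.≤ k → (M : Fin (suc k) → Fin r → Carrier) →
    ¬ (∀ (x : Fin (suc k) → Carrier) → (∀ j → ∑ F (λ i → x i * M i j) ≈ 0#) → ∀ i → x i ≈ 0#)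
  tallMatrix-notInjective {k} {r} r≤k M inj = ¬¬-Fin pivot λ row≈0 →
    1#≉0# (trans (sym (δ-refl (zero {k}))) (inj (δ F zero) (λ j → trans (∑-δ zero (λ i → M i j)) (row≈0 j)) zero))
    where
    pivot : ∀ j → ¬ ¬ (M zero j ≈ 0#)
    pivot j m≉0 = go r≤k j M inj m≉0
      where
      go : ∀ {k r} → r ℕ.≤ k → (j : Fin r) (M : Fin (suc k) → Fin r → Carrier) →
        (∀ (x : Fin (suc k) → Carrier) → (∀ j → ∑ F (λ i → x i * M i j) ≈ 0#) → ∀ i → x i ≈ 0#) →
        ¬ ¬ (M zero j ≈ 0#)
      go {suc k} {suc r} (s≤s r≤k) j₀ M inj m≉0 with inverse (M zero j₀) m≉0
      ... | q , mq≈1 = tallMatrix-notInjective r≤k (λ i j → M′ i (punchIn j₀ j)) λ y y-ker i →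
        inj (extend y) (λ j → extend-ker y y-ker j) (suc i)
        where
        M′ : Fin (suc k) → Fin (suc r) → Carrier
        M′ i j = M (suc i) j - M (suc i) j₀ * (q * M zero j)

        extend : (Fin (suc k) → Carrier) → Fin (suc (suc k)) → Carrier
        -- The coordinate at the pivot row is solved for, so that the pivot column sums to zero.
        extend y zero = - (∑ F (λ i → y i * M (suc i) j₀) * q)
        extend y (suc i) = y i

        extend-∑ : ∀ y j → ∑ F (λ i → extend y i * M i j) ≈ ∑ F (λ i → y i * M′ i j)
        extend-∑ y j = sym $ begin
          ∑ F (λ i → y i * M′ i j)
            ≈⟨ ∑-cong (λ i → solve 5 (λ y a b q c → y :* (a :- b :* (q :* c)) := y :* b :* (:- (q :* c)) :+ y :* a)
                 refl (y i) (M (suc i) j) (M (suc i) j₀) q (M zero j)) ⟩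
          ∑ F (λ i → y i * M (suc i) j₀ * - (q * M zero j) + y i * M (suc i) j)
            ≈⟨ ∑-+ (λ i → y i * M (suc i) j₀ * - (q * M zero j)) (λ i → y i * M (suc i) j) ⟩
          ∑ F (λ i → y i * M (suc i) j₀ * - (q * M zero j)) + ∑ F (λ i → y i * M (suc i) j)
            ≈⟨ +-congʳ (∑-*ʳ (- (q * M zero j)) (λ i → y i * M (suc i) j₀)) ⟨
          ∑ F (λ i → y i * M (suc i) j₀) * - (q * M zero j) + ∑ F (λ i → y i * M (suc i) j)
            ≈⟨ +-congʳ (solve 3 (λ s q m → s :* (:- (q :* m)) := :- (s :* q) :* m) refl _ q _) ⟩
          - (∑ F (λ i → y i * M (suc i) j₀) * q) * M zero j + ∑ F (λ i → y i * M (suc i) j) ∎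

        extend-ker : ∀ y → (∀ j → ∑ F (λ i → y i * M′ i (punchIn j₀ j)) ≈ 0#) →
          ∀ j → ∑ F (λ i → extend y i * M i j) ≈ 0#
        extend-ker y y-ker j with j₀ ≟ j
        ... | yes ≡.refl = trans (extend-∑ y j₀) (∑-zero λ i → begin
          y i * (M (suc i) j₀ - M (suc i) j₀ * (q * M zero j₀))
            ≈⟨ *-congˡ (+-congˡ (-‿cong (*-congˡ (trans (*-comm q _) mq≈1)))) ⟩
          y i * (M (suc i) j₀ - M (suc i) j₀ * 1#)
            ≈⟨ solve 2 (λ y m → y :* (m :- m :* con (+ 1)) := con (+ 0)) refl (y i) _ ⟩
          0# ∎)
        ... | no j₀≢j = trans (extend-∑ y j) (≡.subst (λ j → ∑ F (λ i → y i * M′ i j) ≈ 0#)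
          (punchIn-punchOut j₀≢j) (y-ker (punchOut j₀≢j)))

  module _ {a b : Level} {Ω : Set a} where

    -- Derivations instead of coefficient vectors: closure properties become structural recursions,
    -- and coefficients with respect to a finite family are extracted only at the end, by
    -- `coefficients`.
    data Span (G : (Ω → Carrier) → Set b) : (Ω → Carrier) → Set (a ⊔ b ⊔ c ⊔ ℓ) where
      gen : ∀ {φ} → G φ → Span G φ
      none : Span G (λ _ → 0#)
      add : ∀ {φ ψ} → Span G φ → Span G ψ → Span G (λ ω → φ ω + ψ ω)
      scale : ∀ x {φ} → Span G φ → Span G (λ ω → x * φ ω)
      resp : ∀ {φ ψ} → (∀ ω → ψ ω ≈ φ ω) → Span G φ → Span G ψ

    span-∑ : ∀ {G n} {φ : Fin n → Ω → Carrier} → (∀ i → Span G (φ i)) → Span G (λ ω → ∑ F (λ i → φ i ω))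
    span-∑ {n = zero} s = none
    span-∑ {n = suc n} s = add (s zero) (span-∑ (s ∘ suc))

    span-neg : ∀ {G φ} → Span G φ → Span G (λ ω → - φ ω)
    span-neg s = resp (λ ω → solve 1 (λ x → :- x := (:- con (+ 1)) :* x) refl _) (scale (- 1#) s)

    span-unscale : ∀ {G φ x} → Inv x → Span G (λ ω → x * φ ω) → Span G φ
    span-unscale {x = x} (y , xy≈1) s = resp
      (λ ω → trans (sym (*-identityˡ _)) (trans (*-congʳ (sym xy≈1))
        (solve 3 (λ x y z → x :* y :* z := y :* (x :* z)) refl x y _)))
      (scale y s)

    span-mono : {G G′ : (Ω → Carrier) → Set b} →
      (∀ {φ} → G φ → Span G′ φ) → ∀ {φ} → Span G φ → Span G′ φ
    span-mono f (gen g) = f g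
    span-mono f none = none
    span-mono f (add s t) = add (span-mono f s) (span-mono f t)
    span-mono f (scale x s) = scale x (span-mono f s)
    span-mono f (resp e s) = resp e (span-mono f s)

  -- Reversing p turns it into a monic polynomial in 1/ε.
  reversal : ∀ p {m} (q : Vec Carrier m) → ∃[ n ] Σ[ r ∈ Vec Carrier n ]
    (∀ x ε → x * ε ≈ 1# → monic r x ≈ (F ^ x) (length p) * (monic q x + ε * ev p ε))
  reversal [] q = _ , q , λ x ε _ → solve 2 (λ m e → m := con (+ 1) :* (m :+ e :* con (+ 0))) refl _ ε
  reversal (a ∷ p) q with reversal p (a ∷ q)
  ... | n , r , r-spec = n , r , λ x ε xε≈1 → trans (r-spec x ε xε≈1) (begin
    (F ^ x) (length p) * (a + x * monic q x + ε * ev p ε)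
      ≈⟨ solve 5 (λ w a m y x → w :* (a :+ x :* m :+ y) := w :* (x :* m :+ con (+ 1) :* (a :+ y))) refl _ a _ _ x ⟩
    (F ^ x) (length p) * (x * monic q x + 1# * (a + ε * ev p ε))
      ≈⟨ *-congˡ (+-congˡ (*-congʳ xε≈1)) ⟨
    (F ^ x) (length p) * (x * monic q x + x * ε * (a + ε * ev p ε))
      ≈⟨ solve 5 (λ w m x e y → w :* (x :* m :+ x :* e :* y) := (x :* w) :* (m :+ e :* y)) refl _ _ x ε _ ⟩
    x * (F ^ x) (length p) * (monic q x + ε * (a + ε * ev p ε)) ∎)

  module _ (closed : IsAlgClosed F) where

    -- Let r be the reversal of f, monic of degree n, with r(x) = x^n f(ε) whenever xε = 1. A
    -- solution of x r(x) = 1 makes ε = r(x) the inverse of x, whence x^(n+1) f(ε) = xε = 1 and both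
    -- ε and f(ε) are invertible.
    generic-invertible : ∀ {f} → IsPoly f → f 0# ≈ 1# → ∃[ ε ] (Inv ε × Inv (f ε))
    generic-invertible ([] , f≈p) f0≈1 = contradiction (trans (sym f0≈1) (f≈p 0#)) 1#≉0#
    generic-invertible {f} (a ∷ p , f≈p) f0≈1 with reversal p []
    ... | n , r , r-spec with monic-root closed (shiftConst (- 1#) (0# ∷ r))
    ... | x , root = ε , (x , trans (*-comm ε x) xε≈1) , Inv-right (1# , trans (*-identityʳ _) xf≈1)
      where
      ε = monic r x
      xε≈1 : x * ε ≈ 1#
      xε≈1 = begin
        x * ε ≈⟨ solve 2 (λ x e → x :* e := con (+ 1) :+ ((:- con (+ 1)) :+ con (+ 0) :+ x :* e)) refl x ε ⟩
        1# + (- 1# + 0# + x * ε) ≈⟨ trans (+-congˡ root) (+-identityʳ 1#) ⟩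
        1# ∎
      a≈1 : a ≈ 1#
      a≈1 = trans (solve 2 (λ a y → a := a :+ con (+ 0) :* y) refl a _) (trans (sym (f≈p 0#)) f0≈1)
      xf≈1 : x * (F ^ x) (length p) * f ε ≈ 1#
      xf≈1 = begin
        x * (F ^ x) (length p) * f ε ≈⟨ *-congˡ (trans (f≈p ε) (+-congʳ a≈1)) ⟩
        x * (F ^ x) (length p) * (1# + ε * ev p ε) ≈⟨ *-assoc _ _ _ ⟩
        x * ((F ^ x) (length p) * (1# + ε * ev p ε)) ≈⟨ *-congˡ (r-spec x ε xε≈1) ⟨
        x * ε ≈⟨ xε≈1 ⟩
        1# ∎

    -- Fraction-free elimination: the pivots are polynomials with value 1 at 0,
    -- so it suffices to keep their product p invertible.
    perturbedIdentity-solvable : ∀ {a b} {Ω : Set a} r (M : Fin r → Fin r → Carrier → Carrier) (p : Carrier → Carrier) →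
      (∀ i j → IsPoly (M i j)) → (∀ i j → M i j 0# ≈ δ F i j) → IsPoly p → p 0# ≈ 1# →
      ∃[ ε ] (Inv ε × Inv (p ε) × (∀ (G : (Ω → Carrier) → Set b) (φ : Fin r → Ω → Carrier) →
        (∀ i → Span G (λ ω → ∑ F (λ j → M i j ε * φ j ω))) → ∀ j → Span G (φ j)))
    perturbedIdentity-solvable zero M p _ _ p-poly p0 with generic-invertible p-poly p0
    ... | ε , ε-inv , p-inv = ε , ε-inv , p-inv , λ G φ _ ()
    perturbedIdentity-solvable {Ω = Ω} (suc r) M p M-poly M0 p-poly p0 =
      let ε , ε-inv , pa-inv , solve′ = perturbedIdentity-solvable r M′ (λ x → p x * M zero zero x)
            (λ i j → poly-+ (poly-* (M-poly zero zero) (M-poly (suc i) (suc j)))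
              (poly-neg (poly-* (M-poly (suc i) zero) (M-poly zero (suc j)))))
            M′0 (poly-* p-poly (M-poly zero zero))
            (trans (*-cong p0 (trans (M0 zero zero) (δ-refl (zero {r})))) (*-identityʳ 1#))
      in ε , ε-inv , Inv-left pa-inv , λ G φ rows →
        let tail = solve′ G (φ ∘ suc) λ i → resp (λ ω → combine-rows ε i (λ j → φ j ω))
              (add (scale (M zero zero ε) (rows (suc i))) (scale (- M (suc i) zero ε) (rows zero)))
            -- Back substitution: subtracting the known later terms from row zero leaves the pivot
            -- times the first unknown, and the pivot is a factor of the invertible product.
            head = span-unscale (Inv-right pa-inv) (resp (λ ω → solve 2 (λ x y → x := x :+ y :- y) refl _ _)
              (add (rows zero) (span-neg (span-∑ λ j → scale (M zero (suc j) ε) (tail j)))))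
        in λ { zero → head ; (suc j) → tail j }
      where
      M′ : Fin r → Fin r → Carrier → Carrier
      M′ i j x = M zero zero x * M (suc i) (suc j) x - M (suc i) zero x * M zero (suc j) x

      M′0 : ∀ i j → M′ i j 0# ≈ δ F i j
      M′0 i j = begin
        M zero zero 0# * M (suc i) (suc j) 0# - M (suc i) zero 0# * M zero (suc j) 0#
          ≈⟨ +-cong (*-cong (trans (M0 zero zero) (δ-refl (zero {r}))) (trans (M0 (suc i) (suc j)) (δ-suc i j)))
               (-‿cong (*-congʳ (trans (M0 (suc i) zero) (δ-≢ {i = suc i} {zero} λ ())))) ⟩
        1# * δ F i j - 0# * M zero (suc j) 0#
          ≈⟨ solve 2 (λ d m → con (+ 1) :* d :- con (+ 0) :* m := d) refl _ _ ⟩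
        δ F i j ∎

      combine-rows : ∀ ε i (v : Fin (suc r) → Carrier) →
        ∑ F (λ j → M′ i j ε * v (suc j)) ≈
        M zero zero ε * ∑ F (λ j → M (suc i) j ε * v j) + - M (suc i) zero ε * ∑ F (λ j → M zero j ε * v j)
      combine-rows ε i v = begin
        ∑ F (λ j → M′ i j ε * v (suc j))
          ≈⟨ ∑-cong (λ j → solve 5 (λ a b c d v → (a :* b :- c :* d) :* v := a :* (b :* v) :+ (:- c) :* (d :* v))
               refl (M zero zero ε) (M (suc i) (suc j) ε) (M (suc i) zero ε) (M zero (suc j) ε) (v (suc j))) ⟩
        ∑ F (λ j → M zero zero ε * (M (suc i) (suc j) ε * v (suc j)) + - M (suc i) zero ε * (M zero (suc j) ε * v (suc j)))
          ≈⟨ ∑-+ (λ j → M zero zero ε * (M (suc i) (suc j) ε * v (suc j))) (λ j → - M (suc i) zero ε * (M zero (suc j) ε * v (suc j))) ⟩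
        ∑ F (λ j → M zero zero ε * (M (suc i) (suc j) ε * v (suc j))) + ∑ F (λ j → - M (suc i) zero ε * (M zero (suc j) ε * v (suc j)))
          ≈⟨ +-cong (∑-*ˡ (M zero zero ε) (λ j → M (suc i) (suc j) ε * v (suc j))) (∑-*ˡ (- M (suc i) zero ε) (λ j → M zero (suc j) ε * v (suc j))) ⟨
        M zero zero ε * ∑ F (λ j → M (suc i) (suc j) ε * v (suc j)) + - M (suc i) zero ε * ∑ F (λ j → M zero (suc j) ε * v (suc j))
          ≈⟨ solve 5 (λ a s c t v → a :* s :+ (:- c) :* t := a :* (c :* v :+ s) :+ (:- c) :* (a :* v :+ t)) refl
               (M zero zero ε) _ (M (suc i) zero ε) _ (v zero) ⟩
        M zero zero ε * (M (suc i) zero ε * v zero + ∑ F (λ j → M (suc i) (suc j) ε * v (suc j)))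
          + - M (suc i) zero ε * (M zero zero ε * v zero + ∑ F (λ j → M zero (suc j) ε * v (suc j))) ∎

  -- The index is read in base `d` and its digits are the exponents. Bounding each exponent, and not
  -- the total degree, makes the number of monomials exactly the power `d ^ k`.
  mono : ∀ d k → Fin (d ℕ.^ k) → (Fin k → Carrier) → Carrier
  mono d zero _ x = 1#
  mono d (suc k) i x = uncurry (λ p q → (F ^ x zero) (Fin.toℕ p) * mono d k q (x ∘ suc)) (remQuot {d} (d ℕ.^ k) i)

  mono-combine : ∀ d k p q x →
    mono d (suc k) (combine {d} p q) x ≈ (F ^ x zero) (Fin.toℕ p) * mono d k q (x ∘ suc)
  mono-combine d k p q x = reflexive
    (≡.cong (uncurry (λ p q → (F ^ x zero) (Fin.toℕ p) * mono d k q (x ∘ suc))) (remQuot-combine {d} p q))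

  poly-pow : ∀ n → IsPoly (λ x → (F ^ x) n)
  poly-pow zero = poly-const 1#
  poly-pow (suc n) = poly-* poly-id (poly-pow n)

  module _ (closed : IsAlgClosed F) where

    -- Evaluation at 0 kills the constant coefficient; the rest is x times a polynomial, which
    -- vanishes at invertible points and therefore everywhere.
    univariate-identity : ∀ d (a : Fin d → Carrier) →
      (∀ x → ∑ F (λ i → a i * (F ^ x) (Fin.toℕ i)) ≈ 0#) → ∀ i → a i ≈ 0#
    univariate-identity (suc d) a vanish = λ { zero → a₀≈0 ; (suc i) → univariate-identity d (a ∘ suc) tail i }
      where
      rest : Carrier → Carrier
      rest x = ∑ F (λ i → a (suc i) * (F ^ x) (Fin.toℕ i))
      split : ∀ x → a zero + x * rest x ≈ 0#
      split x = trans (+-cong (sym (*-identityʳ _)) (trans (∑-*ˡ x (λ i → a (suc i) * (F ^ x) (Fin.toℕ i)))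
        (∑-cong λ i → solve 3 (λ x a m → x :* (a :* m) := a :* (x :* m)) refl x (a (suc i)) _))) (vanish x)
      a₀≈0 : a zero ≈ 0#
      a₀≈0 = trans (solve 2 (λ a r → a := a :+ con (+ 0) :* r) refl _ _) (split 0#)
      tail : ∀ x → rest x ≈ 0#
      tail = vanish-offZero closed
        (poly-∑ λ i → poly-* (poly-const (a (suc i))) (poly-pow (Fin.toℕ i)))
        λ x x-inv → Inv-cancel x-inv (trans (sym (+-identityˡ _)) (trans (+-congʳ (sym a₀≈0)) (split x)))

    monomials-independent : ∀ d k (a : Fin (d ℕ.^ k) → Carrier) →
      (∀ x → ∑ F (λ i → a i * mono d k i x) ≈ 0#) → ∀ i → a i ≈ 0#
    monomials-independent d zero a vanish zero =
      trans (solve 1 (λ a → a := a :* con (+ 1) :+ con (+ 0)) refl _) (vanish λ ())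
    monomials-independent d (suc k) a vanish i = ≡.subst (λ i → a i ≈ 0#) (combine-remQuot {d} (d ℕ.^ k) i)
      (monomials-independent d k (λ q → a (combine {d} (proj₁ pq) q)) (λ y →
        univariate-identity d (λ p → ∑ F (λ q → a (combine {d} p q) * mono d k q y)) (λ t → begin
          ∑ F (λ p → ∑ F (λ q → a (combine {d} p q) * mono d k q y) * (F ^ t) (Fin.toℕ p))
            ≈⟨ ∑-cong (λ (p : Fin d) → trans (∑-*ʳ ((F ^ t) (Fin.toℕ p)) (λ q → a (combine {d} p q) * mono d k q y))
                 (∑-cong λ q → trans (solve 3 (λ a m t → a :* m :* t := a :* (t :* m)) refl (a (combine {d} p q)) (mono d k q y) _)
                   (*-congˡ (sym (mono-combine d k p q (cons t y)))))) ⟩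
          ∑ F (λ p → ∑ F (λ q → a (combine {d} p q) * mono d (suc k) (combine {d} p q) (cons t y)))
            ≈⟨ ∑-combine d (λ i → a i * mono d (suc k) i (cons t y)) ⟨
          ∑ F (λ i → a i * mono d (suc k) i (cons t y)) ≈⟨ vanish (cons t y) ⟩
          0# ∎) (proj₁ pq)) (proj₂ pq))
      where
      pq = remQuot {d} (d ℕ.^ k) i
      cons : Carrier → (Fin k → Carrier) → Fin (suc k) → Carrier
      cons t y zero = t
      cons t y (suc j) = y j

-- Exponent vectors and words in the variables

unit : ∀ {k} → Fin k → Fin k → ℕ
unit zero zero = 1
unit zero (suc j) = 0
unit (suc i) zero = 0
unit (suc i) (suc j) = unit i j

unit≤1 : ∀ {k} (i j : Fin k) → unit i j ℕ.≤ 1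
unit≤1 zero zero = s≤s z≤n
unit≤1 zero (suc j) = z≤n
unit≤1 (suc i) zero = z≤n
unit≤1 (suc i) (suc j) = unit≤1 i j

wordAt : ∀ q k → Fin (q ℕ.^ k) → List (Fin q)
wordAt q zero i = []
wordAt q (suc k) i = uncurry (λ a j → a ∷ wordAt q k j) (remQuot {q} (q ℕ.^ k) i)

length-wordAt : ∀ q k i → length (wordAt q k i) ≡ k
length-wordAt q zero i = ≡.refl
length-wordAt q (suc k) i = ≡.cong suc (length-wordAt q k _)

indexOf : ∀ {q k} (w : List (Fin q)) → length w ≡ k → Fin (q ℕ.^ k)
indexOf [] ≡.refl = zero
indexOf (a ∷ w) ≡.refl = combine a (indexOf w ≡.refl)

wordAt-indexOf : ∀ {q k} (w : List (Fin q)) (eq : length w ≡ k) → wordAt q k (indexOf w eq) ≡ w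
wordAt-indexOf [] ≡.refl = ≡.refl
wordAt-indexOf (a ∷ w) ≡.refl = ≡.trans
  (≡.cong (uncurry (λ a j → a ∷ wordAt _ (length w) j)) (remQuot-combine a (indexOf w ≡.refl)))
  (≡.cong (a ∷_) (wordAt-indexOf w ≡.refl))

module Monomials {c ℓ} (F : Field c ℓ) where
  open Field F hiding (zero)
  open RingFacts F
  open LinearAlgebra F

  pow-+ : ∀ x m n → (F ^ x) (m ℕ.+ n) ≈ (F ^ x) m * (F ^ x) n
  pow-+ x zero n = sym (*-identityˡ _)
  pow-+ x (suc m) n = trans (*-congˡ (pow-+ x m n)) (sym (*-assoc x _ _))

  expo : ∀ {k} → (Fin k → ℕ) → (Fin k → Carrier) → Carrier
  expo {zero} γ x = 1#
  expo {suc k} γ x = (F ^ x zero) (γ zero) * expo (γ ∘ suc) (x ∘ suc)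

  expo-+ : ∀ {k} (γ γ′ : Fin k → ℕ) x → expo (λ i → γ i ℕ.+ γ′ i) x ≈ expo γ x * expo γ′ x
  expo-+ {zero} γ γ′ x = sym (*-identityˡ 1#)
  expo-+ {suc k} γ γ′ x = trans (*-cong (pow-+ (x zero) (γ zero) (γ′ zero)) (expo-+ (γ ∘ suc) (γ′ ∘ suc) (x ∘ suc)))
    (solve 4 (λ a b c d → a :* b :* (c :* d) := a :* c :* (b :* d)) refl _ _ _ _)

  expo-0 : ∀ {k} (x : Fin k → Carrier) → expo (λ _ → 0) x ≈ 1#
  expo-0 {zero} x = refl
  expo-0 {suc k} x = trans (*-identityˡ _) (expo-0 (x ∘ suc))

  expo-unit : ∀ {k} i (x : Fin k → Carrier) → expo (unit i) x ≈ x i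
  expo-unit zero x = trans (*-cong (*-identityʳ _) (expo-0 (x ∘ suc))) (*-identityʳ _)
  expo-unit (suc i) x = trans (*-identityˡ _) (expo-unit i (x ∘ suc))

  expo-mono : ∀ d {k} (γ : Fin k → ℕ) → (∀ i → γ i ℕ.< d) → ∃[ i ] (∀ x → mono d k i x ≈ expo γ x)
  expo-mono d {zero} γ γ<d = zero , λ x → refl
  expo-mono d {suc k} γ γ<d with expo-mono d (γ ∘ suc) (γ<d ∘ suc)
  ... | i , i-spec = combine (fromℕ< (γ<d zero)) i , λ x → trans (mono-combine d k (fromℕ< (γ<d zero)) i x)
    (*-cong (reflexive (≡.cong (F ^ x zero) (toℕ-fromℕ< (γ<d zero)))) (i-spec (x ∘ suc)))

  word : ∀ {q} → List (Fin q) → (Fin q → Carrier) → Carrier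
  word [] u = 1#
  word (a ∷ w) u = u a * word w u

  word-removeAt : ∀ {q} (w : List (Fin q)) i u → word w u ≈ u (lookupL w i) * word (removeAt w i) u
  word-removeAt (a ∷ w) zero u = refl
  word-removeAt (a ∷ w) (suc i) u = trans (*-congˡ (word-removeAt w i u))
    (solve 3 (λ a b c → a :* (b :* c) := b :* (a :* c)) refl _ _ _)

  word-repeated : ∀ {q} (w : List (Fin q)) i j → i Fin.< j → lookupL w i ≡ lookupL w j →
    ∃[ a ] ∃[ r ] (suc (suc (length r)) ≡ length w × (∀ u → word w u ≈ u a * (u a * word r u)))
  word-repeated (a ∷ w) zero (suc j) _ eq =
    a , removeAt w j , ≡.cong suc (≡.sym (length-removeAt′ w j)) , λ u → *-congˡ
      (trans (word-removeAt w j u) (*-congʳ (reflexive (≡.cong u (≡.sym eq)))))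
  word-repeated (b ∷ w) (suc i) (suc j) (s≤s i<j) eq with word-repeated w i j i<j eq
  ... | a , r , r-length , r-spec = a , b ∷ r , ≡.cong suc r-length , λ u → trans (*-congˡ (r-spec u))
    (solve 3 (λ a b c → b :* (a :* (a :* c)) := a :* (a :* (b :* c))) refl (u a) (u b) _)

  -- A word longer than its alphabet contains a square. The variables commute, so the repeated
  -- letter can be moved to the front, where a quadric with leading part u_a² can replace it.
  word-pigeonhole : ∀ {q} (w : List (Fin q)) → q ℕ.< length w →
    ∃[ a ] ∃[ r ] (suc (suc (length r)) ≡ length w × (∀ u → word w u ≈ u a * (u a * word r u)))
  word-pigeonhole w q<w = let i , j , i<j , eq = pigeonhole q<w (lookupL w) in word-repeated w i j i<j eq

  orOne : ∀ {q} → (Fin q → Carrier) → Fin (suc q) → Carrier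
  orOne u zero = 1#
  orOne u (suc a) = u a

  -- Words of length at most k are words of length k in an alphabet with an extra letter of value 1.
  word-padded : ∀ {q} k (w : List (Fin q)) → length w ℕ.≤ k →
    ∃[ i ] (∀ u → word (wordAt (suc q) k i) (orOne u) ≈ word w u)
  word-padded {q} k w w≤k with pad k w w≤k
    where
    pad : ∀ k (w : List (Fin q)) → length w ℕ.≤ k →
      Σ[ w′ ∈ List (Fin (suc q)) ] (length w′ ≡ k × (∀ u → word w′ (orOne u) ≈ word w u))
    pad zero [] _ = [] , ≡.refl , λ u → refl
    pad (suc k) [] _ with pad k [] z≤n
    ... | w′ , w′-length , w′-spec = zero ∷ w′ , ≡.cong suc w′-length , λ u → trans (*-identityˡ _) (w′-spec u)
    pad (suc k) (a ∷ w) (s≤s w≤k) with pad k w w≤k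
    ... | w′ , w′-length , w′-spec = suc a ∷ w′ , ≡.cong suc w′-length , λ u → *-congˡ (w′-spec u)
  ... | w′ , w′-length , w′-spec = indexOf w′ w′-length , λ u →
    trans (reflexive (≡.cong (λ w → word w (orOne u)) (wordAt-indexOf w′ w′-length))) (w′-spec u)

-- Bilinear forms and the quadratic relation on V × Fⁿ

module BilinearForms {c ℓ} (F : Field c ℓ) where
  open Field F hiding (zero)
  open RingFacts F
  open FiniteSums F

  bil : ∀ {m n} → (Fin m → Fin n → Carrier) → (Fin m → Carrier) → (Fin n → Carrier) → Carrier
  bil β x y = ∑ F λ a → ∑ F λ b → β a b * (x a * y b)

  ∑∑-cong : ∀ {m n} {f g : Fin m → Fin n → Carrier} → (∀ a b → f a b ≈ g a b) →
    ∑ F (λ a → ∑ F (f a)) ≈ ∑ F (λ a → ∑ F (g a))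
  ∑∑-cong f≈g = ∑-cong λ a → ∑-cong (f≈g a)

  ∑∑-*ˡ : ∀ {m n} x (f : Fin m → Fin n → Carrier) →
    x * ∑ F (λ a → ∑ F (f a)) ≈ ∑ F (λ a → ∑ F (λ b → x * f a b))
  ∑∑-*ˡ x f = trans (∑-*ˡ x (λ a → ∑ F (f a))) (∑-cong λ a → ∑-*ˡ x (f a))

  ∑∑-*ʳ : ∀ {m n} x (f : Fin m → Fin n → Carrier) →
    ∑ F (λ a → ∑ F (f a)) * x ≈ ∑ F (λ a → ∑ F (λ b → f a b * x))
  ∑∑-*ʳ x f = trans (∑-*ʳ x (λ a → ∑ F (f a))) (∑-cong λ a → ∑-*ʳ x (f a))

  ∑∑-+ : ∀ {m n} (f g : Fin m → Fin n → Carrier) →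
    ∑ F (λ a → ∑ F (λ b → f a b + g a b)) ≈ ∑ F (λ a → ∑ F (f a)) + ∑ F (λ a → ∑ F (g a))
  ∑∑-+ f g = trans (∑-cong λ a → ∑-+ (f a) (g a)) (∑-+ (λ a → ∑ F (f a)) (λ a → ∑ F (g a)))

  ∑∑-swap : ∀ {l m n} (f : Fin m → Fin n → Fin l → Carrier) →
    ∑ F (λ a → ∑ F (λ b → ∑ F (f a b))) ≈ ∑ F (λ c → ∑ F (λ a → ∑ F (λ b → f a b c)))
  ∑∑-swap f = trans (∑-cong λ a → ∑-swap (f a)) (∑-swap λ a c → ∑ F λ b → f a b c)

  module _ {m n : ℕ} (β : Fin m → Fin n → Carrier) where

    bil-cong : ∀ {x x′ y y′} → (∀ a → x a ≈ x′ a) → (∀ b → y b ≈ y′ b) → bil β x y ≈ bil β x′ y′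
    bil-cong x≈x′ y≈y′ = ∑∑-cong λ a b → *-congˡ (*-cong (x≈x′ a) (y≈y′ b))

    bil-+ˡ : ∀ x x′ y → bil β (λ a → x a + x′ a) y ≈ bil β x y + bil β x′ y
    bil-+ˡ x x′ y = trans
      (∑∑-cong λ a b → solve 4 (λ β x x′ y → β :* ((x :+ x′) :* y) := β :* (x :* y) :+ β :* (x′ :* y))
        refl (β a b) (x a) (x′ a) (y b))
      (∑∑-+ (λ a b → β a b * (x a * y b)) (λ a b → β a b * (x′ a * y b)))

    bil-+ʳ : ∀ x y y′ → bil β x (λ b → y b + y′ b) ≈ bil β x y + bil β x y′
    bil-+ʳ x y y′ = trans
      (∑∑-cong λ a b → solve 4 (λ β x y y′ → β :* (x :* (y :+ y′)) := β :* (x :* y) :+ β :* (x :* y′))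
        refl (β a b) (x a) (y b) (y′ b))
      (∑∑-+ (λ a b → β a b * (x a * y b)) (λ a b → β a b * (x a * y′ b)))

    bil-∑ˡ : ∀ {k} (x : Fin k → Fin m → Carrier) y →
      bil β (λ a → ∑ F (λ i → x i a)) y ≈ ∑ F (λ i → bil β (x i) y)
    bil-∑ˡ x y = trans
      (∑∑-cong λ a b → trans (*-congˡ (∑-*ʳ (y b) (λ i → x i a))) (∑-*ˡ (β a b) (λ i → x i a * y b)))
      (∑∑-swap λ a b i → β a b * (x i a * y b))

    bil-∑ʳ : ∀ {k} x (y : Fin k → Fin n → Carrier) →
      bil β x (λ b → ∑ F (λ i → y i b)) ≈ ∑ F (λ i → bil β x (y i))
    bil-∑ʳ x y = trans
      (∑∑-cong λ a b → trans (*-congˡ (∑-*ˡ (x a) (λ i → y i b))) (∑-*ˡ (β a b) (λ i → x a * y i b)))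
      (∑∑-swap λ a b i → β a b * (x a * y i b))

-- With V the zero set of T and L = (Aᵀ, Bᵀ), the point (p , u) ranges over V × Fⁿ;
-- section-relation makes u, hence p = s + L u, integral over the coordinates of s = p − L u.
module LinearSection {c ℓ} (F : Field c ℓ) {n₁ n₂ n₃ n : ℕ} (T : Tensor F n₁ n₂ n₃)
  (A : Fin n → Fin n₁ → Field.Carrier F) (B : Fin n → Fin n₂ → Field.Carrier F) (C : Fin n → Fin n₃ → Field.Carrier F)
  where
  open import Data.Integer using (+_)
  open Field F hiding (zero)
  open RingFacts F
  open FiniteSums F
  open BilinearForms F
  open LinearAlgebra F
  open Monomials F
  open import Relation.Binary.Reasoning.Setoid setoid

  -- The tensor (A, B, C)·T for matrices over the field itself, that is, after a value of ε has been
  -- substituted.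
  J : Fin n → Fin n → Fin n → Carrier
  J i j k = ∑ F λ a → ∑ F λ b → ∑ F λ c → A i a * (B j b * (C k c * T a b c))

  Ω : Set (c ⊔ ℓ)
  Ω = Σ (Fin (n₁ ℕ.+ n₂) → Carrier) (ZeroSet F T) × (Fin n → Carrier)

  p : Ω → Fin (n₁ ℕ.+ n₂) → Carrier
  p ((p , _) , u) = p

  u : Ω → Fin n → Carrier
  u (_ , u) = u

  x : (Fin n → Carrier) → Fin n₁ → Carrier
  x u a = ∑ F λ i → A i a * u i

  y : (Fin n → Carrier) → Fin n₂ → Carrier
  y u b = ∑ F λ j → B j b * u j

  L : (Fin n → Carrier) → Fin (n₁ ℕ.+ n₂) → Carrier
  L u z = [ x u , y u ]′ (splitAt n₁ z)

  s : Ω → Fin (n₁ ℕ.+ n₂) → Carrier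
  s ω z = p ω z - L (u ω) z

  p≈s+L : ∀ ω z → p ω z ≈ s ω z + L (u ω) z
  p≈s+L ω z = solve 2 (λ p l → p := p :- l :+ l) refl _ _

  L-x : ∀ v a → L v (a ↑ˡ n₂) ≡ x v a
  L-x v a = ≡.cong [ x v , y v ]′ (splitAt-↑ˡ n₁ a n₂)

  L-y : ∀ v b → L v (n₁ ↑ʳ b) ≡ y v b
  L-y v b = ≡.cong [ x v , y v ]′ (splitAt-↑ʳ n₁ n₂ b)

  module _ (k : Fin n) where

    β : Fin n₁ → Fin n₂ → Carrier
    β a b = ∑ F λ c → C k c * T a b c

    β-vanishes : ∀ ω → bil β (λ a → p ω (a ↑ˡ n₂)) (λ b → p ω (n₁ ↑ʳ b)) ≈ 0#
    β-vanishes ω@((p , p∈V) , _) = begin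
      bil β p₁ p₂
        ≈⟨ ∑∑-cong (λ a b → ∑-*ʳ (p₁ a * p₂ b) (λ c → C k c * T a b c)) ⟩
      ∑ F (λ a → ∑ F λ b → ∑ F λ c → C k c * T a b c * (p₁ a * p₂ b))
        ≈⟨ ∑∑-swap (λ a b c → C k c * T a b c * (p₁ a * p₂ b)) ⟩
      ∑ F (λ c → ∑ F λ a → ∑ F λ b → C k c * T a b c * (p₁ a * p₂ b))
        ≈⟨ ∑-zero (λ c → trans
             (trans (∑∑-cong λ (a : Fin n₁) (b : Fin n₂) → *-assoc _ _ _) (sym (∑∑-*ˡ (C k c) (λ a b → T a b c * (p₁ a * p₂ b)))))
             (trans (*-congˡ (p∈V c)) (zeroʳ _))) ⟩
      0# ∎
      where
      p₁ = λ a → p (a ↑ˡ n₂)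
      p₂ = λ b → p (n₁ ↑ʳ b)

    β-section : ∀ v → bil β (x v) (y v) ≈ ∑ F (λ i → ∑ F λ j → J i j k * (v i * v j))
    β-section v = begin
      bil β (x v) (y v)
        ≈⟨ bil-∑ˡ β (λ i a → A i a * v i) (y v) ⟩
      ∑ F (λ i → bil β (λ a → A i a * v i) (y v))
        ≈⟨ ∑-cong (λ i → bil-∑ʳ β (λ a → A i a * v i) (λ j b → B j b * v j)) ⟩
      ∑ F (λ i → ∑ F λ j → bil β (λ a → A i a * v i) (λ b → B j b * v j))
        ≈⟨ ∑∑-cong (λ i j → trans
             (∑∑-cong λ a b → trans (trans (∑-*ʳ _ (λ c → C k c * T a b c))
               (∑-cong λ c → solve 6 (λ A B C T v w → C :* T :* (A :* v :* (B :* w)) := A :* (B :* (C :* T)) :* (v :* w))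
                 refl (A i a) (B j b) (C k c) (T a b c) (v i) (v j)))
               (sym (∑-*ʳ (v i * v j) (λ c → A i a * (B j b * (C k c * T a b c))))))
             (sym (∑∑-*ʳ (v i * v j) (λ a b → ∑ F λ c → A i a * (B j b * (C k c * T a b c)))))) ⟩
      ∑ F (λ i → ∑ F λ j → J i j k * (v i * v j)) ∎

    -- The k-th form vanishes at p. Substituting p = s + L u in its left argument, and then in the
    -- right argument of the L-term only, isolates the quadratic form in u. The other two terms have
    -- degree at most one in u, since p₂ is itself s₂ plus a linear form in u.
    section-relation : ∀ ω →
      ∑ F (λ i → ∑ F λ j → J i j k * (u ω i * u ω j)) ≈
      - (bil β (λ a → s ω (a ↑ˡ n₂)) (λ b → p ω (n₁ ↑ʳ b)) + bil β (x (u ω)) (λ b → s ω (n₁ ↑ʳ b)))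
    section-relation ω = begin
      ∑ F (λ i → ∑ F λ j → J i j k * (u ω i * u ω j)) ≈⟨ β-section (u ω) ⟨
      bil β (x (u ω)) (y (u ω))
        ≈⟨ solve 3 (λ a b c → c := :- (a :+ b) :+ (a :+ (b :+ c))) refl _ _ _ ⟩
      - rest + (bil β s₁ p₂ + (bil β (x (u ω)) s₂ + bil β (x (u ω)) (y (u ω))))
        ≈⟨ +-congˡ (+-congˡ (trans (sym (bil-+ʳ β (x (u ω)) s₂ (y (u ω)))) (bil-cong β (λ _ → refl)
             λ b → sym (trans (p≈s+L ω _) (+-congˡ (reflexive (L-y (u ω) b))))))) ⟩
      - rest + (bil β s₁ p₂ + bil β (x (u ω)) p₂)
        ≈⟨ +-congˡ (trans (sym (bil-+ˡ β s₁ (x (u ω)) p₂)) (bil-cong β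
             (λ a → sym (trans (p≈s+L ω _) (+-congˡ (reflexive (L-x (u ω) a))))) (λ _ → refl))) ⟩
      - rest + bil β (λ a → p ω (a ↑ˡ n₂)) p₂ ≈⟨ +-congˡ (β-vanishes ω) ⟩
      - rest + 0# ≈⟨ +-identityʳ _ ⟩
      - rest ∎
      where
      s₁ = λ a → s ω (a ↑ˡ n₂)
      s₂ = λ b → s ω (n₁ ↑ʳ b)
      p₂ = λ b → p ω (n₁ ↑ʳ b)
      rest = bil β s₁ p₂ + bil β (x (u ω)) s₂

  -- Words in u have length at most `n` throughout, so that for a fixed bound `g` on the exponents
  -- of s there are only finitely many generators; `g` is the only bound that grows.
  Mon : ℕ → (Ω → Carrier) → Set _
  Mon g φ = Σ[ γ ∈ (Fin (n₁ ℕ.+ n₂) → ℕ) ] Σ[ w ∈ List (Fin n) ]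
    ((∀ z → γ z ℕ.≤ g) × length w ℕ.≤ n × (∀ ω → φ ω ≈ expo γ (s ω) * word w (u ω)))

  span-word : ∀ w → length w ℕ.≤ n → Span (Mon 0) (λ ω → word w (u ω))
  span-word w w≤n = gen ((λ _ → 0) , w , (λ _ → z≤n) , w≤n ,
    λ ω → sym (trans (*-congʳ (expo-0 (s ω))) (*-identityˡ _)))

  span-weaken : ∀ {g h φ} → g ℕ.≤ h → Span (Mon g) φ → Span (Mon h) φ
  span-weaken g≤h = span-mono λ (γ , w , γ≤g , rest) → gen (γ , w , (λ z → ℕ.≤-trans (γ≤g z) g≤h) , rest)

  span-expo : ∀ {g h γ φ} → (∀ z → γ z ℕ.≤ h) → Span (Mon g) φ → Span (Mon (h ℕ.+ g)) (λ ω → expo γ (s ω) * φ ω)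
  span-expo γ≤h (gen (γ′ , w , γ′≤g , w≤n , spec)) = gen
    (_ , w , (λ z → ℕ.+-mono-≤ (γ≤h z) (γ′≤g z)) , w≤n ,
     λ ω → trans (*-congˡ (spec ω)) (trans (sym (*-assoc _ _ _)) (*-congʳ (sym (expo-+ _ γ′ (s ω))))))
  span-expo γ≤h none = resp (λ ω → zeroʳ _) none
  span-expo γ≤h (add t t′) = resp (λ ω → distribˡ _ _ _) (add (span-expo γ≤h t) (span-expo γ≤h t′))
  span-expo γ≤h (scale a t) = resp (λ ω → solve 3 (λ e a f → e :* (a :* f) := a :* (e :* f)) refl _ a _)
    (scale a (span-expo γ≤h t))
  span-expo γ≤h (resp e t) = resp (λ ω → *-congˡ (e ω)) (span-expo γ≤h t)

  span-s : ∀ {g φ} z → Span (Mon g) φ → Span (Mon (1 ℕ.+ g)) (λ ω → s ω z * φ ω)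
  span-s z t = resp (λ ω → *-congʳ (sym (expo-unit z (s ω)))) (span-expo (unit≤1 z) t)

  -- The left side has u-degree two more than `w`, the right side of `section-relation` only one
  -- more, which still fits into length `n`. The bound 2 comes from the product of two coordinates
  -- of s that p₂ = s₂ + y(u) contributes.
  relation-span : ∀ k w → suc (length w) ℕ.≤ n →
    Span (Mon 2) (λ ω → ∑ F (λ i → ∑ F λ j → J i j k * (u ω i * u ω j)) * word w (u ω))
  relation-span k w w<n = resp (λ ω → trans (*-congʳ (section-relation k ω)) (expand ω))
    (span-neg (add
      (span-∑ λ a → span-∑ λ b → scale (β k a b) (span-s (a ↑ˡ n₂) (pw b)))
      (span-∑ λ a → span-∑ λ b → scale (β k a b) (span-s (n₁ ↑ʳ b) (xw a)))))
    where
    xw : ∀ a → Span (Mon 1) (λ ω → x (u ω) a * word w (u ω))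
    xw a = span-weaken z≤n (resp (λ ω → trans (∑-*ʳ (word w (u ω)) (λ i → A i a * u ω i)) (∑-cong λ i → *-assoc (A i a) _ _))
      (span-∑ λ i → scale (A i a) (span-word (i ∷ w) w<n)))
    yw : ∀ b → Span (Mon 1) (λ ω → y (u ω) b * word w (u ω))
    yw b = span-weaken z≤n (resp (λ ω → trans (∑-*ʳ (word w (u ω)) (λ i → B i b * u ω i)) (∑-cong λ i → *-assoc (B i b) _ _))
      (span-∑ λ i → scale (B i b) (span-word (i ∷ w) w<n)))
    pw : ∀ b → Span (Mon 1) (λ ω → p ω (n₁ ↑ʳ b) * word w (u ω))
    pw b = resp (λ ω → trans (*-congʳ (trans (p≈s+L ω (n₁ ↑ʳ b)) (+-congˡ (reflexive (L-y (u ω) b))))) (distribʳ _ _ _))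
      (add (span-s (n₁ ↑ʳ b) (span-word w (ℕ.<⇒≤ w<n))) (yw b))
    expand : ∀ ω → - (bil (β k) (λ a → s ω (a ↑ˡ n₂)) (λ b → p ω (n₁ ↑ʳ b))
                      + bil (β k) (x (u ω)) (λ b → s ω (n₁ ↑ʳ b))) * word w (u ω)
      ≈ - (∑ F (λ a → ∑ F λ b → β k a b * (s ω (a ↑ˡ n₂) * (p ω (n₁ ↑ʳ b) * word w (u ω))))
           + ∑ F (λ a → ∑ F λ b → β k a b * (s ω (n₁ ↑ʳ b) * (x (u ω) a * word w (u ω)))))
    expand ω = trans (solve 3 (λ a b w → (:- (a :+ b)) :* w := :- (a :* w :+ b :* w)) refl _ _ _) (-‿cong (+-cong
      (trans (∑∑-*ʳ (word w (u ω)) (λ a b → β k a b * (s ω (a ↑ˡ n₂) * p ω (n₁ ↑ʳ b))))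
        (∑∑-cong λ a b → solve 4 (λ β s p w → β :* (s :* p) :* w := β :* (s :* (p :* w))) refl (β k a b) _ _ _))
      (trans (∑∑-*ʳ (word w (u ω)) (λ a b → β k a b * (x (u ω) a * s ω (n₁ ↑ʳ b))))
        (∑∑-cong λ a b → solve 4 (λ β x s w → β :* (x :* s) :* w := β :* (s :* (x :* w))) refl (β k a b) _ _ _))))

-- The dimension bound by counting monomials

exponential-gap : ∀ {N t} K → N ℕ.< t → ∃[ d ] (suc (t ℕ.* (d ℕ.* 2)) ℕ.^ N ℕ.* K ℕ.< d ℕ.^ t)
exponential-gap {N} {t} K N<t = d , (begin-strict
  suc (t ℕ.* (d ℕ.* 2)) ℕ.^ N ℕ.* K
    ≤⟨ ℕ.*-monoˡ-≤ K (ℕ.^-monoˡ-≤ N linear) ⟩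
  (d ℕ.* a) ℕ.^ N ℕ.* K
    ≡⟨ ≡.cong (ℕ._* K) (^-distribʳ-* N) ⟩
  d ℕ.^ N ℕ.* a ℕ.^ N ℕ.* K
    ≡⟨ ℕ.*-assoc (d ℕ.^ N) _ K ⟩
  d ℕ.^ N ℕ.* (a ℕ.^ N ℕ.* K)
    <⟨ ℕ.*-monoʳ-< (d ℕ.^ N) {{ℕ.m^n≢0 d N}} (ℕ.n<1+n _) ⟩
  d ℕ.^ N ℕ.* d ≡⟨ ℕ.*-comm (d ℕ.^ N) d ⟩
  d ℕ.^ suc N ≤⟨ ℕ.^-monoʳ-≤ d N<t ⟩
  d ℕ.^ t ∎)
  where
  open ℕ.≤-Reasoning
  -- Since 2td + 1 is at most d·a, the left side is at most d^N (a^N K); `d` is taken just above the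
  -- constant a^N K, and the spare factor d is supplied by N < t.
  a = suc (t ℕ.* 2)
  d = suc (a ℕ.^ N ℕ.* K)
  linear : suc (t ℕ.* (d ℕ.* 2)) ℕ.≤ d ℕ.* a
  linear = begin
    suc (t ℕ.* (d ℕ.* 2)) ≤⟨ ℕ.+-monoˡ-≤ (t ℕ.* (d ℕ.* 2)) {1} {d} (s≤s z≤n) ⟩
    d ℕ.+ t ℕ.* (d ℕ.* 2) ≡⟨ rearrange d t ⟩
    d ℕ.* suc (t ℕ.* 2) ∎
    where
    rearrange : ∀ d t → d ℕ.+ t ℕ.* (d ℕ.* 2) ≡ d ℕ.* suc (t ℕ.* 2)
    rearrange = ℕ-Solver.solve-∀
  ^-distribʳ-* : ∀ N → (d ℕ.* a) ℕ.^ N ≡ d ℕ.^ N ℕ.* a ℕ.^ N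
  ^-distribʳ-* zero = ≡.refl
  ^-distribʳ-* (suc N) = ≡.trans (≡.cong (d ℕ.* a ℕ.*_) (^-distribʳ-* N)) (rearrange d a (d ℕ.^ N) (a ℕ.^ N))
    where
    rearrange : ∀ d a x y → d ℕ.* a ℕ.* (x ℕ.* y) ≡ d ℕ.* x ℕ.* (a ℕ.* y)
    rearrange = ℕ-Solver.solve-∀

module DimensionBound {c ℓ} (F : Field c ℓ) (closed : IsAlgClosed F) {n₁ n₂ n₃ n : ℕ} (T : Tensor F n₁ n₂ n₃) where
  open Field F hiding (zero)
  open RingFacts F
  open FiniteSums F
  open Univariate F
  open LinearAlgebra F
  open Monomials F
  open BilinearForms F
  open import Relation.Binary.Reasoning.Setoid setoid

  N : ℕ
  N = n₁ ℕ.+ n₂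

  module Finiteness (A : Fin n → Fin n₁ → Carrier) (B : Fin n → Fin n₂ → Carrier) (C : Fin n → Fin n₃ → Carrier) where
    open LinearSection F T A B C

    module _ (long-word : ∀ w → length w ≡ suc n → Span (Mon 2) (λ ω → word w (u ω))) where

      -- A word shorter than `n` simply grows. A word of length `n` becomes one of length n + 1,
      -- which `long-word` rewrites at the cost of 2 in the exponents of s.
      span-u : ∀ {g φ} j → Span (Mon g) φ → Span (Mon (2 ℕ.+ g)) (λ ω → u ω j * φ ω)
      span-u {g} j (gen (γ , w , γ≤g , w≤n , spec)) with suc (length w) ℕ.≤? n
      ... | yes w<n = span-weaken (ℕ.m≤n+m g 2) (gen (γ , j ∷ w , γ≤g , w<n , λ ω →
        trans (*-congˡ (spec ω)) (solve 3 (λ u e w → u :* (e :* w) := e :* (u :* w)) refl _ _ _)))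
      ... | no w≮n = resp
        (λ ω → trans (*-congˡ (spec ω)) (solve 3 (λ u e w → u :* (e :* w) := e :* (u :* w)) refl _ _ _))
        (span-weaken (ℕ.≤-reflexive (ℕ.+-comm g 2)) (span-expo γ≤g
          (long-word (j ∷ w) (≡.cong suc (ℕ.≤-antisym w≤n (ℕ.≮⇒≥ w≮n))))))
      span-u j none = resp (λ ω → zeroʳ _) none
      span-u j (add t t′) = resp (λ ω → distribˡ _ _ _) (add (span-u j t) (span-u j t′))
      span-u j (scale a t) = resp (λ ω → solve 3 (λ e a f → e :* (a :* f) := a :* (e :* f)) refl _ a _)
        (scale a (span-u j t))
      span-u j (resp e t) = resp (λ ω → *-congˡ (e ω)) (span-u j t)

      span-L : ∀ {g φ} z → Span (Mon g) φ → Span (Mon (2 ℕ.+ g)) (λ ω → L (u ω) z * φ ω)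
      span-L {φ = φ} z t with splitAt n₁ z
      ... | inj₁ a = resp (λ ω → trans (∑-*ʳ (φ ω) (λ i → A i a * u ω i)) (∑-cong λ i → *-assoc (A i a) _ _))
        (span-∑ λ i → scale (A i a) (span-u i t))
      ... | inj₂ b = resp (λ ω → trans (∑-*ʳ (φ ω) (λ i → B i b * u ω i)) (∑-cong λ i → *-assoc (B i b) _ _))
        (span-∑ λ i → scale (B i b) (span-u i t))

      span-p : ∀ {g φ} z → Span (Mon g) φ → Span (Mon (2 ℕ.+ g)) (λ ω → p ω z * φ ω)
      span-p z t = resp (λ ω → trans (*-congʳ (p≈s+L ω z)) (distribʳ _ _ _))
        (add (span-weaken (ℕ.n≤1+n _) (span-s z t)) (span-L z t))

      module _ {m} (σ : Fin m → Fin N) where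

        coords : Ω → Fin (m ℕ.+ n) → Carrier
        coords ω z = [ (λ i → p ω (σ i)) , u ω ]′ (splitAt m z)

        span-coord : ∀ {g φ} z → Span (Mon g) φ → Span (Mon (2 ℕ.+ g)) (λ ω → coords ω z * φ ω)
        span-coord z t with splitAt m z
        ... | inj₁ i = span-p (σ i) t
        ... | inj₂ j = span-u j t

        span-pow : ∀ {g φ} z e → Span (Mon g) φ → Span (Mon (e ℕ.* 2 ℕ.+ g)) (λ ω → (F ^ coords ω z) e * φ ω)
        span-pow z zero t = resp (λ ω → *-identityˡ _) t
        span-pow z (suc e) t = resp (λ ω → *-assoc _ _ _) (span-coord z (span-pow z e t))

        -- Each of the `k` variables contributes at most `d` factors, and each factor costs 2 in the
        -- exponents of s.
        span-mono-coords : ∀ d {g φ k} i (v : Fin k → Fin (m ℕ.+ n)) → Span (Mon g) φ →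
          Span (Mon (k ℕ.* (d ℕ.* 2) ℕ.+ g)) (λ ω → mono d k i (coords ω ∘ v) * φ ω)
        span-mono-coords d {k = zero} i v t = resp (λ ω → *-identityˡ _) t
        span-mono-coords d {g} {k = suc k} i v t = resp (λ ω → *-assoc _ _ _) (span-weaken
          (ℕ.≤-trans (ℕ.+-monoˡ-≤ (k ℕ.* (d ℕ.* 2) ℕ.+ g) (ℕ.*-monoˡ-≤ 2 (ℕ.<⇒≤ (toℕ<n (proj₁ (remQuot {d} (d ℕ.^ k) i))))))
            (ℕ.≤-reflexive (≡.sym (ℕ.+-assoc (d ℕ.* 2) (k ℕ.* (d ℕ.* 2)) g))))
          (span-pow (v zero) (Fin.toℕ (proj₁ (remQuot {d} (d ℕ.^ k) i))) (span-mono-coords d _ (v ∘ suc) t)))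

        K : ℕ
        K = suc n ℕ.^ n

        basis : ∀ h → Fin (h ℕ.^ N ℕ.* K) → Ω → Carrier
        basis h r ω = uncurry (λ i j → mono h N i (s ω) * word (wordAt (suc n) n j) (orOne (u ω)))
          (remQuot {h ℕ.^ N} K r)

        coefficients : ∀ {g φ} → Span (Mon g) φ →
          ∃[ a ] (∀ ω → φ ω ≈ ∑ F (λ r → a r * basis (suc g) r ω))
        coefficients {g} (gen (γ , w , γ≤g , w≤n , spec)) with expo-mono (suc g) γ (λ z → s≤s (γ≤g z)) | word-padded n w w≤n
        ... | i , i-spec | j , j-spec = δ F r , λ ω → begin
          _ ≈⟨ spec ω ⟩
          expo γ (s ω) * word w (u ω) ≈⟨ *-cong (i-spec (s ω)) (j-spec (u ω)) ⟨
          mono (suc g) N i (s ω) * word (wordAt (suc n) n j) (orOne (u ω))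
            ≡⟨ ≡.cong (uncurry (λ i j → mono (suc g) N i (s ω) * word (wordAt (suc n) n j) (orOne (u ω)))) (remQuot-combine {suc g ℕ.^ N} i j) ⟨
          basis (suc g) r ω ≈⟨ ∑-δ r (λ r → basis (suc g) r ω) ⟨
          ∑ F (λ r′ → δ F r r′ * basis (suc g) r′ ω) ∎
          where r = combine {suc g ℕ.^ N} {K} i j
        coefficients none = (λ _ → 0#) , λ ω → sym (∑-zero λ r → zeroˡ (basis _ r ω))
        coefficients {g} (add t t′) with coefficients t | coefficients t′
        ... | a , a-spec | b , b-spec = (λ r → a r + b r) , λ ω → trans (+-cong (a-spec ω) (b-spec ω))
          (trans (sym (∑-+ (λ r → a r * basis (suc g) r ω) (λ r → b r * basis (suc g) r ω)))
            (∑-cong λ r → sym (distribʳ (basis (suc g) r ω) (a r) (b r))))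
        coefficients {g} (scale x t) with coefficients t
        ... | a , a-spec = (λ r → x * a r) , λ ω → trans (*-congˡ (a-spec ω))
          (trans (∑-*ˡ x (λ r → a r * basis (suc g) r ω)) (∑-cong λ r → sym (*-assoc x (a r) (basis (suc g) r ω))))
        coefficients (resp e t) with coefficients t
        ... | a , a-spec = a , λ ω → trans (e ω) (a-spec ω)

        -- All monomials in the m + n coordinate functions are combinations of one family `basis h`.
        -- Once they outnumber it, their coefficient matrix is tall, and a kernel vector of that
        -- matrix is a linear relation among them.
        monomial-relation : N ℕ.< m ℕ.+ n → ∃[ d ]
          ¬ (∀ (a : Fin (d ℕ.^ (m ℕ.+ n)) → Carrier) →
               (∀ ω → ∑ F (λ i → a i * mono d (m ℕ.+ n) i (coords ω)) ≈ 0#) → ∀ i → a i ≈ 0#)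
        monomial-relation N<t with exponential-gap {N} K N<t
        ... | d , few = d , (λ inj → notInjective few M λ a ker → inj a λ ω → begin
          ∑ F (λ i → a i * mono d (m ℕ.+ n) i (coords ω))
            ≈⟨ ∑-cong (λ i → *-congˡ (proj₂ (coeffs i) ω)) ⟩
          ∑ F (λ i → a i * ∑ F (λ r → M i r * basis h r ω))
            ≈⟨ ∑-cong (λ i → trans (∑-*ˡ (a i) (λ r → M i r * basis h r ω)) (∑-cong λ r → sym (*-assoc (a i) (M i r) (basis h r ω)))) ⟩
          ∑ F (λ i → ∑ F λ r → a i * M i r * basis h r ω)
            ≈⟨ ∑-swap (λ i r → a i * M i r * basis h r ω) ⟩
          ∑ F (λ r → ∑ F λ i → a i * M i r * basis h r ω)
            ≈⟨ ∑-zero (λ r → trans (sym (∑-*ʳ (basis h r ω) (λ i → a i * M i r)))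
                 (trans (*-congʳ (ker r)) (zeroˡ (basis h r ω)))) ⟩
          0# ∎)
          where
          -- The exponents of s are at most 2d(m + n); the successor accounts for the exponent 0.
          h = suc ((m ℕ.+ n) ℕ.* (d ℕ.* 2))
          coeffs : ∀ i → ∃[ a ] (∀ ω → mono d (m ℕ.+ n) i (coords ω) ≈ ∑ F (λ r → a r * basis h r ω))
          coeffs i = coefficients (span-weaken (ℕ.≤-reflexive (ℕ.+-identityʳ _))
            (resp (λ ω → sym (*-identityʳ _)) (span-mono-coords d i (λ z → z) (span-word [] z≤n))))
          M : Fin (d ℕ.^ (m ℕ.+ n)) → Fin (h ℕ.^ N ℕ.* K) → Carrier
          M i = proj₁ (coeffs i)
          notInjective : ∀ {S R} → R ℕ.< S → (M : Fin S → Fin R → Carrier) →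
            ¬ (∀ (x : Fin S → Carrier) → (∀ j → ∑ F (λ i → x i * M i j) ≈ 0#) → ∀ i → x i ≈ 0#)
          notInjective (s≤s R≤k) = tallMatrix-notInjective R≤k

        module _ (indep : IndepOn F (ZeroSet F T) σ) where

          -- With u frozen, a relation on V × Fⁿ is a polynomial in the σ-coordinates that vanishes
          -- on V, hence on all of F^m by independence. As u is arbitrary, the relation holds on
          -- F^(m+n), where monomials are independent.
          monomials-independentOn : ∀ d (a : Fin (d ℕ.^ (m ℕ.+ n)) → Carrier) →
            (∀ ω → ∑ F (λ i → a i * mono d (m ℕ.+ n) i (coords ω)) ≈ 0#) → ∀ i → a i ≈ 0#
          monomials-independentOn d a vanish = monomials-independent closed d (m ℕ.+ n) a λ v → begin
            ∑ F (λ i → a i * mono d (m ℕ.+ n) i v)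
              ≈⟨ ∑-cong (λ i → *-congˡ (mono-cong d (m ℕ.+ n) i λ z →
                   reflexive (≡.sym (split v z)))) ⟩
            ∑ F (λ i → a i * mono d (m ℕ.+ n) i (assign (λ j → v (j ↑ˡ n)) (λ j → v (m ↑ʳ j))))
              ≈⟨ eval-relation (λ j → v (m ↑ʳ j)) (λ j → v (j ↑ˡ n)) ⟨
            eval F (relation (λ j → v (m ↑ʳ j))) (λ j → v (j ↑ˡ n))
              ≈⟨ indep (relation (λ j → v (m ↑ʳ j))) (λ q q∈V →
                   trans (eval-relation (λ j → v (m ↑ʳ j)) (q ∘ σ)) (vanish ((q , q∈V) , λ j → v (m ↑ʳ j))))
                   (λ j → v (j ↑ˡ n)) ⟩
            0# ∎
            where
            assign : (Fin m → Carrier) → (Fin n → Carrier) → Fin (m ℕ.+ n) → Carrier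
            assign v w z = [ v , w ]′ (splitAt m z)

            split : ∀ v z → assign (λ j → v (j ↑ˡ n)) (λ j → v (m ↑ʳ j)) z ≡ v z
            split v z with splitAt m z | join-splitAt m n z
            ... | inj₁ _ | eq = ≡.cong v eq
            ... | inj₂ _ | eq = ≡.cong v eq

            mono-cong : ∀ d k i {v w} → (∀ z → v z ≈ w z) → mono d k i v ≈ mono d k i w
            mono-cong d zero i v≈w = refl
            mono-cong d (suc k) i v≈w = *-cong (pow-cong (Fin.toℕ (proj₁ (remQuot {d} (d ℕ.^ k) i))) (v≈w zero)) (mono-cong d k _ (v≈w ∘ suc))
              where
              pow-cong : ∀ e {x y} → x ≈ y → (F ^ x) e ≈ (F ^ y) e
              pow-cong zero x≈y = refl
              pow-cong (suc e) x≈y = *-cong x≈y (pow-cong e x≈y)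

            variableOf : (Fin n → Carrier) → Fin (m ℕ.+ n) → Poly F m
            variableOf w z = [ var , (λ j → con (w j)) ]′ (splitAt m z)

            powPoly : Poly F m → ℕ → Poly F m
            powPoly f zero = con 1#
            powPoly f (suc e) = f ⊗ powPoly f e

            eval-powPoly : ∀ f e v → eval F (powPoly f e) v ≈ (F ^ eval F f v) e
            eval-powPoly f zero v = refl
            eval-powPoly f (suc e) v = *-congˡ (eval-powPoly f e v)

            monoPoly : ∀ k → Fin (d ℕ.^ k) → (Fin k → Poly F m) → Poly F m
            monoPoly zero i τ = con 1#
            monoPoly (suc k) i τ =
              uncurry (λ e j → powPoly (τ zero) (Fin.toℕ e) ⊗ monoPoly k j (τ ∘ suc)) (remQuot {d} (d ℕ.^ k) i)

            eval-monoPoly : ∀ k i τ v → eval F (monoPoly k i τ) v ≈ mono d k i (λ z → eval F (τ z) v)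
            eval-monoPoly zero i τ v = refl
            eval-monoPoly (suc k) i τ v = *-cong (eval-powPoly (τ zero) (Fin.toℕ (proj₁ (remQuot {d} (d ℕ.^ k) i))) v) (eval-monoPoly k _ (τ ∘ suc) v)

            sumPoly : ∀ {k} → (Fin k → Poly F m) → Poly F m
            sumPoly {zero} f = con 0#
            sumPoly {suc k} f = f zero ⊕ sumPoly (f ∘ suc)

            eval-sumPoly : ∀ {k} (f : Fin k → Poly F m) v → eval F (sumPoly f) v ≈ ∑ F (λ i → eval F (f i) v)
            eval-sumPoly {zero} f v = refl
            eval-sumPoly {suc k} f v = +-congˡ (eval-sumPoly (f ∘ suc) v)

            relation : (Fin n → Carrier) → Poly F m
            relation w = sumPoly λ i → con (a i) ⊗ monoPoly (m ℕ.+ n) i (variableOf w)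

            eval-variable : ∀ w v z → eval F (variableOf w z) v ≈ assign v w z
            eval-variable w v z with splitAt m z
            ... | inj₁ _ = refl
            ... | inj₂ _ = refl

            eval-relation : ∀ w v → eval F (relation w) v ≈ ∑ F (λ i → a i * mono d (m ℕ.+ n) i (assign v w))
            eval-relation w v = trans (eval-sumPoly (λ i → con (a i) ⊗ monoPoly (m ℕ.+ n) i (variableOf w)) v)
              (∑-cong λ i → *-congˡ (trans (eval-monoPoly (m ℕ.+ n) i (variableOf w) v)
                (mono-cong d (m ℕ.+ n) i (eval-variable w v))))

          section-bound : m ℕ.+ n ℕ.≤ N
          section-bound = ℕ.≮⇒≥ λ N<t →
            let d , notInjective = monomial-relation N<t in notInjective (monomials-independentOn d)

  -- A family (A, B, C)(ε) with (A, B, C)·T = I_n + O(ε), in evaluated form.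
  module _ (g : Fin n → Fin n → Fin n → Carrier → Carrier)
    (g-poly : ∀ i j k → IsPoly (g i j k)) (g0 : ∀ i j k → g i j k 0# ≈ I F n i j k)
    where

    square-span : ∀ (v : Fin n → Carrier) k → ∑ F (λ i → ∑ F λ j → I F n i j k * (v i * v j)) ≈ v k * v k
    square-span v k = begin
      ∑ F (λ i → ∑ F λ j → δ F i j * δ F j k * (v i * v j))
        ≈⟨ ∑-cong (λ i → trans (∑-cong λ j → *-assoc (δ F i j) (δ F j k) (v i * v j)) (∑-δ i (λ j → δ F j k * (v i * v j)))) ⟩
      ∑ F (λ i → δ F i k * (v i * v i)) ≈⟨ ∑-δʳ k (λ i → v i * v i) ⟩
      v k * v k ∎

    private
      R : ℕ
      R = n ℕ.^ suc n

      repeated : ∀ r → ∃[ k ] ∃[ w ] (suc (suc (length w)) ≡ suc n × (∀ v → word (wordAt n (suc n) r) v ≈ v k * (v k * word w v)))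
      repeated r with word-pigeonhole (wordAt n (suc n) r) (ℕ.≤-reflexive (≡.sym (length-wordAt n (suc n) r)))
      ... | k , w , w-length , w-spec = k , w , ≡.trans w-length (length-wordAt n (suc n) r) , w-spec

      letter : Fin R → Fin n
      letter r = proj₁ (repeated r)

      rest : Fin R → List (Fin n)
      rest r = proj₁ (proj₂ (repeated r))

      rest-length : ∀ r → suc (suc (length (rest r))) ≡ suc n
      rest-length r = proj₁ (proj₂ (proj₂ (repeated r)))

      index : Fin R → Fin n → Fin n → Fin R
      index r i j = indexOf (i ∷ j ∷ rest r) (rest-length r)

      -- Row r writes its word as u_k² times `rest r` and adds the O(ε) part of the k-th quadric
      -- times `rest r`. The main term sits at r itself and not at `index r k k`, which may be a
      -- reordering of the same word; thus M(0) is exactly the identity.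
      M : Fin R → Fin R → Carrier → Carrier
      M r r′ ε = δ F r r′ + ∑ F λ i → ∑ F λ j → (g i j (letter r) ε - I F n i j (letter r)) * δ F (index r i j) r′

      M-poly : ∀ r r′ → IsPoly (M r r′)
      M-poly r r′ = poly-+ (poly-const _) (poly-∑ λ i → poly-∑ λ j →
        poly-* (poly-+ (g-poly i j (letter r)) (poly-const _)) (poly-const _))

      M0 : ∀ r r′ → M r r′ 0# ≈ δ F r r′
      M0 r r′ = trans (+-congˡ (∑-zero λ i → ∑-zero λ j → trans
        (*-congʳ (trans (+-congʳ (g0 i j (letter r))) (-‿inverseʳ _))) (zeroˡ _))) (+-identityʳ _)

      long : Fin R → (Fin n → Carrier) → Carrier
      long r = word (wordAt n (suc n) r)

      M-long : ∀ r ε v → ∑ F (λ r′ → M r r′ ε * long r′ v) ≈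
        ∑ F (λ i → ∑ F λ j → g i j (letter r) ε * (v i * v j)) * word (rest r) v
      M-long r ε v = begin
        ∑ F (λ r′ → M r r′ ε * long r′ v)
          ≈⟨ ∑-cong (λ r′ → trans (distribʳ (long r′ v) (δ F r r′) _) (+-congˡ (trans
               (∑∑-*ʳ (long r′ v) (λ i j → h i j * δ F (index r i j) r′))
               (∑∑-cong λ i j → *-assoc (h i j) _ _)))) ⟩
        ∑ F (λ r′ → δ F r r′ * long r′ v + ∑ F λ i → ∑ F λ j → h i j * (δ F (index r i j) r′ * long r′ v))
          ≈⟨ ∑-+ (λ r′ → δ F r r′ * long r′ v) (λ r′ → ∑ F λ i → ∑ F λ j → h i j * (δ F (index r i j) r′ * long r′ v)) ⟩
        ∑ F (λ r′ → δ F r r′ * long r′ v) + ∑ F (λ r′ → ∑ F λ i → ∑ F λ j → h i j * (δ F (index r i j) r′ * long r′ v))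
          ≈⟨ +-cong (∑-δ r (λ r′ → long r′ v))
               (trans (sym (∑∑-swap (λ i j r′ → h i j * (δ F (index r i j) r′ * long r′ v))))
                 (∑∑-cong λ i j → trans (sym (∑-*ˡ (h i j) (λ r′ → δ F (index r i j) r′ * long r′ v)))
                   (*-congˡ (trans (∑-δ (index r i j) (λ r′ → long r′ v))
                     (reflexive (≡.cong (λ w → word w v) (wordAt-indexOf (i ∷ j ∷ rest r) (rest-length r)))))))) ⟩
        long r v + ∑ F (λ i → ∑ F λ j → h i j * (v i * (v j * word (rest r) v)))
          ≈⟨ +-cong (trans (proj₂ (proj₂ (proj₂ (repeated r))) v)
                 (trans (sym (*-assoc _ _ _)) (*-congʳ (sym (square-span v k)))))
               (trans (∑∑-cong λ i j → solve 4 (λ h x y w → h :* (x :* (y :* w)) := h :* (x :* y) :* w) refl (h i j) (v i) (v j) _)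
                 (sym (∑∑-*ʳ (word (rest r) v) (λ i j → h i j * (v i * v j))))) ⟩
        ∑ F (λ i → ∑ F λ j → I F n i j k * (v i * v j)) * word (rest r) v
          + ∑ F (λ i → ∑ F λ j → h i j * (v i * v j)) * word (rest r) v
          ≈⟨ trans (sym (distribʳ _ _ _)) (*-congʳ (trans
               (sym (∑∑-+ (λ i j → I F n i j k * (v i * v j)) (λ i j → h i j * (v i * v j))))
               (∑∑-cong λ i j → solve 3 (λ a b w → a :* w :+ (b :- a) :* w := b :* w) refl (I F n i j k) (g i j k ε) (v i * v j)))) ⟩
        ∑ F (λ i → ∑ F λ j → g i j k ε * (v i * v j)) * word (rest r) v ∎
        where
        k = letter r
        h = λ i j → g i j k ε - I F n i j k

    degeneration-bound : (∀ ε → Inv ε →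
        Σ[ A ∈ (Fin n → Fin n₁ → Carrier) ] Σ[ B ∈ (Fin n → Fin n₂ → Carrier) ] Σ[ C ∈ (Fin n → Fin n₃ → Carrier) ]
          (∀ i j k → LinearSection.J F T A B C i j k ≈ g i j k ε)) →
      ∀ {m} (σ : Fin m → Fin N) → IndepOn F (ZeroSet F T) σ → m ℕ.+ n ℕ.≤ N
    degeneration-bound family σ indep =
      -- The generators `Mon` involve s and so the matrices at ε. Hence ε is obtained first, and
      -- `solve′` accepts any generators afterwards.
      let ε , ε-inv , _ , solve′ = perturbedIdentity-solvable closed R M (λ _ → 1#) M-poly M0 (poly-const 1#) refl
          A , B , C , J≈g = family ε ε-inv
      in Finiteness.section-bound A B C (λ w w-length →
           let r = indexOf w w-length in
           Span.resp (λ ω → reflexive (≡.cong (λ w → word w (proj₂ ω)) (≡.sym (wordAt-indexOf w w-length))))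
             (solve′ (LinearSection.Mon F T A B C 2) (λ r ω → long r (proj₂ ω))
               (λ r → Span.resp (λ ω → trans (M-long r ε (proj₂ ω)) (*-congʳ (∑∑-cong λ i j → *-congʳ (sym (J≈g i j (letter r))))))
                 (LinearSection.relation-span F T A B C (letter r) (rest r)
                   (ℕ.≤-reflexive (ℕ.suc-injective (rest-length r))))) r))
           σ indep

-- Laurent polynomials: coefficients, and evaluation at invertible ε

module LaurentFacts {c ℓ} (F : Field c ℓ) where
  open import Data.Integer using (+_; -[1+_])
  open Field F hiding (zero)
  open RingFacts F
  open FiniteSums F
  open Univariate F
  open Monomials F
  open import Relation.Binary.Reasoning.Setoid setoid

  -- Extending the coefficients by 0 to negative indices turns multiplication by a power of ε into a
  -- translation of ℤ.
  lookupℤ : List Carrier → ℤ → Carrier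
  lookupℤ p (+ n) = lookupℕ F p n
  lookupℤ p -[1+ n ] = 0#

  coeffL-lookupℤ : ∀ k p z → coeffL F (laurent k p) z ≡ lookupℤ p (z ℤ.+ + k)
  coeffL-lookupℤ k p z with z ℤ.+ + k
  ... | + n = ≡.refl
  ... | -[1+ n ] = ≡.refl

  lookupℕ-add : ∀ p q n → lookupℕ F (polyAdd F p q) n ≈ lookupℕ F p n + lookupℕ F q n
  lookupℕ-add [] q n = sym (+-identityˡ _)
  lookupℕ-add (a ∷ p) [] n = sym (+-identityʳ _)
  lookupℕ-add (a ∷ p) (b ∷ q) zero = refl
  lookupℕ-add (a ∷ p) (b ∷ q) (suc n) = lookupℕ-add p q n

  lookupℕ-scale : ∀ a p n → lookupℕ F (map (a *_) p) n ≈ a * lookupℕ F p n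
  lookupℕ-scale a [] n = sym (zeroʳ a)
  lookupℕ-scale a (b ∷ p) zero = refl
  lookupℕ-scale a (b ∷ p) (suc n) = lookupℕ-scale a p n

  lookupℤ-add : ∀ p q z → lookupℤ (polyAdd F p q) z ≈ lookupℤ p z + lookupℤ q z
  lookupℤ-add p q (+ n) = lookupℕ-add p q n
  lookupℤ-add p q -[1+ n ] = sym (+-identityʳ 0#)

  lookupℤ-scale : ∀ a p z → lookupℤ (map (a *_) p) z ≈ a * lookupℤ p z
  lookupℤ-scale a p (+ n) = lookupℕ-scale a p n
  lookupℤ-scale a p -[1+ n ] = sym (zeroʳ a)

  lookupℤ-∷ : ∀ p z → lookupℤ (0# ∷ p) (ℤ.suc z) ≈ lookupℤ p z
  lookupℤ-∷ p (+ n) = refl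
  lookupℤ-∷ p -[1+ zero ] = refl
  lookupℤ-∷ p -[1+ suc n ] = refl

  lookupℤ-[0] : ∀ z → lookupℤ (0# ∷ []) z ≈ 0#
  lookupℤ-[0] (+ zero) = refl
  lookupℤ-[0] (+ suc n) = refl
  lookupℤ-[0] -[1+ n ] = refl

  +suc : ∀ z k → z ℤ.+ + suc k ≡ ℤ.suc (z ℤ.+ + k)
  +suc z k = shift z (+ k)
    where
    shift : ∀ z k → z ℤ.+ (+ 1 ℤ.+ k) ≡ + 1 ℤ.+ (z ℤ.+ k)
    shift = ℤ-Solver.solve-∀

  lookupℤ-shift : ∀ k p z → lookupℤ (replicate k 0# ++ p) (z ℤ.+ + k) ≈ lookupℤ p z
  lookupℤ-shift zero p z = reflexive (≡.cong (lookupℤ p) (ℤ.+-identityʳ z))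
  lookupℤ-shift (suc k) p z = begin
    lookupℤ (0# ∷ (replicate k 0# ++ p)) (z ℤ.+ + suc k) ≡⟨ ≡.cong (lookupℤ (0# ∷ _)) (+suc z k) ⟩
    lookupℤ (0# ∷ (replicate k 0# ++ p)) (ℤ.suc (z ℤ.+ + k)) ≈⟨ lookupℤ-∷ _ (z ℤ.+ + k) ⟩
    lookupℤ (replicate k 0# ++ p) (z ℤ.+ + k) ≈⟨ lookupℤ-shift k p z ⟩
    lookupℤ p z ∎

  coeffL-+ : ∀ f g z → coeffL F (_+L_ F f g) z ≈ coeffL F f z + coeffL F g z
  coeffL-+ (laurent k p) (laurent l q) z = begin
    coeffL F (laurent (k ℕ.+ l) (polyAdd F p′ q′)) z
      ≡⟨ coeffL-lookupℤ (k ℕ.+ l) (polyAdd F p′ q′) z ⟩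
    lookupℤ (polyAdd F p′ q′) (z ℤ.+ + (k ℕ.+ l)) ≈⟨ lookupℤ-add p′ q′ (z ℤ.+ + (k ℕ.+ l)) ⟩
    lookupℤ p′ (z ℤ.+ + (k ℕ.+ l)) + lookupℤ q′ (z ℤ.+ + (k ℕ.+ l))
      ≡⟨ ≡.cong₂ (λ a b → lookupℤ p′ a + lookupℤ q′ b) (assocˡ z (+ k) (+ l)) (assocʳ z (+ k) (+ l)) ⟩
    lookupℤ p′ (z ℤ.+ + k ℤ.+ + l) + lookupℤ q′ (z ℤ.+ + l ℤ.+ + k)
      ≈⟨ +-cong (lookupℤ-shift l p (z ℤ.+ + k)) (lookupℤ-shift k q (z ℤ.+ + l)) ⟩
    lookupℤ p (z ℤ.+ + k) + lookupℤ q (z ℤ.+ + l)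
      ≡⟨ ≡.cong₂ _+_ (coeffL-lookupℤ k p z) (coeffL-lookupℤ l q z) ⟨
    coeffL F (laurent k p) z + coeffL F (laurent l q) z ∎
    where
    p′ = replicate l 0# ++ p
    q′ = replicate k 0# ++ q
    assocˡ : ∀ z k l → z ℤ.+ (k ℤ.+ l) ≡ z ℤ.+ k ℤ.+ l
    assocˡ = ℤ-Solver.solve-∀
    assocʳ : ∀ z k l → z ℤ.+ (k ℤ.+ l) ≡ z ℤ.+ l ℤ.+ k
    assocʳ = ℤ-Solver.solve-∀

  coeffL-∑ : ∀ {n} (f : Fin n → Laurent F) z → coeffL F (∑L F f) z ≈ ∑ F (λ i → coeffL F (f i) z)
  coeffL-∑ {zero} f z = reflexive (≡.trans (coeffL-lookupℤ 0 [] z) (empty (z ℤ.+ + 0)))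
    where
    empty : ∀ z → lookupℤ [] z ≡ 0#
    empty (+ n) = ≡.refl
    empty -[1+ n ] = ≡.refl
  coeffL-∑ {suc n} f z = trans (coeffL-+ (f zero) (∑L F (f ∘ suc)) z) (+-congˡ (coeffL-∑ (f ∘ suc) z))

  -- monoL a w k is the Laurent monomial a ε^(w − k).
  monoL : Carrier → ℕ → ℕ → Laurent F
  monoL a w k = laurent k (replicate w 0# ++ a ∷ [])

  lookupℤ-monomial* : ∀ a w q z →
    lookupℤ (polyMul F (replicate w 0# ++ a ∷ []) q) (z ℤ.+ + w) ≈ a * lookupℤ q z
  lookupℤ-monomial* a zero q z = begin
    lookupℤ (polyAdd F (map (a *_) q) (0# ∷ [])) (z ℤ.+ + 0)
      ≡⟨ ≡.cong (lookupℤ (polyAdd F (map (a *_) q) (0# ∷ []))) (ℤ.+-identityʳ z) ⟩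
    lookupℤ (polyAdd F (map (a *_) q) (0# ∷ [])) z ≈⟨ lookupℤ-add (map (a *_) q) (0# ∷ []) z ⟩
    lookupℤ (map (a *_) q) z + lookupℤ (0# ∷ []) z ≈⟨ +-cong (lookupℤ-scale a q z) (lookupℤ-[0] z) ⟩
    a * lookupℤ q z + 0# ≈⟨ +-identityʳ _ ⟩
    a * lookupℤ q z ∎
  lookupℤ-monomial* a (suc w) q z = begin
    lookupℤ (polyAdd F (map (0# *_) q) (0# ∷ r)) (z ℤ.+ + suc w)
      ≡⟨ ≡.cong (lookupℤ (polyAdd F (map (0# *_) q) (0# ∷ r))) (+suc z w) ⟩
    lookupℤ (polyAdd F (map (0# *_) q) (0# ∷ r)) z′ ≈⟨ lookupℤ-add (map (0# *_) q) (0# ∷ r) z′ ⟩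
    lookupℤ (map (0# *_) q) z′ + lookupℤ (0# ∷ r) z′
      ≈⟨ +-cong (trans (lookupℤ-scale 0# q z′) (zeroˡ _)) (lookupℤ-∷ r (z ℤ.+ + w)) ⟩
    0# + lookupℤ r (z ℤ.+ + w) ≈⟨ +-identityˡ _ ⟩
    lookupℤ r (z ℤ.+ + w) ≈⟨ lookupℤ-monomial* a w q z ⟩
    a * lookupℤ q z ∎
    where
    r = polyMul F (replicate w 0# ++ a ∷ []) q
    z′ = ℤ.suc (z ℤ.+ + w)

  coeffL-monoL* : ∀ a w k f z →
    coeffL F (_*L_ F (monoL a w k) f) z ≈ a * coeffL F f (z ℤ.+ (+ k ℤ.- + w))
  coeffL-monoL* a w k (laurent l q) z = begin
    coeffL F (laurent (k ℕ.+ l) r) z ≡⟨ coeffL-lookupℤ (k ℕ.+ l) r z ⟩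
    lookupℤ r (z ℤ.+ + (k ℕ.+ l)) ≡⟨ ≡.cong (lookupℤ r) (rearrange z (+ k) (+ l) (+ w)) ⟩
    lookupℤ r (z′ ℤ.+ + l ℤ.+ + w) ≈⟨ lookupℤ-monomial* a w q (z′ ℤ.+ + l) ⟩
    a * lookupℤ q (z′ ℤ.+ + l) ≡⟨ ≡.cong (a *_) (coeffL-lookupℤ l q z′) ⟨
    a * coeffL F (laurent l q) z′ ∎
    where
    r = polyMul F (replicate w 0# ++ a ∷ []) q
    z′ = z ℤ.+ (+ k ℤ.- + w)
    rearrange : ∀ z k l w → z ℤ.+ (k ℤ.+ l) ≡ z ℤ.+ (k ℤ.- w) ℤ.+ l ℤ.+ w
    rearrange = ℤ-Solver.solve-∀

  coeffL-constL : ∀ t z → coeffL F (constL F t) z ≈ lookupℤ (t ∷ []) z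
  coeffL-constL t z = reflexive (≡.trans (coeffL-lookupℤ 0 (t ∷ []) z) (≡.cong (lookupℤ (t ∷ [])) (ℤ.+-identityʳ z)))

  -- Evaluation at ε = x, where y stands for the inverse of x.
  evL : Carrier → Carrier → Laurent F → Carrier
  evL x y (laurent k p) = (F ^ y) k * ev p x

  ev-shift : ∀ k p x → ev (replicate k 0# ++ p) x ≈ (F ^ x) k * ev p x
  ev-shift zero p x = sym (*-identityˡ _)
  ev-shift (suc k) p x = trans (+-identityˡ _) (trans (*-congˡ (ev-shift k p x)) (sym (*-assoc x _ _)))

  pow-inverse : ∀ {x y} → x * y ≈ 1# → ∀ k → (F ^ y) k * (F ^ x) k ≈ 1#
  pow-inverse xy≈1 zero = *-identityˡ 1#
  pow-inverse {x} {y} xy≈1 (suc k) = trans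
    (solve 4 (λ x y a b → y :* a :* (x :* b) := x :* y :* (a :* b)) refl x y _ _)
    (trans (*-cong xy≈1 (pow-inverse xy≈1 k)) (*-identityˡ 1#))

  -- The terms of exponent at least 0 as an ordinary polynomial, so that ε = 0 can be substituted,
  -- where `evL` would need an inverse.
  regularPart : Laurent F → List Carrier
  regularPart (laurent k p) = drop k p

  regularPart-0 : ∀ f → ev (regularPart f) 0# ≈ coeffL F f (+ 0)
  regularPart-0 (laurent k p) = go k p
    where
    go : ∀ k p → ev (drop k p) 0# ≈ lookupℕ F p k
    go zero [] = refl
    go zero (a ∷ p) = trans (+-congˡ (zeroˡ _)) (+-identityʳ a)
    go (suc k) [] = refl
    go (suc k) (a ∷ p) = go k p

  module _ {x y : Carrier} (xy≈1 : x * y ≈ 1#) where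

    evL-+ : ∀ f g → evL x y (_+L_ F f g) ≈ evL x y f + evL x y g
    evL-+ (laurent k p) (laurent l q) = begin
      (F ^ y) (k ℕ.+ l) * ev (polyAdd F (replicate l 0# ++ p) (replicate k 0# ++ q)) x
        ≈⟨ *-cong (pow-+ y k l) (trans (ev-add (replicate l 0# ++ p) (replicate k 0# ++ q) x)
             (+-cong (ev-shift l p x) (ev-shift k q x))) ⟩
      (F ^ y) k * (F ^ y) l * ((F ^ x) l * ev p x + (F ^ x) k * ev q x)
        ≈⟨ solve 6 (λ yk yl xk xl p q → yk :* yl :* (xl :* p :+ xk :* q) := yl :* xl :* (yk :* p) :+ yk :* xk :* (yl :* q))
             refl _ _ _ _ _ _ ⟩
      (F ^ y) l * (F ^ x) l * ((F ^ y) k * ev p x) + (F ^ y) k * (F ^ x) k * ((F ^ y) l * ev q x)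
        ≈⟨ +-cong (trans (*-congʳ (pow-inverse xy≈1 l)) (*-identityˡ _)) (trans (*-congʳ (pow-inverse xy≈1 k)) (*-identityˡ _)) ⟩
      (F ^ y) k * ev p x + (F ^ y) l * ev q x ∎

    evL-* : ∀ f g → evL x y (_*L_ F f g) ≈ evL x y f * evL x y g
    evL-* (laurent k p) (laurent l q) = trans (*-cong (pow-+ y k l) (ev-mul p q x))
      (solve 4 (λ a b c d → a :* b :* (c :* d) := a :* c :* (b :* d)) refl _ _ _ _)

    evL-constL : ∀ a → evL x y (constL F a) ≈ a
    evL-constL a = trans (*-identityˡ _) (trans (+-congˡ (zeroʳ x)) (+-identityʳ a))

    evL-∑ : ∀ {n} (f : Fin n → Laurent F) → evL x y (∑L F f) ≈ ∑ F (λ i → evL x y (f i))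
    evL-∑ {zero} f = zeroʳ _
    evL-∑ {suc n} f = trans (evL-+ (f zero) (∑L F (f ∘ suc))) (+-congˡ (evL-∑ (f ∘ suc)))

    evL-act : ∀ {m₁ m₂ m₃ n₁ n₂ n₃} (A : Fin m₁ → Fin n₁ → Laurent F) (B : Fin m₂ → Fin n₂ → Laurent F)
      (C : Fin m₃ → Fin n₃ → Laurent F) T i j k →
      evL x y (act F A B C T i j k) ≈
      ∑ F λ a → ∑ F λ b → ∑ F λ c → evL x y (A i a) * (evL x y (B j b) * (evL x y (C k c) * T a b c))
    evL-act A B C T i j k =
      trans (evL-∑ λ a → ∑L F λ b → ∑L F λ c → term a b c) (∑-cong λ a →
      trans (evL-∑ λ b → ∑L F λ c → term a b c) (∑-cong λ b →
      trans (evL-∑ λ c → term a b c) (∑-cong λ c →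
      trans (evL-* (A i a) _) (*-congˡ (trans (evL-* (B j b) _) (*-congˡ
        (trans (evL-* (C k c) _) (*-congˡ (evL-constL _)))))))))
      where
      term = λ a b c → _*L_ F (A i a) (_*L_ F (B j b) (_*L_ F (C k c) (constL F (T a b c))))

    -- Absence of poles makes the first k coefficients vanish, so x^k factors out of the numerator
    -- and cancels the denominator y^k.
    evL-regular : ∀ f → (∀ n → coeffL F f -[1+ n ] ≈ 0#) → evL x y f ≈ ev (regularPart f) x
    evL-regular (laurent k p) no-pole = begin
      (F ^ y) k * ev p x ≈⟨ *-congˡ (factor k p low) ⟩
      (F ^ y) k * ((F ^ x) k * ev (drop k p) x) ≈⟨ *-assoc _ _ _ ⟨
      (F ^ y) k * (F ^ x) k * ev (drop k p) x ≈⟨ trans (*-congʳ (pow-inverse xy≈1 k)) (*-identityˡ _) ⟩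
      ev (drop k p) x ∎
      where
      factor : ∀ k p → (∀ i → i ℕ.< k → lookupℕ F p i ≈ 0#) → ev p x ≈ (F ^ x) k * ev (drop k p) x
      factor zero p low = sym (*-identityˡ _)
      factor (suc k) [] low = sym (zeroʳ _)
      factor (suc k) (a ∷ p) low = trans (+-cong (low 0 (s≤s z≤n)) (*-congˡ (factor k p λ i i<k → low (suc i) (s≤s i<k))))
        (trans (+-identityˡ _) (sym (*-assoc x _ _)))
      low : ∀ i → i ℕ.< k → lookupℕ F p i ≈ 0#
      low i i<k = trans (reflexive (≡.sym (≡.trans (coeffL-lookupℤ k p z) (≡.cong (lookupℤ p) z+k≡i)))) (no-pole (k ℕ.∸ suc i))
        where
        z = -[1+ k ℕ.∸ suc i ]
        z+k≡i : z ℤ.+ + k ≡ + i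
        z+k≡i = ≡.trans (ℤ.⊖-≥ (ℕ.≤-trans (ℕ.≤-reflexive (≡.sym (ℕ.+-∸-assoc 1 i<k))) (ℕ.m∸n≤m k i)))
          (≡.cong +_ (≡.trans (≡.cong (k ℕ.∸_) (≡.sym (ℕ.+-∸-assoc 1 i<k))) (ℕ.m∸[m∸n]≡n (ℕ.<⇒≤ i<k))))

  -- Each entry of the degenerated tensor has no pole, so it is a polynomial in ε whose value at 0
  -- is the entry of I_n. At an invertible ε it is also the entry obtained from the evaluated
  -- matrices.
  degeneration-dimension : IsAlgClosed F → ∀ {n₁ n₂ n₃ n} (T : Tensor F n₁ n₂ n₃) → _⊴_ F (I F n) T →
    ∀ {m} (σ : Fin m → Fin (n₁ ℕ.+ n₂)) → IndepOn F (ZeroSet F T) σ → m ℕ.+ n ℕ.≤ n₁ ℕ.+ n₂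
  degeneration-dimension closed T (A , B , C , no-pole , limit) = DimensionBound.degeneration-bound F closed T
    (λ i j k → ev (regularPart (entry i j k)))
    (λ i j k → regularPart (entry i j k) , λ x → refl)
    (λ i j k → trans (regularPart-0 (entry i j k)) (limit i j k))
    (λ x (y , xy≈1) → (λ i a → evL x y (A i a)) , (λ j b → evL x y (B j b)) , (λ k c → evL x y (C k c)) ,
      λ i j k → trans (sym (evL-act xy≈1 A B C T i j k)) (evL-regular xy≈1 (entry i j k) (no-pole i j k)))
    where entry = act F A B C T

↑ˡ≢↑ʳ : ∀ {m n} (i : Fin m) (j : Fin n) → i ↑ˡ n ≢ m ↑ʳ j
↑ˡ≢↑ʳ {m} {n} i j eq with ≡.trans (≡.sym (splitAt-↑ˡ m i n)) (≡.trans (≡.cong (splitAt m) eq) (splitAt-↑ʳ m n j))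
... | ()

-- Density of the invertible matrices

module GenericMatrices {c ℓ} (F : Field c ℓ) (closed : IsAlgClosed F) where
  open import Data.Integer using (+_)
  open Field F hiding (zero)
  open RingFacts F
  open FiniteSums F
  open Univariate F
  open import Relation.Binary.Reasoning.Setoid setoid

  Matrix : ℕ → ℕ → Set c
  Matrix m n = Fin m → Fin n → Carrier

  _≋_ : ∀ {m n} → Matrix m n → Matrix m n → Set ℓ
  A ≋ B = ∀ i j → A i j ≈ B i j

  -- Polynomial along every polynomial curve of matrices. This is enough for varying one entry at a
  -- time, and it survives the substitution of a Schur complement.
  Regular : ∀ {m n} → (Matrix m n → Carrier) → Set _
  Regular {m} {n} f = ∀ (M : Carrier → Matrix m n) → (∀ i j → IsPoly (λ t → M t i j)) → IsPoly (λ t → f (M t))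

  Solvable : ∀ {n} → Matrix n n → Set _
  Solvable {n} A = ∀ (b : Fin n → Carrier) → Σ[ w ∈ (Fin n → Carrier) ] (∀ i → ∑ F (λ j → A i j * w j) ≈ b i)

  block : ∀ {m n} → Matrix (suc m) (suc n) → Carrier → Matrix m n → Matrix (suc m) (suc n)
  block A t D zero zero = t
  block A t D zero (suc j) = A zero (suc j)
  block A t D (suc i) zero = A (suc i) zero
  block A t D (suc i) (suc j) = D i j

  block-cong : ∀ {m n} (A : Matrix (suc m) (suc n)) {t t′ D D′} → t ≈ t′ → D ≋ D′ → block A t D ≋ block A t′ D′
  block-cong A t≈ D≈ zero zero = t≈
  block-cong A t≈ D≈ zero (suc j) = refl
  block-cong A t≈ D≈ (suc i) zero = refl
  block-cong A t≈ D≈ (suc i) (suc j) = D≈ i j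

  -- Schur complement with respect to the invertible corner t.
  block-solvable : ∀ {n} (A : Matrix (suc n) (suc n)) t q → t * q ≈ 1# → ∀ D → Solvable D →
    Solvable (block A t (λ i j → D i j + A (suc i) zero * q * A zero (suc j)))
  block-solvable {n} A t q tq≈1 D solve-D b = w , λ { zero → row₀ ; (suc i) → row i }
    where
    r = λ j → A zero (suc j)
    d = λ i → A (suc i) zero
    v : Fin n → Carrier
    v = proj₁ (solve-D λ i → b (suc i) - d i * q * b zero)
    v-spec = proj₂ (solve-D λ i → b (suc i) - d i * q * b zero)
    S = ∑ F (λ j → r j * v j)
    w : Fin (suc n) → Carrier
    w zero = q * (b zero - S)
    w (suc j) = v j
    row₀ : t * (q * (b zero - S)) + S ≈ b zero
    row₀ = begin
      t * (q * (b zero - S)) + S ≈⟨ +-congʳ (sym (*-assoc t q _)) ⟩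
      t * q * (b zero - S) + S ≈⟨ +-congʳ (*-congʳ tq≈1) ⟩
      1# * (b zero - S) + S ≈⟨ solve 2 (λ b s → con (+ 1) :* (b :- s) :+ s := b) refl _ _ ⟩
      b zero ∎
    row : ∀ i → d i * (q * (b zero - S)) + ∑ F (λ j → (D i j + d i * q * r j) * v j) ≈ b (suc i)
    row i = begin
      d i * (q * (b zero - S)) + ∑ F (λ j → (D i j + d i * q * r j) * v j)
        ≈⟨ +-congˡ (trans (∑-cong λ j → trans (distribʳ (v j) (D i j) _) (+-congˡ (*-assoc (d i * q) (r j) (v j))))
             (trans (∑-+ (λ j → D i j * v j) (λ j → d i * q * (r j * v j)))
               (+-cong (v-spec i) (sym (∑-*ˡ (d i * q) (λ j → r j * v j)))))) ⟩
      d i * (q * (b zero - S)) + (b (suc i) - d i * q * b zero + d i * q * S)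
        ≈⟨ solve 5 (λ d q b s y → d :* (q :* (b :- s)) :+ (y :- d :* q :* b :+ d :* q :* s) := y) refl (d i) q (b zero) S _ ⟩
      b (suc i) ∎

  -- By density of the units it suffices to treat an invertible corner t. For such t, f is a regular
  -- function of the Schur complement D, and a solvable D makes the whole block solvable; the
  -- induction hypothesis gives f = 0 at every D, in particular at the one that restores the given
  -- minor.
  regular-solvable-vanish : ∀ n (f : Matrix n n → Carrier) → Regular f → (∀ {A B} → A ≋ B → f A ≈ f B) →
    (∀ A → Solvable A → f A ≈ 0#) → ∀ A → f A ≈ 0#
  regular-solvable-vanish zero f _ _ vanish A = vanish A λ b → (λ ()) , λ ()
  regular-solvable-vanish (suc n) f f-reg f-cong vanish A = trans
    (f-cong λ { zero zero → refl ; zero (suc j) → refl ; (suc i) zero → refl ; (suc i) (suc j) → refl })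
    (vanish-offZero closed (f-reg (λ t → block A t minor) λ
      { zero zero → poly-id ; zero (suc j) → poly-const _ ; (suc i) zero → poly-const _ ; (suc i) (suc j) → poly-const _ })
      invertible-corner (A zero zero))
    where
    minor : Matrix n n
    minor i j = A (suc i) (suc j)

    invertible-corner : ∀ t → Inv t → f (block A t minor) ≈ 0#
    invertible-corner t (q , tq≈1) = trans
      (f-cong (block-cong A refl λ i j → solve 2 (λ m x → m := m :- x :+ x) refl (minor i j) (outer i j)))
      (regular-solvable-vanish n (λ D → f (block A t λ i j → D i j + outer i j))
        (λ M M-poly → f-reg (λ s → block A t λ i j → M s i j + outer i j) λ
          { zero zero → poly-const _ ; zero (suc j) → poly-const _ ; (suc i) zero → poly-const _
          ; (suc i) (suc j) → poly-+ (M-poly i j) (poly-const _) })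
        (λ D≋ → f-cong (block-cong A refl λ i j → +-congʳ (D≋ i j)))
        (λ D D-solvable → vanish _ (block-solvable A t q tq≈1 D D-solvable))
        (λ i j → minor i j - outer i j))
      where
      outer : Matrix n n
      outer i j = A (suc i) zero * q * A zero (suc j)

  eval-cong : ∀ {n} (f : Poly F n) {v w} → (∀ i → v i ≈ w i) → eval F f v ≈ eval F f w
  eval-cong (con a) v≈w = refl
  eval-cong (var i) v≈w = v≈w i
  eval-cong (f ⊕ g) v≈w = +-cong (eval-cong f v≈w) (eval-cong g v≈w)
  eval-cong (f ⊗ g) v≈w = *-cong (eval-cong f v≈w) (eval-cong g v≈w)

  eval-poly : ∀ {n} (f : Poly F n) {v : Carrier → Fin n → Carrier} → (∀ i → IsPoly (λ t → v t i)) →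
    IsPoly (λ t → eval F f (v t))
  eval-poly (con a) v-poly = poly-const a
  eval-poly (var i) v-poly = v-poly i
  eval-poly (f ⊕ g) v-poly = poly-+ (eval-poly f v-poly) (eval-poly g v-poly)
  eval-poly (f ⊗ g) v-poly = poly-* (eval-poly f v-poly) (eval-poly g v-poly)

-- The matrix multiplication tensor in coordinates

module MatrixMultiplication {c ℓ} (F : Field c ℓ) where
  open Field F hiding (zero)
  open RingFacts F
  open FiniteSums F
  open import Relation.Binary.Reasoning.Setoid setoid

  MM-entry : ∀ {e h l} (a : Fin e) (b b′ : Fin h) (c c′ : Fin l) (a′ : Fin e) →
    MM F e h l (combine a b) (combine b′ c) (combine c′ a′) ≡ δ F b b′ * (δ F c c′ * δ F a a′)
  MM-entry {e} {h} {l} a b b′ c c′ a′ = ≡.trans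
    (≡.cong (λ x → entry x (remQuot l (combine b′ c)) (remQuot e (combine c′ a′))) (remQuot-combine a b))
    (≡.cong₂ (entry (a , b)) (remQuot-combine b′ c) (remQuot-combine c′ a′))
    where
    entry : Fin e × Fin h → Fin h × Fin l → Fin l × Fin e → Carrier
    entry (a , b) (b′ , c) (c′ , a′) = δ F b b′ * (δ F c c′ * δ F a a′)

  -- The coordinate `combine c a` of the bilinear map is the entry (a, c) of XY: the three deltas
  -- collapse the sums over a′, b′ and c′.
  MM-zeroSet : ∀ {e h l} (p : Fin (e ℕ.* h ℕ.+ h ℕ.* l) → Carrier) →
    (∀ (a : Fin e) (c : Fin l) → ∑ F (λ b → p (combine a b ↑ˡ _) * p (e ℕ.* h ↑ʳ combine b c)) ≈ 0#) →
    ZeroSet F (MM F e h l) p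
  MM-zeroSet {e} {h} {l} p XY≈0 k = ≡.subst
    (λ k → ∑ F (λ i → ∑ F λ j → MM F e h l i j k * (p (i ↑ˡ _) * p (e ℕ.* h ↑ʳ j))) ≈ 0#)
    (combine-remQuot {l} e k) (at (proj₁ (remQuot {l} e k)) (proj₂ (remQuot {l} e k)))
    where
    X = λ (a : Fin e) (b : Fin h) → p (combine a b ↑ˡ (h ℕ.* l))
    Y = λ (b : Fin h) (c : Fin l) → p (e ℕ.* h ↑ʳ combine b c)
    at : ∀ c a → ∑ F (λ i → ∑ F λ j → MM F e h l i j (combine c a) * (p (i ↑ˡ _) * p (e ℕ.* h ↑ʳ j))) ≈ 0#
    at c a = begin
      ∑ F (λ i → ∑ F λ j → MM F e h l i j (combine c a) * (p (i ↑ˡ _) * p (e ℕ.* h ↑ʳ j)))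
        ≈⟨ ∑-combine e (λ i → ∑ F λ j → MM F e h l i j (combine c a) * (p (i ↑ˡ _) * p (e ℕ.* h ↑ʳ j))) ⟩
      ∑ F (λ a′ → ∑ F λ b → ∑ F λ j → MM F e h l (combine a′ b) j (combine c a) * (X a′ b * p (e ℕ.* h ↑ʳ j)))
        ≈⟨ ∑-cong (λ a′ → ∑-cong λ (b : Fin h) → begin
             ∑ F (λ j → MM F e h l (combine a′ b) j (combine c a) * (X a′ b * p (e ℕ.* h ↑ʳ j)))
               ≈⟨ ∑-combine h (λ j → MM F e h l (combine a′ b) j (combine c a) * (X a′ b * p (e ℕ.* h ↑ʳ j))) ⟩
             ∑ F (λ b′ → ∑ F λ c′ → MM F e h l (combine a′ b) (combine b′ c′) (combine c a) * (X a′ b * Y b′ c′))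
               ≈⟨ ∑-cong (λ b′ → trans (∑-cong λ (c′ : Fin l) → trans (*-congʳ (reflexive (MM-entry a′ b b′ c′ c a)))
                    (solve 4 (λ x y z w → x :* (y :* z) :* w := x :* (y :* (z :* w))) refl (δ F b b′) (δ F c′ c) (δ F a′ a) _))
                    (sym (∑-*ˡ (δ F b b′) (λ c′ → δ F c′ c * (δ F a′ a * (X a′ b * Y b′ c′)))))) ⟩
             ∑ F (λ b′ → δ F b b′ * ∑ F λ c′ → δ F c′ c * (δ F a′ a * (X a′ b * Y b′ c′)))
               ≈⟨ ∑-δ b (λ b′ → ∑ F λ c′ → δ F c′ c * (δ F a′ a * (X a′ b * Y b′ c′))) ⟩
             ∑ F (λ c′ → δ F c′ c * (δ F a′ a * (X a′ b * Y b c′)))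
               ≈⟨ ∑-δʳ c (λ c′ → δ F a′ a * (X a′ b * Y b c′)) ⟩
             δ F a′ a * (X a′ b * Y b c) ∎) ⟩
      ∑ F (λ a′ → ∑ F λ b → δ F a′ a * (X a′ b * Y b c))
        ≈⟨ ∑-cong (λ a′ → ∑-*ˡ (δ F a′ a) (λ b → X a′ b * Y b c)) ⟨
      ∑ F (λ a′ → δ F a′ a * ∑ F λ b → X a′ b * Y b c)
        ≈⟨ ∑-δʳ a (λ a′ → ∑ F λ b → X a′ b * Y b c) ⟩
      ∑ F (λ b → X a b * Y b c) ≈⟨ XY≈0 a c ⟩
      0# ∎

-- Independent coordinates on a component of {XY = 0}

module RankCoordinates (r e′ h′ l : ℕ) where

  -- The first r rows of X, the first r columns of its other rows, and the last h′ rows of Y. When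
  -- the upper left block of X is invertible, these determine the point: the rest of X by rank r,
  -- the rest of Y by XY = 0.
  Coord : Set
  Coord = (Fin r × Fin (r ℕ.+ h′)) ⊎ ((Fin e′ × Fin r) ⊎ (Fin h′ × Fin l))

  dimension : ℕ
  dimension = r ℕ.* (r ℕ.+ h′) ℕ.+ (e′ ℕ.* r ℕ.+ h′ ℕ.* l)

  N₁ N₂ : ℕ
  N₁ = (r ℕ.+ e′) ℕ.* (r ℕ.+ h′)
  N₂ = (r ℕ.+ h′) ℕ.* l

  decode : Fin dimension → Coord
  decode z = [ inj₁ ∘ remQuot (r ℕ.+ h′) , inj₂ ∘ (λ y → [ inj₁ ∘ remQuot r , inj₂ ∘ remQuot l ]′ (splitAt (e′ ℕ.* r) y)) ]′
    (splitAt (r ℕ.* (r ℕ.+ h′)) z)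

  encode : Coord → Fin dimension
  encode (inj₁ (i , b)) = combine i b ↑ˡ _
  encode (inj₂ (inj₁ (i , b))) = r ℕ.* (r ℕ.+ h′) ↑ʳ (combine i b ↑ˡ _)
  encode (inj₂ (inj₂ (b , c))) = r ℕ.* (r ℕ.+ h′) ↑ʳ (e′ ℕ.* r ↑ʳ combine b c)

  encode-decode : ∀ z → encode (decode z) ≡ z
  encode-decode z with splitAt (r ℕ.* (r ℕ.+ h′)) z in eq
  ... | inj₁ i = ≡.trans (≡.cong (_↑ˡ _) (combine-remQuot {r} (r ℕ.+ h′) i)) (splitAt⁻¹-↑ˡ eq)
  ... | inj₂ y with splitAt (e′ ℕ.* r) y in eq′
  ...   | inj₁ i = ≡.trans (≡.cong (r ℕ.* (r ℕ.+ h′) ↑ʳ_)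
            (≡.trans (≡.cong (_↑ˡ _) (combine-remQuot {e′} r i)) (splitAt⁻¹-↑ˡ eq′))) (splitAt⁻¹-↑ʳ {i = z} eq)
  ...   | inj₂ i = ≡.trans (≡.cong (r ℕ.* (r ℕ.+ h′) ↑ʳ_)
            (≡.trans (≡.cong (e′ ℕ.* r ↑ʳ_) (combine-remQuot {h′} l i)) (splitAt⁻¹-↑ʳ {i = y} eq′))) (splitAt⁻¹-↑ʳ {i = z} eq)

  place : Coord → Fin (N₁ ℕ.+ N₂)
  place (inj₁ (i , b)) = combine (i ↑ˡ e′) b ↑ˡ N₂
  place (inj₂ (inj₁ (i , b))) = combine (r ↑ʳ i) (b ↑ˡ h′) ↑ˡ N₂
  place (inj₂ (inj₂ (b , c))) = N₁ ↑ʳ combine (r ↑ʳ b) c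

  place-injective : ∀ κ κ′ → place κ ≡ place κ′ → κ ≡ κ′
  place-injective (inj₁ (i , b)) (inj₁ (i′ , b′)) eq with combine-injective (i ↑ˡ e′) b (i′ ↑ˡ e′) b′ (↑ˡ-injective N₂ _ _ eq)
  ... | eq₁ , ≡.refl = ≡.cong (λ i → inj₁ (i , b)) (↑ˡ-injective e′ i i′ eq₁)
  place-injective (inj₁ (i , b)) (inj₂ (inj₁ (i′ , b′))) eq =
    contradiction (proj₁ (combine-injective (i ↑ˡ e′) b (r ↑ʳ i′) (b′ ↑ˡ h′) (↑ˡ-injective N₂ _ _ eq))) (↑ˡ≢↑ʳ i i′)
  place-injective (inj₁ (i , b)) (inj₂ (inj₂ _)) eq = contradiction eq (↑ˡ≢↑ʳ _ _)
  place-injective (inj₂ (inj₁ (i , b))) (inj₁ (i′ , b′)) eq =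
    contradiction (proj₁ (combine-injective (i′ ↑ˡ e′) b′ (r ↑ʳ i) (b ↑ˡ h′) (≡.sym (↑ˡ-injective N₂ _ _ eq)))) (↑ˡ≢↑ʳ i′ i)
  place-injective (inj₂ (inj₁ (i , b))) (inj₂ (inj₁ (i′ , b′))) eq
    with combine-injective (r ↑ʳ i) (b ↑ˡ h′) (r ↑ʳ i′) (b′ ↑ˡ h′) (↑ˡ-injective N₂ _ _ eq)
  ... | eq₁ , eq₂ = ≡.cong₂ (λ i b → inj₂ (inj₁ (i , b))) (↑ʳ-injective r i i′ eq₁) (↑ˡ-injective h′ b b′ eq₂)
  place-injective (inj₂ (inj₁ _)) (inj₂ (inj₂ _)) eq = contradiction eq (↑ˡ≢↑ʳ _ _)
  place-injective (inj₂ (inj₂ _)) (inj₁ _) eq = contradiction (≡.sym eq) (↑ˡ≢↑ʳ _ _)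
  place-injective (inj₂ (inj₂ _)) (inj₂ (inj₁ _)) eq = contradiction (≡.sym eq) (↑ˡ≢↑ʳ _ _)
  place-injective (inj₂ (inj₂ (b , c))) (inj₂ (inj₂ (b′ , c′))) eq
    with combine-injective (r ↑ʳ b) c (r ↑ʳ b′) c′ (↑ʳ-injective N₁ _ _ eq)
  ... | eq₁ , ≡.refl = ≡.cong (λ b → inj₂ (inj₂ (b , c))) (↑ʳ-injective r b b′ eq₁)

  σ : Fin dimension → Fin (N₁ ℕ.+ N₂)
  σ = place ∘ decode

  σ-injective : Injective _≡_ _≡_ σ
  σ-injective {x} {y} eq = ≡.trans (≡.sym (encode-decode x))
    (≡.trans (≡.cong encode (place-injective (decode x) (decode y) eq)) (encode-decode y))

module RankVariety {c ℓ} (F : Field c ℓ) (closed : IsAlgClosed F) (r e′ h′ l : ℕ) where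
  open import Data.Integer using (+_)
  open Field F hiding (zero)
  open RingFacts F
  open FiniteSums F
  open Univariate F
  open GenericMatrices F closed
  open MatrixMultiplication F
  open RankCoordinates r e′ h′ l
  open import Relation.Binary.Reasoning.Setoid setoid

  module _ (f : Poly F dimension)
    (vanish : ∀ p → ZeroSet F (MM F (r ℕ.+ e′) (r ℕ.+ h′) l) p → eval F f (λ z → p (σ z)) ≈ 0#)
    (a : Fin dimension → Carrier) where

    private
      B : Matrix r h′
      B i j = a (encode (inj₁ (i , r ↑ʳ j)))

      C : Matrix e′ r
      C i j = a (encode (inj₂ (inj₁ (i , j))))

      Y₂ : Matrix h′ l
      Y₂ j c = a (encode (inj₂ (inj₂ (j , c))))

      fill : Matrix r r → Coord → Carrier
      fill A (inj₁ (i , b)) = [ A i , B i ]′ (splitAt r b)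
      fill A (inj₂ (inj₁ (i , b))) = C i b
      fill A (inj₂ (inj₂ (b , c))) = Y₂ b c

      -- Only the upper left block is varied, all other coordinates being frozen at `a`. For a
      -- solvable block the coordinates extend to a point of the zero set, where f vanishes; density
      -- covers the remaining blocks.
      f̂ : Matrix r r → Carrier
      f̂ A = eval F f (λ z → fill A (decode z))

      f̂-regular : Regular f̂
      f̂-regular M M-poly = eval-poly f λ z → fill-poly (decode z)
        where
        fill-poly : ∀ κ → IsPoly (λ t → fill (M t) κ)
        fill-poly (inj₁ (i , b)) with splitAt r b
        ... | inj₁ j = M-poly i j
        ... | inj₂ j = poly-const _
        fill-poly (inj₂ (inj₁ _)) = poly-const _
        fill-poly (inj₂ (inj₂ _)) = poly-const _

      f̂-cong : ∀ {A A′} → A ≋ A′ → f̂ A ≈ f̂ A′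
      f̂-cong {A} {A′} A≋A′ = eval-cong f λ z → fill-cong (decode z)
        where
        fill-cong : ∀ κ → fill A κ ≈ fill A′ κ
        fill-cong (inj₁ (i , b)) with splitAt r b
        ... | inj₁ j = A≋A′ i j
        ... | inj₂ j = refl
        fill-cong (inj₂ (inj₁ _)) = refl
        fill-cong (inj₂ (inj₂ _)) = refl

      -- With A W = B, the product of [A B; C CW] and [−W Y₂; Y₂] is zero.
      module Point (A : Matrix r r) (A-solvable : Solvable A) where
        W : Matrix r h′
        W k j = proj₁ (A-solvable λ i → B i j) k

        AW≈B : ∀ i j → ∑ F (λ k → A i k * W k j) ≈ B i j
        AW≈B i j = proj₂ (A-solvable λ i → B i j) i

        X : Matrix (r ℕ.+ e′) (r ℕ.+ h′)
        X x y = [ (λ i → [ A i , B i ]′ (splitAt r y))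
                , (λ i → [ C i , (λ j → ∑ F λ k → C i k * W k j) ]′ (splitAt r y)) ]′ (splitAt r x)

        Y : Matrix (r ℕ.+ h′) l
        Y y c = [ (λ k → - (∑ F λ j → W k j * Y₂ j c)) , (λ j → Y₂ j c) ]′ (splitAt r y)

        row-annihilates : ∀ (v : Fin r → Carrier) (y : Fin h′ → Carrier) →
          ∑ F (λ k → v k * - (∑ F λ j → W k j * y j)) + ∑ F (λ j → ∑ F (λ k → v k * W k j) * y j) ≈ 0#
        row-annihilates v y = begin
          ∑ F (λ k → v k * - (∑ F λ j → W k j * y j)) + ∑ F (λ j → ∑ F (λ k → v k * W k j) * y j)
            ≈⟨ +-cong (trans (∑-cong λ k → solve 2 (λ v s → v :* (:- s) := (:- con (+ 1)) :* (v :* s)) refl (v k) _)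
                 (sym (∑-*ˡ (- 1#) (λ k → v k * ∑ F λ j → W k j * y j))))
                 (trans (∑-cong λ j → ∑-*ʳ (y j) (λ k → v k * W k j)) (trans (∑-swap λ j k → v k * W k j * y j)
                   (∑-cong λ k → trans (∑-cong λ j → *-assoc (v k) (W k j) (y j)) (sym (∑-*ˡ (v k) (λ j → W k j * y j)))))) ⟩
          - 1# * S + S ≈⟨ solve 1 (λ s → (:- con (+ 1)) :* s :+ s := con (+ 0)) refl S ⟩
          0# ∎
          where S = ∑ F (λ k → v k * ∑ F λ j → W k j * y j)

        XY≈0 : ∀ x c → ∑ F (λ y → X x y * Y y c) ≈ 0#
        XY≈0 x c = begin
          ∑ F (λ y → X x y * Y y c) ≈⟨ ∑-++ r (λ y → X x y * Y y c) ⟩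
          ∑ F (λ k → X x (k ↑ˡ h′) * Y (k ↑ˡ h′) c) + ∑ F (λ j → X x (r ↑ʳ j) * Y (r ↑ʳ j) c)
            ≈⟨ +-cong (∑-cong λ k → reflexive (≡.cong (λ s → X′ x s * Y′ s c) (splitAt-↑ˡ r k h′)))
                 (∑-cong λ j → reflexive (≡.cong (λ s → X′ x s * Y′ s c) (splitAt-↑ʳ r h′ j))) ⟩
          ∑ F (λ k → X′ x (inj₁ k) * Y′ (inj₁ k) c) + ∑ F (λ j → X′ x (inj₂ j) * Y₂ j c)
            ≈⟨ rows (splitAt r x) ⟩
          0# ∎
          where
          X″ : Fin r ⊎ Fin e′ → Fin r ⊎ Fin h′ → Carrier
          X″ x y = [ (λ i → [ A i , B i ]′ y) , (λ i → [ C i , (λ j → ∑ F λ k → C i k * W k j) ]′ y) ]′ x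
          X′ : Fin (r ℕ.+ e′) → Fin r ⊎ Fin h′ → Carrier
          X′ x = X″ (splitAt r x)
          Y′ : Fin r ⊎ Fin h′ → Fin l → Carrier
          Y′ y c = [ (λ k → - (∑ F λ j → W k j * Y₂ j c)) , (λ j → Y₂ j c) ]′ y
          rows : ∀ x → ∑ F (λ k → X″ x (inj₁ k) * Y′ (inj₁ k) c) + ∑ F (λ j → X″ x (inj₂ j) * Y₂ j c) ≈ 0#
          rows (inj₁ i) = trans (+-congˡ (∑-cong λ j → *-congʳ (sym (AW≈B i j)))) (row-annihilates (A i) (λ j → Y₂ j c))
          rows (inj₂ i) = row-annihilates (C i) (λ j → Y₂ j c)

        point : Fin (N₁ ℕ.+ N₂) → Carrier
        point z = [ uncurry X ∘ remQuot (r ℕ.+ h′) , uncurry Y ∘ remQuot l ]′ (splitAt N₁ z)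

        point-X : ∀ x y → point (combine x y ↑ˡ N₂) ≡ X x y
        point-X x y = ≡.trans (≡.cong [ _ , _ ]′ (splitAt-↑ˡ N₁ (combine x y) N₂)) (≡.cong (uncurry X) (remQuot-combine x y))

        point-Y : ∀ y c → point (N₁ ↑ʳ combine y c) ≡ Y y c
        point-Y y c = ≡.trans (≡.cong [ _ , _ ]′ (splitAt-↑ʳ N₁ N₂ (combine y c))) (≡.cong (uncurry Y) (remQuot-combine y c))

        point∈V : ZeroSet F (MM F (r ℕ.+ e′) (r ℕ.+ h′) l) point
        point∈V = MM-zeroSet point λ x c → trans
          (∑-cong λ y → *-cong (reflexive (point-X x y)) (reflexive (point-Y y c))) (XY≈0 x c)

        point-place : ∀ κ → point (place κ) ≡ fill A κ
        point-place (inj₁ (i , b)) = ≡.trans (point-X (i ↑ˡ e′) b) (≡.cong [ _ , _ ]′ (splitAt-↑ˡ r i e′))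
        point-place (inj₂ (inj₁ (i , b))) = ≡.trans (point-X (r ↑ʳ i) (b ↑ˡ h′))
          (≡.trans (≡.cong [ _ , _ ]′ (splitAt-↑ʳ r e′ i)) (≡.cong [ _ , _ ]′ (splitAt-↑ˡ r b h′)))
        point-place (inj₂ (inj₂ (b , c))) = ≡.trans (point-Y (r ↑ʳ b) c) (≡.cong [ _ , _ ]′ (splitAt-↑ʳ r h′ b))

    vanishes-everywhere : eval F f a ≈ 0#
    vanishes-everywhere = trans (eval-cong f λ z → reflexive (≡.trans (≡.cong a (≡.sym (encode-decode z))) (≡.sym (fill-a (decode z)))))
      (regular-solvable-vanish r f̂ f̂-regular f̂-cong
        (λ A A-solvable → let open Point A A-solvable in
          trans (eval-cong f λ z → reflexive (≡.sym (point-place (decode z)))) (vanish point point∈V))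
        (λ i j → a (encode (inj₁ (i , j ↑ˡ h′)))))
      where
      fill-a : ∀ κ → fill (λ i j → a (encode (inj₁ (i , j ↑ˡ h′)))) κ ≡ a (encode κ)
      fill-a (inj₁ (i , b)) with splitAt r b in eq
      ... | inj₁ j = ≡.cong (λ b → a (encode (inj₁ (i , b)))) (splitAt⁻¹-↑ˡ eq)
      ... | inj₂ j = ≡.cong (λ b → a (encode (inj₁ (i , b)))) (splitAt⁻¹-↑ʳ {i = b} eq)
      fill-a (inj₂ (inj₁ _)) = ≡.refl
      fill-a (inj₂ (inj₂ _)) = ≡.refl

  σ-independent : IndepOn F (ZeroSet F (MM F (r ℕ.+ e′) (r ℕ.+ h′) l)) σ
  σ-independent = vanishes-everywhere

-- Strassen's monomial degeneration

module MonomialDegeneration {c ℓ} (F : Field c ℓ) where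
  open import Data.Integer using (+_; -[1+_])
  open Field F hiding (zero)
  open FiniteSums F
  open LaurentFacts F
  open MatrixMultiplication F
  open import Relation.Binary.Reasoning.Setoid setoid

  -- A weight (w , k) stands for the exponent w − k of ε.
  monomialMatrix : ∀ {m n} → (Fin m → Fin n) → (Fin n → ℕ × ℕ) → Fin m → Fin n → Laurent F
  monomialMatrix α w i a = monoL (δ F (α i) a) (proj₁ (w a)) (proj₂ (w a))

  -- The exponent with its sign reversed: the coefficient at z of ε^(w - k) f is that of f at z + k
  -- - w.
  pole : ℕ × ℕ → ℤ
  pole (w , k) = + k ℤ.- + w

  coeffL-act-monomial : ∀ {m₁ m₂ m₃ n₁ n₂ n₃} (T : Tensor F n₁ n₂ n₃)
    (α : Fin m₁ → Fin n₁) (β : Fin m₂ → Fin n₂) (γ : Fin m₃ → Fin n₃) wα wβ wγ i j k z →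
    coeffL F (act F (monomialMatrix α wα) (monomialMatrix β wβ) (monomialMatrix γ wγ) T i j k) z ≈
    lookupℤ (T (α i) (β j) (γ k) ∷ []) (z ℤ.+ pole (wα (α i)) ℤ.+ pole (wβ (β j)) ℤ.+ pole (wγ (γ k)))
  coeffL-act-monomial T α β γ wα wβ wγ i j k z = begin
    coeffL F (act F A B C T i j k) z
      ≈⟨ trans (coeffL-∑ (λ a → ∑L F λ b → ∑L F λ c → term a b c) z) (∑-cong λ a →
         trans (coeffL-∑ (λ b → ∑L F λ c → term a b c) z) (∑-cong λ b →
         trans (coeffL-∑ (λ c → term a b c) z) (∑-cong λ c → term-coeff a b c))) ⟩
    ∑ F (λ a → ∑ F λ b → ∑ F λ c → δ F (α i) a * (δ F (β j) b * (δ F (γ k) c * value a b c)))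
      ≈⟨ ∑-cong (λ a → trans (∑-cong λ b → trans (sym (∑-*ˡ (δ F (α i) a) (λ c → δ F (β j) b * (δ F (γ k) c * value a b c))))
           (*-congˡ (trans (sym (∑-*ˡ (δ F (β j) b) (λ c → δ F (γ k) c * value a b c))) (*-congˡ (∑-δ (γ k) (value a b))))))
           (trans (sym (∑-*ˡ (δ F (α i) a) (λ b → δ F (β j) b * value a b (γ k)))) (*-congˡ (∑-δ (β j) (λ b → value a b (γ k)))))) ⟩
    ∑ F (λ a → δ F (α i) a * value a (β j) (γ k)) ≈⟨ ∑-δ (α i) (λ a → value a (β j) (γ k)) ⟩
    value (α i) (β j) (γ k) ∎
    where
    A = monomialMatrix α wα
    B = monomialMatrix β wβ
    C = monomialMatrix γ wγ
    term = λ a b c → _*L_ F (A i a) (_*L_ F (B j b) (_*L_ F (C k c) (constL F (T a b c))))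
    value = λ a b c → lookupℤ (T a b c ∷ []) (z ℤ.+ pole (wα a) ℤ.+ pole (wβ b) ℤ.+ pole (wγ c))
    term-coeff : ∀ a b c → coeffL F (term a b c) z ≈ δ F (α i) a * (δ F (β j) b * (δ F (γ k) c * value a b c))
    term-coeff a b c =
      trans (coeffL-monoL* (δ F (α i) a) (proj₁ (wα a)) (proj₂ (wα a)) (_*L_ F (B j b) (_*L_ F (C k c) (constL F (T a b c)))) z) (*-congˡ
      (trans (coeffL-monoL* (δ F (β j) b) (proj₁ (wβ b)) (proj₂ (wβ b)) (_*L_ F (C k c) (constL F (T a b c))) (z ℤ.+ pole (wα a))) (*-congˡ
      (trans (coeffL-monoL* (δ F (γ k) c) (proj₁ (wγ c)) (proj₂ (wγ c)) (constL F (T a b c)) (z ℤ.+ pole (wα a) ℤ.+ pole (wβ b))) (*-congˡ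
      (coeffL-constL (T a b c) (z ℤ.+ pole (wα a) ℤ.+ pole (wβ b) ℤ.+ pole (wγ c))))))))

  lookupℤ-[≈0] : ∀ {t} → t ≈ 0# → ∀ z → lookupℤ (t ∷ []) z ≈ 0#
  lookupℤ-[≈0] t≈0 (+ zero) = t≈0
  lookupℤ-[≈0] t≈0 (+ suc n) = refl
  lookupℤ-[≈0] t≈0 -[1+ n ] = refl

  square : ∀ x → x ℤ.* x ≡ + (ℤ.∣ x ∣ ℕ.* ℤ.∣ x ∣)
  square (+ n) = ≡.sym (ℤ.pos-* n n)
  square -[1+ n ] = ≡.refl

  lookupℤ-negative : ∀ p n x → lookupℤ p (-[1+ n ] ℤ.- x ℤ.* x) ≡ 0#
  lookupℤ-negative p n x rewrite square x with ℤ.∣ x ∣ ℕ.* ℤ.∣ x ∣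
  ... | zero = ≡.refl
  ... | suc _ = ≡.refl

  lookupℤ-negative₀ : ∀ p x → x ≢ + 0 → lookupℤ p (+ 0 ℤ.- x ℤ.* x) ≡ 0#
  lookupℤ-negative₀ p (+ zero) x≢0 = contradiction ≡.refl x≢0
  lookupℤ-negative₀ p (+ suc n) _ = ≡.refl
  lookupℤ-negative₀ p -[1+ n ] _ = ≡.refl

  I-diagonal : ∀ {n} (i : Fin n) → I F n i i i ≈ 1#
  I-diagonal i = trans (*-cong (δ-refl i) (δ-refl i)) (*-identityʳ 1#)

  I-offDiagonal : ∀ {n} (i j k : Fin n) → ¬ (i ≡ j × j ≡ k) → I F n i j k ≈ 0#
  I-offDiagonal i j k ne with i ≟ j
  ... | no _ = zeroˡ _
  ... | yes i≡j = trans (*-congˡ (δ-≢ λ j≡k → ne (i≡j , j≡k))) (zeroʳ _)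

  -- Strassen's degeneration: the weights i² + 2ij, j² − 2jK and K² − 2iK of the
  -- variables x_ij, y_jk and z_ki, where K = s + k, add up to (i + j − K)².
  module _ {e h l n : ℕ} (s : ℕ) (ι : Fin n → Fin e) (η : Fin n → Fin h) (κ : Fin n → Fin l)
    (on-plane : ∀ x → toℕ (ι x) ℕ.+ toℕ (η x) ≡ s ℕ.+ toℕ (κ x))
    (injective : ∀ {x y} → ι x ≡ ι y → η x ≡ η y → x ≡ y)
    where

    private
      xWeight yWeight zWeight : ℕ → ℕ → ℕ × ℕ
      xWeight i j = i ℕ.* i ℕ.+ 2 ℕ.* (i ℕ.* j) , 0
      yWeight j k = j ℕ.* j , 2 ℕ.* (j ℕ.* (s ℕ.+ k))
      zWeight k i = (s ℕ.+ k) ℕ.* (s ℕ.+ k) , 2 ℕ.* (i ℕ.* (s ℕ.+ k))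

      onPair : (ℕ → ℕ → ℕ × ℕ) → ∀ m n → Fin (m ℕ.* n) → ℕ × ℕ
      onPair w m n = uncurry (λ a b → w (toℕ a) (toℕ b)) ∘ remQuot {m} n

      onPair-combine : ∀ w {m n} (a : Fin m) (b : Fin n) → onPair w m n (combine a b) ≡ w (toℕ a) (toℕ b)
      onPair-combine w a b = ≡.cong (uncurry (λ a b → w (toℕ a) (toℕ b))) (remQuot-combine a b)

      α : Fin n → Fin (e ℕ.* h)
      α x = combine (ι x) (η x)

      β : Fin n → Fin (h ℕ.* l)
      β x = combine (η x) (κ x)

      γ : Fin n → Fin (l ℕ.* e)
      γ x = combine (κ x) (ι x)

      -- Here i and j come from the matched indices and i′ is the row of the second cell. That cell
      -- lies on the plane, so K = i′ + j, and the total exponent (i + j - K)² becomes (i - i′)².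
      poles-add : ∀ z i j k i′ → i′ ℕ.+ j ≡ s ℕ.+ k →
        z ℤ.+ pole (xWeight i j) ℤ.+ pole (yWeight j k) ℤ.+ pole (zWeight k i) ≡
        z ℤ.- (+ i ℤ.- + i′) ℤ.* (+ i ℤ.- + i′)
      poles-add z i j k i′ eq = ≡.trans
        (≡.cong₂ ℤ._+_ (≡.cong₂ (λ u v → z ℤ.+ u ℤ.+ v)
          (≡.cong (λ u → + 0 ℤ.- u) (≡.cong₂ ℤ._+_ (ℤ.pos-* i i) (double i j)))
          (≡.cong₂ ℤ._-_ (double j (s ℕ.+ k)) (ℤ.pos-* j j)))
          (≡.cong₂ ℤ._-_ (double i (s ℕ.+ k)) (ℤ.pos-* (s ℕ.+ k) (s ℕ.+ k))))
        (≡.trans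
          (≡.cong (λ K → z ℤ.+ (+ 0 ℤ.- (+ i ℤ.* + i ℤ.+ + 2 ℤ.* (+ i ℤ.* + j)))
            ℤ.+ (+ 2 ℤ.* (+ j ℤ.* K) ℤ.- + j ℤ.* + j)
            ℤ.+ (+ 2 ℤ.* (+ i ℤ.* K) ℤ.- K ℤ.* K)) (≡.cong +_ (≡.sym eq)))
          (identity z (+ i) (+ j) (+ i′)))
        where
        double : ∀ a b → + (2 ℕ.* (a ℕ.* b)) ≡ + 2 ℤ.* (+ a ℤ.* + b)
        double a b = ≡.trans (ℤ.pos-* 2 (a ℕ.* b)) (≡.cong (λ u → + 2 ℤ.* u) (ℤ.pos-* a b))
        identity : ∀ z i j i′ →
          z ℤ.+ (+ 0 ℤ.- (i ℤ.* i ℤ.+ + 2 ℤ.* (i ℤ.* j)))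
            ℤ.+ (+ 2 ℤ.* (j ℤ.* (i′ ℤ.+ j)) ℤ.- j ℤ.* j)
            ℤ.+ (+ 2 ℤ.* (i ℤ.* (i′ ℤ.+ j)) ℤ.- (i′ ℤ.+ j) ℤ.* (i′ ℤ.+ j))
          ≡ z ℤ.- (i ℤ.- i′) ℤ.* (i ℤ.- i′)
        identity = ℤ-Solver.solve-∀

      entry : Fin n → Fin n → Fin n → Laurent F
      entry = act F (monomialMatrix α (onPair xWeight e h)) (monomialMatrix β (onPair yWeight h l))
        (monomialMatrix γ (onPair zWeight l e)) (MM F e h l)

      tensorEntry : Fin n → Fin n → Fin n → Carrier
      tensorEntry x y z = δ F (η x) (η y) * (δ F (κ y) (κ z) * δ F (ι x) (ι z))

      entry-coeff : ∀ x y z m → coeffL F (entry x y z) m ≈ lookupℤ (tensorEntry x y z ∷ [])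
        (m ℤ.+ pole (xWeight (toℕ (ι x)) (toℕ (η x))) ℤ.+ pole (yWeight (toℕ (η y)) (toℕ (κ y)))
           ℤ.+ pole (zWeight (toℕ (κ z)) (toℕ (ι z))))
      entry-coeff x y z m = trans (coeffL-act-monomial (MM F e h l) α β γ (onPair xWeight e h) (onPair yWeight h l) (onPair zWeight l e) x y z m) (reflexive (≡.cong₂
        (λ t → lookupℤ (t ∷ [])) (MM-entry (ι x) (η x) (η y) (κ y) (κ z) (ι z))
        (≡.cong₂ (λ u w → m ℤ.+ u ℤ.+ pole (onPair yWeight h l (β y)) ℤ.+ w)
          (≡.cong pole (onPair-combine xWeight (ι x) (η x))) (≡.cong pole (onPair-combine zWeight (κ z) (ι z)))
         ⟨trans⟩ ≡.cong (λ v → m ℤ.+ pole (xWeight (toℕ (ι x)) (toℕ (η x))) ℤ.+ v ℤ.+ pole (zWeight (toℕ (κ z)) (toℕ (ι z))))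
          (≡.cong pole (onPair-combine yWeight (η y) (κ y))))))
        where _⟨trans⟩_ = ≡.trans

      entry-unmatched : ∀ x y z → tensorEntry x y z ≈ 0# → ∀ m → coeffL F (entry x y z) m ≈ 0#
      entry-unmatched x y z t≈0 m = trans (entry-coeff x y z m) (lookupℤ-[≈0] t≈0
        (m ℤ.+ pole (xWeight (toℕ (ι x)) (toℕ (η x))) ℤ.+ pole (yWeight (toℕ (η y)) (toℕ (κ y)))
           ℤ.+ pole (zWeight (toℕ (κ z)) (toℕ (ι z)))))

      entry-matched : ∀ x y z → η x ≡ η y → κ y ≡ κ z → ι x ≡ ι z → ∀ m →
        coeffL F (entry x y z) m ≈
        lookupℤ (1# ∷ []) (m ℤ.- (+ toℕ (ι x) ℤ.- + toℕ (ι y)) ℤ.* (+ toℕ (ι x) ℤ.- + toℕ (ι y)))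
      entry-matched x y z ηx≡ηy κy≡κz ιx≡ιz m = begin
        coeffL F (entry x y z) m ≈⟨ entry-coeff x y z m ⟩
        lookupℤ (tensorEntry x y z ∷ []) (m ℤ.+ pole (xWeight (toℕ (ι x)) (toℕ (η x)))
          ℤ.+ pole (yWeight (toℕ (η y)) (toℕ (κ y))) ℤ.+ pole (zWeight (toℕ (κ z)) (toℕ (ι z))))
          ≡⟨ ≡.cong (lookupℤ (tensorEntry x y z ∷ [])) (exponent (≡.sym ηx≡ηy) (≡.sym κy≡κz) (≡.sym ιx≡ιz)) ⟩
        lookupℤ (tensorEntry x y z ∷ []) x² ≈⟨ singleton-cong x² one ⟩
        lookupℤ (1# ∷ []) x² ∎
        where
        x² = m ℤ.- (+ toℕ (ι x) ℤ.- + toℕ (ι y)) ℤ.* (+ toℕ (ι x) ℤ.- + toℕ (ι y))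
        exponent : ∀ {ηy κz ιz} → ηy ≡ η x → κz ≡ κ y → ιz ≡ ι x →
          m ℤ.+ pole (xWeight (toℕ (ι x)) (toℕ (η x))) ℤ.+ pole (yWeight (toℕ ηy) (toℕ (κ y)))
            ℤ.+ pole (zWeight (toℕ κz) (toℕ ιz)) ≡ x²
        exponent ≡.refl ≡.refl ≡.refl = poles-add m (toℕ (ι x)) (toℕ (η x)) (toℕ (κ y)) (toℕ (ι y))
          (≡.trans (≡.cong (λ j → toℕ (ι y) ℕ.+ toℕ j) ηx≡ηy) (on-plane y))
        one : tensorEntry x y z ≈ 1#
        one = trans (*-cong (δ-≡ ηx≡ηy) (trans (*-cong (δ-≡ κy≡κz) (δ-≡ ιx≡ιz)) (*-identityˡ 1#))) (*-identityˡ 1#)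
          where
          δ-≡ : ∀ {n} {i j : Fin n} → i ≡ j → δ F i j ≈ 1#
          δ-≡ {i = i} ≡.refl = δ-refl i
        singleton-cong : ∀ z {t u} → t ≈ u → lookupℤ (t ∷ []) z ≈ lookupℤ (u ∷ []) z
        singleton-cong (+ zero) t≈u = t≈u
        singleton-cong (+ suc n) t≈u = refl
        singleton-cong -[1+ n ] t≈u = refl

      poles-vanish : ∀ x y z n → coeffL F (entry x y z) -[1+ n ] ≈ 0#
      poles-vanish x y z n with η x ≟ η y | κ y ≟ κ z | ι x ≟ ι z
      ... | yes p | yes q | yes r = trans (entry-matched x y z p q r -[1+ n ]) (reflexive (lookupℤ-negative (1# ∷ []) n (+ toℕ (ι x) ℤ.- + toℕ (ι y))))
      ... | no p | _ | _ = entry-unmatched x y z (trans (*-congʳ (δ-≢ p)) (zeroˡ _)) -[1+ n ]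
      ... | yes _ | no q | _ = entry-unmatched x y z (trans (*-congˡ (trans (*-congʳ (δ-≢ q)) (zeroˡ _))) (zeroʳ _)) -[1+ n ]
      ... | yes _ | yes _ | no r = entry-unmatched x y z (trans (*-congˡ (trans (*-congˡ (δ-≢ r)) (zeroʳ _))) (zeroʳ _)) -[1+ n ]

      -- The plane equation recovers the column of a cell from ι and κ. This identifies the third
      -- index with the second in the limit.
      κ-injective : ∀ {x y} → ι x ≡ ι y → κ x ≡ κ y → x ≡ y
      κ-injective {x} {y} ιx≡ιy κx≡κy = injective ιx≡ιy (toℕ-injective (ℕ.+-cancelˡ-≡ (toℕ (ι x)) _ _ (≡.trans (on-plane x)
        (≡.trans (≡.cong (λ k → s ℕ.+ toℕ k) κx≡κy) (≡.trans (≡.sym (on-plane y)) (≡.cong (λ i → toℕ i ℕ.+ toℕ (η y)) (≡.sym ιx≡ιy)))))))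

      limit : ∀ x y z → coeffL F (entry x y z) (+ 0) ≈ I F n x y z
      limit x y z with η x ≟ η y | κ y ≟ κ z | ι x ≟ ι z
      ... | no p | _ | _ = trans (entry-unmatched x y z (trans (*-congʳ (δ-≢ p)) (zeroˡ _)) (+ 0))
        (sym (I-offDiagonal x y z λ (x≡y , _) → p (≡.cong η x≡y)))
      ... | yes _ | no q | _ = trans (entry-unmatched x y z (trans (*-congˡ (trans (*-congʳ (δ-≢ q)) (zeroˡ _))) (zeroʳ _)) (+ 0))
        (sym (I-offDiagonal x y z λ (_ , y≡z) → q (≡.cong κ y≡z)))
      ... | yes _ | yes _ | no r = trans (entry-unmatched x y z (trans (*-congˡ (trans (*-congˡ (δ-≢ r)) (zeroʳ _))) (zeroʳ _)) (+ 0))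
        (sym (I-offDiagonal x y z λ (x≡y , y≡z) → r (≡.cong ι (≡.trans x≡y y≡z))))
      ... | yes p | yes q | yes r with ι x ≟ ι y
      -- A matched triple from cells in different rows is multiplied by a positive power of ε and
      -- disappears in the limit.
      ...   | no ιx≢ιy = trans (entry-matched x y z p q r (+ 0)) (trans
        (reflexive (lookupℤ-negative₀ (1# ∷ []) (+ toℕ (ι x) ℤ.- + toℕ (ι y)) λ eq →
          ιx≢ιy (toℕ-injective (ℤ.+-injective (ℤ.i-j≡0⇒i≡j (+ toℕ (ι x)) (+ toℕ (ι y)) eq)))))
        (sym (I-offDiagonal x y z λ (x≡y , _) → ιx≢ιy (≡.cong ι x≡y))))
      ...   | yes ιx≡ιy with injective ιx≡ιy p
      ...     | ≡.refl with κ-injective r q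
      ...       | ≡.refl = trans (entry-matched x y z p q r (+ 0)) (trans
        (reflexive (≡.cong (λ d → lookupℤ (1# ∷ []) (+ 0 ℤ.- d ℤ.* d)) (ℤ.+-inverseʳ (+ toℕ (ι x)))))
        (sym (I-diagonal x)))

    I⊴MM : _⊴_ F (I F n) (MM F e h l)
    I⊴MM = monomialMatrix α (onPair xWeight e h) , monomialMatrix β (onPair yWeight h l) ,
      monomialMatrix γ (onPair zWeight l e) , poles-vanish , limit

-- The size of the band and the value of the formula

module Arithmetic where
  open import Data.Nat hiding (parity)
  open import Data.Nat.Properties
  open import Data.Nat.DivMod using (m*n/n≡m; +-distrib-/; m<n⇒m/n≡0; m*n%n≡0; m<n⇒m%n≡m)
  open import Data.Nat.Tactic.RingSolver using (solve-∀)
  open import Relation.Binary.PropositionalEquality hiding ([_])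

  sumBelow : ℕ → (ℕ → ℕ) → ℕ
  sumBelow zero f = 0
  sumBelow (suc n) f = f 0 + sumBelow n (f ∘ suc)

  sumBelow-cong : ∀ n {f g} → (∀ i → i < n → f i ≡ g i) → sumBelow n f ≡ sumBelow n g
  sumBelow-cong zero f≡g = refl
  sumBelow-cong (suc n) f≡g = cong₂ _+_ (f≡g 0 (s≤s z≤n)) (sumBelow-cong n λ i i<n → f≡g (suc i) (s≤s i<n))

  sumBelow-+ : ∀ n f g → sumBelow n (λ i → f i + g i) ≡ sumBelow n f + sumBelow n g
  sumBelow-+ zero f g = refl
  sumBelow-+ (suc n) f g = trans (cong (f 0 + g 0 +_) (sumBelow-+ n (f ∘ suc) (g ∘ suc))) (rearrange (f 0) (g 0) _ _)
    where
    rearrange : ∀ a b c d → a + b + (c + d) ≡ a + c + (b + d)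
    rearrange = solve-∀

  sumBelow-const : ∀ n c → sumBelow n (λ _ → c) ≡ n * c
  sumBelow-const zero c = refl
  sumBelow-const (suc n) c = cong (c +_) (sumBelow-const n c)

  sumBelow-last : ∀ n f → sumBelow (suc n) f ≡ sumBelow n f + f n
  sumBelow-last zero f = +-comm (f 0) 0
  sumBelow-last (suc n) f = trans (cong (f 0 +_) (sumBelow-last n (f ∘ suc))) (sym (+-assoc (f 0) _ _))

  triangle : ℕ → ℕ
  triangle zero = 0
  triangle (suc n) = suc n + triangle n

  sumBelow-lower : ∀ {n} c → c ≤ n → sumBelow n (c ∸_) ≡ triangle c
  sumBelow-lower {n} zero _ = trans (sumBelow-cong n λ i _ → 0∸n≡0 i) (trans (sumBelow-const n 0) (*-zeroʳ n))
  sumBelow-lower (suc c) (s≤s c≤n) = cong (suc c +_) (sumBelow-lower c c≤n)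

  sumBelow-suc : ∀ n → sumBelow n suc ≡ triangle n
  sumBelow-suc zero = refl
  sumBelow-suc (suc n) = trans (sumBelow-last n suc) (trans (+-comm _ (suc n)) (cong (suc n +_) (sumBelow-suc n)))

  sumBelow-upper : ∀ n b → b ≤ n → sumBelow n (λ i → suc (i + b) ∸ n) ≡ triangle b
  sumBelow-upper n b b≤n with m≤n⇒m<n∨m≡n b≤n
  ... | inj₂ refl = trans (sumBelow-cong n λ i _ → m+n∸n≡m (suc i) n) (sumBelow-suc n)
  sumBelow-upper (suc n) b b≤n | inj₁ (s≤s b≤n′) = cong₂ _+_ (m≤n⇒m∸n≡0 b≤n′) (sumBelow-upper n b b≤n′)

  cell : ∀ n f → Fin (sumBelow n f) → Σ[ i ∈ Fin n ] Fin (f (toℕ i))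
  cell (suc n) f x = [ (λ t → zero , t) , (λ y → suc (proj₁ (cell n (f ∘ suc) y)) , proj₂ (cell n (f ∘ suc) y)) ]′
    (splitAt (f 0) x)

  cell-injective : ∀ n f x y → proj₁ (cell n f x) ≡ proj₁ (cell n f y) →
    toℕ (proj₂ (cell n f x)) ≡ toℕ (proj₂ (cell n f y)) → x ≡ y
  cell-injective (suc n) f x y eq₁ eq₂ with splitAt (f 0) x in eqx | splitAt (f 0) y in eqy
  ... | inj₁ s | inj₁ t = trans (sym (splitAt⁻¹-↑ˡ eqx)) (trans (cong (Fin._↑ˡ _) (toℕ-injective eq₂)) (splitAt⁻¹-↑ˡ eqy))
  ... | inj₂ s | inj₂ t = trans (sym (splitAt⁻¹-↑ʳ {i = x} eqx)) (trans
    (cong (f 0 Fin.↑ʳ_) (cell-injective n (f ∘ suc) s t (Fin.suc-injective eq₁) eq₂)) (splitAt⁻¹-↑ʳ {i = y} eqy))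

  -- The pairs (i , j) ∈ [e] × [h] with c ≤ i + j < c + l, row by row: row i
  -- omits its first c ∸ i and its last suc (i + b) ∸ e entries.
  module Band {e h l c b : ℕ} (e≤h : e ≤ h) (c+b≤e : c + b ≤ e) (width : e + h ≤ suc (c + b + l)) where

    lower upper row : ℕ → ℕ
    lower i = c ∸ i
    upper i = suc (i + b) ∸ e
    row i = h ∸ (lower i + upper i)

    size : ℕ
    size = sumBelow e row

    -- As c + b is at most e, the two corners meet disjoint sets of rows, so in each row one of the
    -- summands is zero and the other is at most e.
    lower+upper≤h : ∀ i → i < e → lower i + upper i ≤ h
    lower+upper≤h i i<e with i <? c
    ... | yes i<c = ≤-trans (+-mono-≤ (m∸n≤m c i) (≤-reflexive (m≤n⇒m∸n≡0 (≤-trans (+-monoˡ-≤ b i<c) c+b≤e))))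
      (≤-trans (≤-reflexive (+-identityʳ c)) (≤-trans (m+n≤o⇒m≤o c c+b≤e) e≤h))
    ... | no i≮c = ≤-trans (+-mono-≤ (≤-reflexive (m≤n⇒m∸n≡0 (≮⇒≥ i≮c))) (m≤n+o⇒m∸n≤o (suc (i + b)) e (+-monoˡ-≤ b i<e)))
      (≤-trans (m+n≤o⇒n≤o c c+b≤e) e≤h)

    size+corners : size + (triangle c + triangle b) ≡ e * h
    size+corners = begin
      size + (triangle c + triangle b)
        ≡⟨ cong (size +_) (cong₂ _+_ (sumBelow-lower c (m+n≤o⇒m≤o c c+b≤e)) (sumBelow-upper e b (m+n≤o⇒n≤o c c+b≤e))) ⟨
      size + (sumBelow e lower + sumBelow e upper) ≡⟨ cong (size +_) (sumBelow-+ e lower upper) ⟨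
      size + sumBelow e (λ i → lower i + upper i) ≡⟨ sumBelow-+ e row (λ i → lower i + upper i) ⟨
      sumBelow e (λ i → row i + (lower i + upper i)) ≡⟨ sumBelow-cong e (λ i i<e → m∸n+n≡m (lower+upper≤h i i<e)) ⟩
      sumBelow e (λ _ → h) ≡⟨ sumBelow-const e h ⟩
      e * h ∎
      where open ≡-Reasoning

    i₀ : Fin size → Fin e
    i₀ x = proj₁ (cell e row x)

    t₀ : Fin size → ℕ
    t₀ x = toℕ (proj₂ (cell e row x))

    column+upper<h : ∀ x → lower (toℕ (i₀ x)) + t₀ x + upper (toℕ (i₀ x)) < h
    column+upper<h x = begin-strict
      lower i + t₀ x + upper i ≡⟨ rearrange (lower i) (t₀ x) (upper i) ⟩
      t₀ x + (lower i + upper i) <⟨ +-monoˡ-< (lower i + upper i) (toℕ<n (proj₂ (cell e row x))) ⟩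
      row i + (lower i + upper i) ≡⟨ m∸n+n≡m (lower+upper≤h i (toℕ<n (i₀ x))) ⟩
      h ∎
      where
      open ≤-Reasoning
      i = toℕ (i₀ x)
      rearrange : ∀ a t u → a + t + u ≡ t + (a + u)
      rearrange = solve-∀

    column<h : ∀ x → lower (toℕ (i₀ x)) + t₀ x < h
    column<h x = ≤-<-trans (m≤m+n _ _) (column+upper<h x)

    c≤i+j : ∀ x → c ≤ toℕ (i₀ x) + (lower (toℕ (i₀ x)) + t₀ x)
    c≤i+j x = ≤-trans (m≤n+m∸n c (toℕ (i₀ x))) (+-monoʳ-≤ (toℕ (i₀ x)) (m≤m+n _ _))

    -- Combine j + upper i < h with i + 1 + b at most e + upper i: the antidiagonal satisfies i + j
    -- + 1 + b < e + h, which `width` bounds by 1 + c + b + l.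
    i+j∸c<l : ∀ x → toℕ (i₀ x) + (lower (toℕ (i₀ x)) + t₀ x) ∸ c < l
    i+j∸c<l x = +-cancelˡ-< (suc (c + b)) _ _ (begin-strict
      suc (c + b) + (i + j ∸ c) ≡⟨ move c b (i + j ∸ c) ⟩
      suc b + (c + (i + j ∸ c)) ≡⟨ cong (suc b +_) (m+[n∸m]≡n (c≤i+j x)) ⟩
      suc b + (i + j) ≡⟨ move′ b i j ⟩
      suc (i + b) + j ≤⟨ +-monoˡ-≤ j (m≤n+m∸n (suc (i + b)) e) ⟩
      e + upper i + j ≡⟨ move″ e (upper i) j ⟩
      e + (j + upper i) <⟨ +-monoʳ-< e (column+upper<h x) ⟩
      e + h ≤⟨ width ⟩
      suc (c + b) + l ∎)
      where
      open ≤-Reasoning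
      i = toℕ (i₀ x)
      j = lower i + t₀ x
      move : ∀ c b d → suc (c + b) + d ≡ suc b + (c + d)
      move = solve-∀
      move′ : ∀ b i j → suc b + (i + j) ≡ suc (i + b) + j
      move′ = solve-∀
      move″ : ∀ e u j → e + u + j ≡ e + (j + u)
      move″ = solve-∀

    j₀ : Fin size → Fin h
    j₀ x = fromℕ< (column<h x)

    k₀ : Fin size → Fin l
    k₀ x = fromℕ< (i+j∸c<l x)

    on-plane : ∀ x → toℕ (i₀ x) + toℕ (j₀ x) ≡ c + toℕ (k₀ x)
    on-plane x = begin
      toℕ (i₀ x) + toℕ (j₀ x) ≡⟨ cong (toℕ (i₀ x) +_) (toℕ-fromℕ< (column<h x)) ⟩
      toℕ (i₀ x) + (lower (toℕ (i₀ x)) + t₀ x) ≡⟨ m+[n∸m]≡n (c≤i+j x) ⟨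
      c + (toℕ (i₀ x) + (lower (toℕ (i₀ x)) + t₀ x) ∸ c) ≡⟨ cong (c +_) (toℕ-fromℕ< (i+j∸c<l x)) ⟨
      c + toℕ (k₀ x) ∎
      where open ≡-Reasoning

    cell-determined : ∀ {x y} → i₀ x ≡ i₀ y → j₀ x ≡ j₀ y → x ≡ y
    cell-determined {x} {y} eq₁ eq₂ = cell-injective e row x y eq₁ (+-cancelˡ-≡ (lower (toℕ (i₀ x))) _ _ (begin
      lower (toℕ (i₀ x)) + t₀ x ≡⟨ toℕ-fromℕ< (column<h x) ⟨
      toℕ (j₀ x) ≡⟨ cong toℕ eq₂ ⟩
      toℕ (j₀ y) ≡⟨ toℕ-fromℕ< (column<h y) ⟩
      lower (toℕ (i₀ y)) + t₀ y ≡⟨ cong (λ i → lower (toℕ i) + t₀ y) eq₁ ⟨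
      lower (toℕ (i₀ x)) + t₀ y ∎))
      where open ≡-Reasoning

  -- With d = max(e + h − l, 0): r = ⌊d/2⌋ is the rank of X on a largest component of
  -- {XY = 0}, q = ⌊d²/4⌋, and c, b are the sides of the two corners cut off by the band.
  record Split (e h l : ℕ) : Set where
    field
      c b r e′ h′ q : ℕ
      c+b≤e : c + b ≤ e
      width : e + h ≤ suc (c + b + l)
      corners : triangle c + triangle b ≡ q
      e-split : r + e′ ≡ e
      h-split : r + h′ ≡ h
      -- Equivalently, the component has dimension q + hl, and so codimension eh - q, the size of
      -- the band.
      balance : q + r * l ≡ r * (r + h′) + e′ * r
      formula-value : formula e h l ≡ e * h ∸ q

  quarter : ∀ n d → d < 4 → (d + n * 4) / 4 ≡ n
  quarter n d d<4 = trans (+-distrib-/ d (n * 4) (subst (_< 4)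
      (sym (trans (cong (d % 4 +_) (m*n%n≡0 n 4)) (trans (+-identityʳ _) (m<n⇒m%n≡m d<4)))) d<4))
    (cong₂ _+_ (m<n⇒m/n≡0 d<4) (m*n/n≡m n 4))

  triangle-double : ∀ n → triangle n + triangle n ≡ n * suc n
  triangle-double zero = refl
  triangle-double (suc n) = trans (rearrange n (triangle n)) (trans (cong (suc n + suc n +_) (triangle-double n)) (collect n))
    where
    rearrange : ∀ n t → suc n + t + (suc n + t) ≡ suc n + suc n + (t + t)
    rearrange = solve-∀
    collect : ∀ n → suc n + suc n + n * suc n ≡ suc n * suc (suc n)
    collect = solve-∀

  triangle-pred : ∀ n → triangle (pred n) + triangle n ≡ n * n
  triangle-pred zero = refl
  triangle-pred (suc n) = trans (rearrange n (triangle n)) (trans (cong (suc n +_) (triangle-double n)) (collect n))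
    where
    rearrange : ∀ n t → t + (suc n + t) ≡ suc n + (t + t)
    rearrange = solve-∀
    collect : ∀ n → suc n + n * suc n ≡ suc n * suc n
    collect = solve-∀

  evenOrOdd : ∀ n → ∃[ u ] (n ≡ u + u ⊎ n ≡ suc (u + u))
  evenOrOdd zero = 0 , inj₁ refl
  evenOrOdd (suc n) with evenOrOdd n
  ... | u , inj₁ refl = u , inj₂ refl
  ... | u , inj₂ refl = suc u , inj₁ (cong suc (sym (+-suc u u)))

  formula-≥ : ∀ e h l s q → e + h ≡ s + l → (s * s) / 4 ≡ q → formula e h l ≡ e * h ∸ q
  formula-≥ e h l s q eq sq with l ≤? e + h
  ... | yes _ = cong (e * h ∸_) (trans (cong (λ s → (s * s) / 4) (trans (cong (_∸ l) eq) (m+n∸n≡m s l))) sq)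
  ... | no l≰ = contradiction (≤-trans (m≤n+m l s) (≤-reflexive (sym eq))) l≰

  formula-< : ∀ e h l → e + h < l → formula e h l ≡ e * h
  formula-< e h l e+h<l with l ≤? e + h
  ... | yes l≤ = contradiction l≤ (<⇒≱ e+h<l)
  ... | no _ = refl

  split : ∀ {e h l} → e ≤ h → h ≤ l → Split e h l
  split {e} {h} {l} e≤h h≤l with l ≤? e + h
  -- All antidiagonals fit into a window of length l, so no corner is cut; the component is {X = 0}.
  ... | no l≰ = record
    { c = 0 ; b = 0 ; r = 0 ; e′ = e ; h′ = h ; q = 0
    ; c+b≤e = z≤n ; width = ≤-trans (<⇒≤ (≰⇒> l≰)) (n≤1+n l) ; corners = refl
    ; e-split = refl ; h-split = refl ; balance = sym (*-zeroʳ e)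
    ; formula-value = formula-< e h l (≰⇒> l≰) }
  ... | yes l≤ = byParity (evenOrOdd s)
    where
    s = e + h ∸ l
    e+h≡s+l : e + h ≡ s + l
    e+h≡s+l = sym (m∸n+n≡m l≤)
    s≤e : s ≤ e
    s≤e = m≤n+o⇒m∸n≤o (e + h) l (≤-trans (≤-reflexive (+-comm e h)) (+-monoˡ-≤ e h≤l))
    -- With e + h = s + l and s = u + s′, both sides equal u(e + h - u). The product u s′ of the two
    -- nearly equal halves of s is ⌊s²/4⌋.
    rebalance : ∀ {u s′} → u ≤ e → s ≡ u + s′ → u * s′ + u * l ≡ u * (u + (h ∸ u)) + (e ∸ u) * u
    rebalance {u} {s′} u≤e s≡ = begin
      u * s′ + u * l ≡⟨ *-distribˡ-+ u s′ l ⟨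
      u * (s′ + l) ≡⟨ cong (u *_) (+-cancelˡ-≡ u _ _ (begin
        u + (s′ + l) ≡⟨ +-assoc u s′ l ⟨
        u + s′ + l ≡⟨ cong (_+ l) s≡ ⟨
        s + l ≡⟨ e+h≡s+l ⟨
        e + h ≡⟨ cong (_+ h) (m+[n∸m]≡n u≤e) ⟨
        u + (e ∸ u) + h ≡⟨ +-assoc u (e ∸ u) h ⟩
        u + (e ∸ u + h) ∎)) ⟩
      u * (e ∸ u + h) ≡⟨ *-distribˡ-+ u (e ∸ u) h ⟩
      u * (e ∸ u) + u * h ≡⟨ cong₂ _+_ (*-comm u (e ∸ u)) (cong (u *_) (sym (m+[n∸m]≡n (≤-trans u≤e e≤h)))) ⟩
      (e ∸ u) * u + u * (u + (h ∸ u)) ≡⟨ +-comm ((e ∸ u) * u) _ ⟩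
      u * (u + (h ∸ u)) + (e ∸ u) * u ∎
      where open ≡-Reasoning
    -- Of the e + h - 1 antidiagonals, s - 1 must be cut, as evenly as possible on the two sides: u
    -- - 1 and u when s = 2u, with removed area u², and u and u when s = 2u + 1, with removed area
    -- u(u + 1). For s = 0 nothing is cut and `pred` truncates to 0, a case in which `width` is
    -- strict.
    byParity : ∃[ u ] (s ≡ u + u ⊎ s ≡ suc (u + u)) → Split e h l
    byParity (u , inj₁ s≡) = record
      { c = pred u ; b = u ; r = u ; e′ = e ∸ u ; h′ = h ∸ u ; q = u * u
      ; c+b≤e = ≤-trans (+-monoˡ-≤ u (pred[n]≤n {u})) 2u≤e
      ; width = ≤-trans (≤-reflexive (trans e+h≡s+l (cong (_+ l) s≡))) (+-monoˡ-≤ l (+-monoˡ-≤ u (m≤n+m∸n u 1)))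
      ; corners = triangle-pred u
      ; e-split = m+[n∸m]≡n u≤e ; h-split = m+[n∸m]≡n (≤-trans u≤e e≤h)
      ; balance = rebalance u≤e s≡
      ; formula-value = formula-≥ e h l s (u * u) e+h≡s+l (trans (cong (λ s → s * s / 4) s≡)
          (trans (cong (_/ 4) (expand u)) (quarter (u * u) 0 (s≤s z≤n)))) }
      where
      2u≤e = ≤-trans (≤-reflexive (sym s≡)) s≤e
      u≤e = ≤-trans (m≤m+n u u) 2u≤e
      expand : ∀ u → (u + u) * (u + u) ≡ u * u * 4
      expand = solve-∀
    byParity (u , inj₂ s≡) = record
      { c = u ; b = u ; r = u ; e′ = e ∸ u ; h′ = h ∸ u ; q = u * suc u
      ; c+b≤e = 2u≤e
      ; width = ≤-reflexive (trans e+h≡s+l (cong (_+ l) s≡))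
      ; corners = triangle-double u
      ; e-split = m+[n∸m]≡n u≤e ; h-split = m+[n∸m]≡n (≤-trans u≤e e≤h)
      ; balance = rebalance u≤e (trans s≡ (sym (+-suc u u)))
      ; formula-value = formula-≥ e h l s (u * suc u) e+h≡s+l (trans (cong (λ s → s * s / 4) s≡)
          (trans (cong (_/ 4) (expand u)) (quarter (u * suc u) 1 (s≤s (s≤s z≤n))))) }
      where
      2u≤e = <⇒≤ (≤-trans (≤-reflexive (sym s≡)) s≤e)
      u≤e = ≤-trans (m≤m+n u u) 2u≤e
      expand : ∀ u → suc (u + u) * suc (u + u) ≡ 1 + u * suc u * 4
      expand = solve-∀

  m≡n+o⇒m∸o≡n : ∀ {m n o} → m ≡ n + o → m ∸ o ≡ n
  m≡n+o⇒m∸o≡n {n = n} {o} eq = trans (cong (_∸ o) eq) (m+n∸n≡m n o)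

  -- For m = 2u both sides are 3u², for m = 2u + 1 both are 3u(u + 1) + 1. The 3 added before
  -- division by 4 leaves the remainders 3 and 2 respectively, so the rounding up is exact.
  formula-cube : ∀ m → formula m m m ≡ ceil3m²/4 m
  formula-cube m with evenOrOdd m
  ... | u , inj₁ refl = trans (formula-≥ m m m m (u * u) refl (trans (cong (_/ 4) (expand u)) (quarter (u * u) 0 (s≤s z≤n))))
    (trans (m≡n+o⇒m∸o≡n (expand′ u)) (sym (trans (cong (_/ 4) (expand″ u)) (quarter (3 * (u * u)) 3 ≤-refl))))
    where
    expand : ∀ u → (u + u) * (u + u) ≡ u * u * 4
    expand = solve-∀
    expand′ : ∀ u → (u + u) * (u + u) ≡ 3 * (u * u) + u * u
    expand′ = solve-∀
    expand″ : ∀ u → 3 * ((u + u) * (u + u)) + 3 ≡ 3 + 3 * (u * u) * 4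
    expand″ = solve-∀
  ... | u , inj₂ refl = trans (formula-≥ m m m m (u * suc u) refl (trans (cong (_/ 4) (expand u)) (quarter (u * suc u) 1 (s≤s (s≤s z≤n)))))
    (trans (m≡n+o⇒m∸o≡n (expand′ u)) (sym (trans (cong (_/ 4) (expand″ u)) (quarter (3 * (u * suc u) + 1) 2 (s≤s (s≤s (s≤s z≤n)))))))
    where
    expand : ∀ u → suc (u + u) * suc (u + u) ≡ 1 + u * suc u * 4
    expand = solve-∀
    expand′ : ∀ u → suc (u + u) * suc (u + u) ≡ 3 * (u * suc u) + 1 + u * suc u
    expand′ = solve-∀
    expand″ : ∀ u → 3 * (suc (u + u) * suc (u + u)) + 3 ≡ 2 + (3 * (u * suc u) + 1) * 4
    expand″ = solve-∀

-- The common value of border subrank and geometric rank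

module Values {c ℓ} (F : Field c ℓ) (closed : IsAlgClosed F) where

  open import Data.Nat using (_+_; _*_; _∸_)
  open import Data.Nat.Properties
  open import Data.Nat.Tactic.RingSolver using (solve-∀)
  open import Relation.Binary.PropositionalEquality
  open Arithmetic

  -- The two bounds of degeneration-dimension meet: each of the two witnesses certifies that the other is optimal.
  ranks-from-witnesses : ∀ {n₁ n₂ n₃} (T : Tensor F n₁ n₂ n₃) n d → n + d ≡ n₁ + n₂ → _⊴_ F (I F n) T →
    (σ : Fin d → Fin (n₁ + n₂)) → Injective _≡_ _≡_ σ → IndepOn F (ZeroSet F T) σ →
    BorderSubrankIs F T n × GeometricRankIs F T n
  ranks-from-witnesses T n d n+d≡N I⊴T σ σ-injective σ-independent =
    (I⊴T , λ m I⊴T′ → +-cancelˡ-≤ d m n (≤-trans (degeneration-dimension closed T I⊴T′ σ σ-independent)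
      (≤-reflexive (trans (sym n+d≡N) (+-comm n d))))) ,
    (d , ((σ , σ-injective , σ-independent) , λ m τ _ τ-independent →
      +-cancelʳ-≤ n m d (≤-trans (degeneration-dimension closed T I⊴T τ τ-independent)
        (≤-reflexive (trans (sym n+d≡N) (+-comm n d))))) , n+d≡N)
    where open LaurentFacts F

  ranks-MM : ∀ {e h l} → e ≤ h → Split e h l →
    BorderSubrankIs F (MM F e h l) (formula e h l) × GeometricRankIs F (MM F e h l) (formula e h l)
  -- Matching the two splittings with `refl` gives e and h the forms r + e′ and r + h′ in which the
  -- rank component is described.
  ranks-MM {e} {h} {l} e≤h s@record { e-split = refl ; h-split = refl } =
    ranks-from-witnesses (MM F e h l) (formula e h l) dimension total
      (subst (λ n → _⊴_ F (I F n) (MM F e h l)) size≡formula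
        (MonomialDegeneration.I⊴MM F s₀ i₀ j₀ k₀ on-plane cell-determined))
      σ σ-injective (RankVariety.σ-independent F closed r e′ h′ l)
    where
    open Split s renaming (c to s₀; b to s₁)
    open Band {e} {h} {l} {s₀} {s₁} e≤h c+b≤e width
    open RankCoordinates r e′ h′ l
    size+q : size + q ≡ e * h
    size+q = trans (cong (size +_) (sym corners)) size+corners
    size≡formula : size ≡ formula e h l
    size≡formula = trans (sym (m+n∸n≡m size q)) (trans (cong (_∸ q) size+q) (sym formula-value))
    total : formula e h l + dimension ≡ e * h + h * l
    total = begin
      formula e h l + dimension ≡⟨ cong (_+ dimension) size≡formula ⟨
      size + (r * (r + h′) + (e′ * r + h′ * l)) ≡⟨ cong (size +_) (+-assoc (r * (r + h′)) _ _) ⟨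
      size + (r * (r + h′) + e′ * r + h′ * l) ≡⟨ cong (λ x → size + (x + h′ * l)) balance ⟨
      size + (q + r * l + h′ * l) ≡⟨ rearrange size q r l h′ ⟩
      size + q + h * l ≡⟨ cong (_+ h * l) size+q ⟩
      e * h + h * l ∎
      where
      open ≡-Reasoning
      rearrange : ∀ a q r l h′ → a + (q + r * l + h′ * l) ≡ a + q + (r + h′) * l
      rearrange = solve-∀

theorem6p1 : ∀ {c ℓ} (F : Field c ℓ) → IsAlgClosed F →
    ((e h l : ℕ) → 1 ≤ e → e ≤ h → h ≤ l →
    BorderSubrankIs F (MM F e h l) (formula e h l) ×
    GeometricRankIs F (MM F e h l) (formula e h l)) ×
    ((m : ℕ) → 1 ≤ m →
    BorderSubrankIs F (MM F m m m) (ceil3m²/4 m) ×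
    GeometricRankIs F (MM F m m m) (ceil3m²/4 m))
theorem6p1 F closed =
  (λ e h l _ e≤h h≤l → ranks-MM {e} {h} {l} e≤h (split e≤h h≤l)) ,
  (λ m _ → ≡.subst (λ n → BorderSubrankIs F (MM F m m m) n × GeometricRankIs F (MM F m m m) n)
    (formula-cube m) (ranks-MM {m} {m} {m} ℕ.≤-refl (split ℕ.≤-refl ℕ.≤-refl)))
  where
  open Values F closed
  open Arithmetic
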